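{- Let $M$ be a simple binary matroid that is not a binary comatroid but such that $M|F$ is a binary comatroid for every proper flat $F$ of $M$, and suppose $r(M)\ge 6$. Then $M$ or $M^c$ is a circuit.
   Context: All matroids are simple. Every simple binary matroid $M$ is uniquely $GF(2)$-representable, so for $k\ge r(M)$ one can write $M\cong PG(k-1,2)|T$, and the $(GF(2),k)$-complement of $M$ is $PG(k-1,2)\backslash T$ (well defined up to isomorphism); $M^c$ denotes the $(GF(2),r(M))$-complement of $M$. Binary comatroids are defined recursively: $U_{0,0}$ is one; the direct sum of two is one; and the $(GF(2),t)$-complement of one is one for every $t\ge r(M)$. -}

module Defs where

open import Data.Bool using (Bool; true; false; _∧_; _∨_; not; _xor_)
open import Data.Bool.Properties using () renaming (_≟_ to _≟ᵇ_)
open import Data.Nat using (ℕ; zero; suc; _+_; _≤_; _<_)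
open import Data.List using (List; []; _∷_; length; foldr; concatMap)
open import Data.Vec using (Vec; []; _∷_; replicate; zipWith; take; drop)
open import Data.Vec.Properties using (≡-dec)
open import Data.Product using (Σ; _×_; _,_; ∃)
open import Data.Sum using (_⊎_)
open import Data.Empty using (⊥)
open import Function.Bundles using (_⇔_)
open import Relation.Nullary using (¬_; does)
open import Relation.Binary.PropositionalEquality using (_≡_)

Pt : ℕ → Set
Pt k = Vec Bool k

𝟘 : ∀ {k} → Pt k
𝟘 = replicate _ false

_⊕ᵥ_ : ∀ {k} → Pt k → Pt k → Pt k
_⊕ᵥ_ = zipWith _xor_

isZero : ∀ {k} → Pt k → Bool
isZero [] = true
isZero (x ∷ xs) = not x ∧ isZero xs

_==_ : ∀ {k} → Pt k → Pt k → Bool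
x == y = does (≡-dec _≟ᵇ_ x y)

PSet : ℕ → Set
PSet k = Pt k → Bool

_∈_ : ∀ {k} → Pt k → PSet k → Set
x ∈ S = S x ≡ true

_∉_ : ∀ {k} → Pt k → PSet k → Set
x ∉ S = S x ≡ false

_⊆_ : ∀ {k} → PSet k → PSet k → Set
X ⊆ Y = ∀ x → x ∈ X → x ∈ Y

_∪｛_｝ : ∀ {k} → PSet k → Pt k → PSet k
(X ∪｛ e ｝) x = X x ∨ (x == e)

allPts : (k : ℕ) → List (Pt k)
allPts zero = [] ∷ []
allPts (suc k) = concatMap (λ v → (false ∷ v) ∷ (true ∷ v) ∷ []) (allPts k)

filt : ∀ {k} → PSet k → List (Pt k) → List (Pt k)
filt S [] = []
filt S (x ∷ xs) with S x
... | true  = x ∷ filt S xs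
... | false = filt S xs

elems : ∀ {k} → PSet k → List (Pt k)
elems {k} S = filt S (allPts k)

card : ∀ {k} → PSet k → ℕ
card S = length (elems S)

sumS : ∀ {k} → PSet k → Pt k
sumS S = foldr _⊕ᵥ_ 𝟘 (elems S)

-- The binary matroid M[T] on the point set T ⊆ GF(2)^k.

Indep : ∀ {k} → PSet k → Set
Indep X = ∀ Y → Y ⊆ X → (∃ λ y → y ∈ Y) → ¬ (sumS Y ≡ 𝟘)

-- simple: no loops (zero vector); no parallel pairs is automatic for sets
Simple : ∀ {k} → PSet k → Set
Simple T = ∀ x → x ∈ T → ¬ (x ≡ 𝟘)

Rank : ∀ {k} → PSet k → ℕ → Set
Rank X n = (∃ λ Y → Y ⊆ X × Indep Y × card Y ≡ n)
         × (∀ Y → Y ⊆ X → Indep Y → card Y ≤ n)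

record _≅_ {a b : ℕ} (T : PSet a) (T' : PSet b) : Set where
  field
    f    : Pt a → Pt b
    g    : Pt b → Pt a
    f∈   : ∀ x → x ∈ T → f x ∈ T'
    g∈   : ∀ y → y ∈ T' → g y ∈ T
    gf   : ∀ x → x ∈ T → g (f x) ≡ x
    fg   : ∀ y → y ∈ T' → f (g y) ≡ y
    -- the image f(X) of X ⊆ T is {y ∈ T' : g y ∈ X}
    indep : ∀ X → X ⊆ T → Indep X ⇔ Indep (λ y → T' y ∧ X (g y))

_⊕ₘ_ : ∀ {a b} → PSet a → PSet b → PSet (a + b)
(_⊕ₘ_ {a} {b} T₁ T₂) x =
  (T₁ (take a x) ∧ isZero (drop a x)) ∨ (isZero (take a x) ∧ T₂ (drop a x))

compl : (t : ℕ) → PSet t → PSet t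
compl t S x = not (isZero x) ∧ not (S x)

data Comat : ∀ {k} → PSet k → Set where
  empty : ∀ {k} {T : PSet k} → (∀ x → x ∉ T) → Comat T
  dsum  : ∀ {k a b} {T : PSet k} {T₁ : PSet a} {T₂ : PSet b} →
          Comat T₁ → Comat T₂ → T ≅ (T₁ ⊕ₘ T₂) → Comat T
  -- isomorphic to the (GF(2),t)-complement of a binary comatroid N:
  -- N ≅ PG(t-1,2)|S and T ≅ PG(t-1,2) \ S   (forces t ≥ r(N))
  cmpl  : ∀ {k j t} {T : PSet k} {N : PSet j} {S : PSet t} →
          Comat N → Simple S → N ≅ S → T ≅ compl t S → Comat T

Flat : ∀ {k} → PSet k → PSet k → Set
Flat T F = F ⊆ T × (∀ e → e ∈ T → e ∉ F →
             ∀ n m → Rank F n → Rank (F ∪｛ e ｝) m → n < m)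

ProperFlat : ∀ {k} → PSet k → PSet k → Set
ProperFlat T F = Flat T F × (∃ λ e → e ∈ T × e ∉ F)

IsCircuit : ∀ {k} → PSet k → Set
IsCircuit T = ¬ Indep T × (∀ X → X ⊆ T → (∃ λ e → e ∈ T × e ∉ X) → Indep X)

{-# OPTIONS --safe #-}
-- Passing to coordinates, let G be the point set and R its complement in V = PG(r-1,2). Call a subspace W
-- separated by G if G ∩ W lies in the union of two proper subspaces of W meeting in 0, i.e. if G ∩ W is
-- disconnected or does not span W. Comatroids are closed under direct sums and complements, so V is separated
-- neither by G nor by R, while the hypothesis on flats makes every proper nonzero subspace separated by G or R;
-- in dimension at least four the two alternatives exclude each other.
--
-- If a hyperplane H is separated by G and a section K of codimension one in H is not, then K is a part of the
-- separation and H \ K has at most one point of G. If there were hyperplanes of both types, this would happen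
-- for sufficiently generic hyperplanes with respect to one fixed hyperplane, and a generic hyperplane through
-- two points of one colour outside the fixed one would give a contradiction. So all hyperplanes have the same
-- type, say G. By descending induction on the dimension the same holds for all proper subspaces of dimension at
-- least four: for a maximal exception W, a minimal set of points of G outside W with a nonzero sum in W spans V
-- modulo W, and together with a suitable hyperplane of W it spans a hyperplane not separated by G. Finally, in
-- coordinates with respect to a basis contained in G, the support of any other point of G gives a circuit,
-- which has rank at most three or r; this forces G to consist of the basis and its sum.
--
-- Almost everything is proved under a double negation, which is harmless since being a circuit is stable.
module Submission where

open import Defs
open import Data.Bool using (Bool; true; false; _∧_; _∨_; not; _xor_)
open import Data.Bool.Properties using
  (xor-assoc; xor-comm; xor-same; xor-identityˡ; xor-identityʳ; ∧-comm; ∧-zeroʳ; ∧-identityʳ;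
   ∧-distribˡ-xor; ∨-zeroʳ; ¬-not) renaming (_≟_ to _≟ᵇ_)
open import Data.Empty using (⊥; ⊥-elim)
open import Data.Fin using (Fin; zero; suc; fromℕ<)
import Data.Fin.Properties as FP
open import Data.List as L using (List; []; _∷_; length; concatMap; foldr)
open import Data.List.Properties using (length-map; length-tabulate)
open import Data.List.Relation.Unary.All as LA using ([]; _∷_)
import Data.List.Relation.Unary.All.Properties as LAP
open import Data.List.Relation.Unary.AllPairs using ([]; _∷_)
import Data.List.Relation.Unary.Unique.DecPropositional as UniqueDec
open import Data.List.Relation.Unary.Unique.Propositional using (Unique)
import Data.List.Relation.Unary.Unique.Propositional.Properties as UP
open import Data.Nat using (ℕ; zero; suc; _+_; _≤_; _<_; z≤n; s≤s; _≤?_)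
open import Data.Nat.Properties using
  (≤-refl; ≤-trans; ≤-pred; ≤-reflexive; ≰⇒>; <-≤-trans; n≮n; n≤1+n; n≤0⇒n≡0; m≤m+n; m≤n+m; m≤n⇒m≤1+n;
   m≤n⇒m<n∨m≡n; +-suc; +-comm; +-assoc; +-identityʳ; +-mono-≤; +-monoˡ-≤; +-monoʳ-≤; +-cancelˡ-≤)
open import Data.Product using (_×_; _,_; ∃; proj₁; proj₂)
open import Data.Sum as Sum using (_⊎_; inj₁; inj₂; [_,_]′)
open import Data.Unit using (⊤; tt)
open import Data.Vec using
  (Vec; []; _∷_; replicate; zipWith; lookup; tail; map; tabulate; take; drop; fromList; toList; _++_)
open import Data.Vec.Properties using
  (≡-dec; zipWith-assoc; zipWith-comm; zipWith-identityˡ; zipWith-identityʳ; lookup-zipWith;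
   lookup-replicate; tabulate∘lookup; tabulate-cong; take-zipWith; drop-zipWith; length-toList)
open import Data.Vec.Relation.Unary.All as All using (All; []; _∷_)
import Data.Vec.Relation.Unary.All.Properties as AllP
open import Function using (_∘_; id)
open import Function.Bundles using (mk⇔; Equivalence)
open import Level using (Level)
open import Relation.Binary.PropositionalEquality using
  (_≡_; _≢_; _≗_; refl; sym; trans; cong; cong₂; subst; module ≡-Reasoning)
open import Relation.Nullary using (¬_; Dec; yes; no; does)
open import Relation.Nullary.Decidable using (¬¬-excluded-middle; decidable-stable; dec-true; from-yes; ¬?; _×-dec_)

-- Separation speaks of subspaces and points only: no ranks, flats or contractions enter the
-- geometric argument, and the notion is inherited along the recursive construction of comatroids.
-- The number four is where counting begins to bite: two separations of one space offer four parts
-- with at most three nonzero points each, and 12 < 15. The number six is four plus two, since the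
-- types of sections of codimension two are compared again and again; it returns as 4 + 2 when a
-- section of codimension four must have three points, and as 3 + 3 when at least three coordinates
-- must remain outside a support of size at most three. Two obstacles come from the form of the
-- statement. An isomorphism only preserves independence of sets, so unique representability has to
-- be proved: such a bijection preserves vanishing sums and therefore extends linearly to the spans.
-- And the disjunction in the conclusion, unlike its two sides, is not stable as such, so the choice
-- of the side is read off from the colours of three particular points.

variable
  ℓ : Level
  a b k l m n : ℕ

-- Vectors over GF(2) and their linear combinations

infixl 6 _⊕_
_⊕_ : Pt n → Pt n → Pt n
_⊕_ = _⊕ᵥ_

_≟ₚ_ : (x y : Pt n) → Dec (x ≡ y)
_≟ₚ_ = ≡-dec _≟ᵇ_

∧-true : ∀ {x y} → x ∧ y ≡ true → x ≡ true × y ≡ true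
∧-true {true} {true} _ = refl , refl

∧-true⁺ : ∀ {x y} → x ≡ true → y ≡ true → x ∧ y ≡ true
∧-true⁺ refl refl = refl

∨-true : ∀ {x y} → x ∨ y ≡ true → x ≡ true ⊎ y ≡ true
∨-true {true} _ = inj₁ refl
∨-true {false} e = inj₂ e

not-true : ∀ {x} → not x ≡ true → x ≡ false
not-true {false} _ = refl

bool-ext : ∀ {x y} → (x ≡ true → y ≡ true) → (y ≡ true → x ≡ true) → x ≡ y
bool-ext {true}  {true}  f g = refl
bool-ext {true}  {false} f g = sym (f refl)
bool-ext {false} {true}  f g = g refl
bool-ext {false} {false} f g = refl

contradict : ∀ {ℓ} {A : Set ℓ} {x} → x ≡ false → x ≡ true → A
contradict refl ()

≢true⇒≡false : ∀ {x} → x ≢ true → x ≡ false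
≢true⇒≡false = ¬-not

≢false⇒≡true : ∀ {x} → x ≢ false → x ≡ true
≢false⇒≡true = ¬-not

em : {P : Set ℓ} → ¬ ¬ Dec P
em = ¬¬-excluded-middle

⊕-assoc : (x y z : Pt n) → (x ⊕ y) ⊕ z ≡ x ⊕ (y ⊕ z)
⊕-assoc = zipWith-assoc xor-assoc

⊕-comm : (x y : Pt n) → x ⊕ y ≡ y ⊕ x
⊕-comm = zipWith-comm xor-comm

⊕-idˡ : (x : Pt n) → 𝟘 ⊕ x ≡ x
⊕-idˡ = zipWith-identityˡ xor-identityˡ

⊕-idʳ : (x : Pt n) → x ⊕ 𝟘 ≡ x
⊕-idʳ = zipWith-identityʳ xor-identityʳ

⊕-self : (x : Pt n) → x ⊕ x ≡ 𝟘
⊕-self []       = refl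
⊕-self (b ∷ x) = cong₂ _∷_ (xor-same b) (⊕-self x)

⊕-medial : (x y z w : Pt n) → (x ⊕ y) ⊕ (z ⊕ w) ≡ (x ⊕ z) ⊕ (y ⊕ w)
⊕-medial x y z w = begin
  (x ⊕ y) ⊕ (z ⊕ w) ≡⟨ ⊕-assoc x y (z ⊕ w) ⟩
  x ⊕ (y ⊕ (z ⊕ w)) ≡⟨ cong (x ⊕_) (sym (⊕-assoc y z w)) ⟩
  x ⊕ ((y ⊕ z) ⊕ w) ≡⟨ cong (λ u → x ⊕ (u ⊕ w)) (⊕-comm y z) ⟩
  x ⊕ ((z ⊕ y) ⊕ w) ≡⟨ cong (x ⊕_) (⊕-assoc z y w) ⟩
  x ⊕ (z ⊕ (y ⊕ w)) ≡⟨ sym (⊕-assoc x z (y ⊕ w)) ⟩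
  (x ⊕ z) ⊕ (y ⊕ w) ∎
  where open ≡-Reasoning

infixr 7 _·_
_·_ : Bool → Pt n → Pt n
true  · v = v
false · v = 𝟘

·-xor : ∀ b c (v : Pt n) → (b xor c) · v ≡ b · v ⊕ c · v
·-xor true  true  v = sym (⊕-self v)
·-xor true  false v = sym (⊕-idʳ v)
·-xor false c     v = sym (⊕-idˡ (c · v))

lin : Vec Bool m → Vec (Pt n) m → Pt n
lin []      []       = 𝟘
lin (b ∷ c) (v ∷ vs) = b · v ⊕ lin c vs

lin-𝟘 : (vs : Vec (Pt n) m) → lin 𝟘 vs ≡ 𝟘
lin-𝟘 []       = refl
lin-𝟘 (v ∷ vs) = trans (⊕-idˡ _) (lin-𝟘 vs)

lin-⊕ : (c d : Vec Bool m) (vs : Vec (Pt n) m) → lin (c ⊕ d) vs ≡ lin c vs ⊕ lin d vs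
lin-⊕ []      []      []       = sym (⊕-idˡ 𝟘)
lin-⊕ (b ∷ c) (e ∷ d) (v ∷ vs) = trans
  (cong₂ _⊕_ (·-xor b e v) (lin-⊕ c d vs))
  (⊕-medial (b · v) (e · v) (lin c vs) (lin d vs))

unit : Fin n → Pt n
unit zero    = true ∷ 𝟘
unit (suc i) = false ∷ unit i

lin-unit : (i : Fin m) (vs : Vec (Pt n) m) → lin (unit i) vs ≡ lookup vs i
lin-unit zero    (v ∷ vs) = trans (cong (v ⊕_) (lin-𝟘 vs)) (⊕-idʳ v)
lin-unit (suc i) (v ∷ vs) = trans (⊕-idˡ _) (lin-unit i vs)

-- A decision procedure for identities in groups of exponent two: compare the coefficient vectors.
data Expr (m : ℕ) : Set where
  var : Fin m → Expr m
  ⟨0⟩ : Expr m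
  _:+_ : Expr m → Expr m → Expr m

infixl 6 _:+_

⟦_⟧ : Expr m → Vec (Pt n) m → Pt n
⟦ var i ⟧ vs   = lookup vs i
⟦ ⟨0⟩ ⟧ vs     = 𝟘
⟦ e :+ f ⟧ vs = ⟦ e ⟧ vs ⊕ ⟦ f ⟧ vs

coeffs : Expr m → Vec Bool m
coeffs (var i)  = unit i
coeffs ⟨0⟩      = 𝟘
coeffs (e :+ f) = coeffs e ⊕ coeffs f

coeffs-sound : (e : Expr m) (vs : Vec (Pt n) m) → lin (coeffs e) vs ≡ ⟦ e ⟧ vs
coeffs-sound (var i)  vs = lin-unit i vs
coeffs-sound ⟨0⟩      vs = lin-𝟘 vs
coeffs-sound (e :+ f) vs =
  trans (lin-⊕ (coeffs e) (coeffs f) vs) (cong₂ _⊕_ (coeffs-sound e vs) (coeffs-sound f vs))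

solve : (vs : Vec (Pt n) m) (e f : Expr m) → coeffs e ≡ coeffs f → ⟦ e ⟧ vs ≡ ⟦ f ⟧ vs
solve vs e f eq =
  trans (sym (coeffs-sound e vs)) (trans (cong (λ c → lin c vs) eq) (coeffs-sound f vs))

pattern v₀ = var zero
pattern v₁ = var (suc zero)
pattern v₂ = var (suc (suc zero))
pattern v₃ = var (suc (suc (suc zero)))

⊕≡𝟘⇒≡ : (x y : Pt n) → x ⊕ y ≡ 𝟘 → x ≡ y
⊕≡𝟘⇒≡ x y e = trans (solve (x ∷ y ∷ []) v₀ ((v₀ :+ v₁) :+ v₁) refl) (trans (cong (_⊕ y) e) (⊕-idˡ y))

⊕-cancel : (x y : Pt n) → x ⊕ (x ⊕ y) ≡ y
⊕-cancel x y = solve (x ∷ y ∷ []) (v₀ :+ (v₀ :+ v₁)) v₁ refl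

-- Subspaces

-- Membership is an arbitrary proposition, so spans, images and intersections need no computation;
-- where a decision is wanted, finiteness supplies one under a double negation (`decide-Sub`).
record Sub (n : ℕ) : Set₁ where
  field
    mem : Pt n → Set
    𝟘∈  : mem 𝟘
    ⊕∈  : ∀ {x y} → mem x → mem y → mem (x ⊕ y)
open Sub public

·∈ : (W : Sub n) → ∀ b {v} → mem W v → mem W (b · v)
·∈ W true  v∈ = v∈
·∈ W false v∈ = 𝟘∈ W

lin∈ : (W : Sub n) (c : Vec Bool m) {vs : Vec (Pt n) m} → All (mem W) vs → mem W (lin c vs)
lin∈ W []      []         = 𝟘∈ W
lin∈ W (b ∷ c) (v∈ ∷ vs∈) = ⊕∈ W (·∈ W b v∈) (lin∈ W c vs∈)

⊕∈⁻ : (W : Sub n) {x y : Pt n} → mem W x → mem W (x ⊕ y) → mem W y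
⊕∈⁻ W {x} {y} x∈ xy∈ = subst (mem W) (⊕-cancel x y) (⊕∈ W x∈ xy∈)

full : Sub n
full = record { mem = λ _ → ⊤ ; 𝟘∈ = tt ; ⊕∈ = λ _ _ → tt }

nil : Sub n
nil = record
  { mem = _≡ 𝟘 ; 𝟘∈ = refl ; ⊕∈ = λ { refl refl → ⊕-self 𝟘 } }

infixr 7 _∩_
_∩_ : Sub n → Sub n → Sub n
A ∩ B = record
  { mem = λ x → mem A x × mem B x
  ; 𝟘∈ = 𝟘∈ A , 𝟘∈ B
  ; ⊕∈ = λ (a , b) (a′ , b′) → ⊕∈ A a a′ , ⊕∈ B b b′ }

infixl 6 _+lin_
_+lin_ : Sub n → Vec (Pt n) m → Sub n
_+lin_ {m = m} Y X = record
  { mem = λ v → ∃ λ y → ∃ λ (c : Vec Bool m) → mem Y y × v ≡ y ⊕ lin c X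
  ; 𝟘∈ = 𝟘 , 𝟘 , 𝟘∈ Y , sym (trans (⊕-idˡ _) (lin-𝟘 X))
  ; ⊕∈ = λ { (y , c , y∈ , refl) (y′ , c′ , y′∈ , refl) →
      y ⊕ y′ , c ⊕ c′ , ⊕∈ Y y∈ y′∈ ,
      trans (⊕-medial y (lin c X) y′ (lin c′ X)) (cong (y ⊕ y′ ⊕_) (sym (lin-⊕ c c′ X))) } }

⊆+lin : (Y : Sub n) (X : Vec (Pt n) m) → ∀ {y} → mem Y y → mem (Y +lin X) y
⊆+lin Y X {y} y∈ = y , 𝟘 , y∈ , sym (trans (cong (y ⊕_) (lin-𝟘 X)) (⊕-idʳ y))

span : Vec (Pt n) m → Sub n
span {m = m} vs = record
  { mem = λ v → ∃ λ c → lin c vs ≡ v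
  ; 𝟘∈ = 𝟘 , lin-𝟘 vs
  ; ⊕∈ = λ { (c , refl) (d , refl) → c ⊕ d , lin-⊕ c d vs } }

-- Linear functionals, represented by dot products

dot : Pt n → Pt n → Bool
dot []      []      = false
dot (a ∷ x) (b ∷ y) = (a ∧ b) xor dot x y

xor-medial : ∀ a b c d → (a xor b) xor (c xor d) ≡ (a xor c) xor (b xor d)
xor-medial a b c d = cong (λ v → lookup v zero) (⊕-medial (a ∷ []) (b ∷ []) (c ∷ []) (d ∷ []))

dot-⊕ʳ : (x y z : Pt n) → dot x (y ⊕ z) ≡ dot x y xor dot x z
dot-⊕ʳ []      []      []      = refl
dot-⊕ʳ (a ∷ x) (b ∷ y) (c ∷ z) = trans
  (cong₂ _xor_ (∧-distribˡ-xor a b c) (dot-⊕ʳ x y z))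
  (xor-medial (a ∧ b) (a ∧ c) (dot x y) (dot x z))

dot-comm : (x y : Pt n) → dot x y ≡ dot y x
dot-comm []      []      = refl
dot-comm (a ∷ x) (b ∷ y) = cong₂ _xor_ (∧-comm a b) (dot-comm x y)

dot-⊕ˡ : (x y z : Pt n) → dot (x ⊕ y) z ≡ dot x z xor dot y z
dot-⊕ˡ x y z = trans (dot-comm (x ⊕ y) z)
  (trans (dot-⊕ʳ z x y) (cong₂ _xor_ (dot-comm z x) (dot-comm z y)))

dot-𝟘ʳ : (x : Pt n) → dot x 𝟘 ≡ false
dot-𝟘ʳ []      = refl
dot-𝟘ʳ (a ∷ x) = cong₂ _xor_ (∧-zeroʳ a) (dot-𝟘ʳ x)

dot-𝟘ˡ : (x : Pt n) → dot 𝟘 x ≡ false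
dot-𝟘ˡ x = trans (dot-comm 𝟘 x) (dot-𝟘ʳ x)

dot-· : ∀ b (x y : Pt n) → dot (b · x) y ≡ b ∧ dot x y
dot-· true  x y = refl
dot-· false x y = dot-𝟘ˡ y

dot-unit : (i : Fin n) (x : Pt n) → dot (unit i) x ≡ lookup x i
dot-unit zero    (b ∷ x) = trans (cong (b xor_) (dot-𝟘ˡ x)) (xor-identityʳ b)
dot-unit (suc i) (b ∷ x) = dot-unit i x

ker : Pt n → Sub n
ker α = record
  { mem = λ x → dot α x ≡ false
  ; 𝟘∈ = dot-𝟘ʳ α
  ; ⊕∈ = λ {x} {y} p q → trans (dot-⊕ʳ α x y) (cong₂ _xor_ p q) }

ann : Pt n → Sub n
ann p = record
  { mem = λ α → dot α p ≡ false
  ; 𝟘∈ = dot-𝟘ˡ p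
  ; ⊕∈ = λ {x} {y} e f → trans (dot-⊕ˡ x y p) (cong₂ _xor_ e f) }

nonzero-coordinate : (x : Pt n) → x ≢ 𝟘 → ∃ λ i → lookup x i ≡ true
nonzero-coordinate []          ne = ⊥-elim (ne refl)
nonzero-coordinate (true ∷ x)  ne = zero , refl
nonzero-coordinate (false ∷ x) ne with nonzero-coordinate x (λ e → ne (cong (false ∷_) e))
... | i , e = suc i , e

lookup-ext : {A : Set} (x y : Vec A n) → (∀ i → lookup x i ≡ lookup y i) → x ≡ y
lookup-ext x y h = trans (sym (tabulate∘lookup x)) (trans (tabulate-cong h) (tabulate∘lookup y))

kills : List (Pt n) → Pt n → Set
kills ps x = LA.All (λ p → dot p x ≡ false) ps

-- Either no equation involves the first unknown, or one of them is used to eliminate it.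
eliminate : (ps : List (Pt (suc n))) →
  LA.All (λ p → lookup p zero ≡ false) ps ⊎
  (∃ λ p → ∃ λ qs → suc (length qs) ≡ length ps × (∀ x → kills qs x → kills ps (dot p x ∷ x)))
eliminate [] = inj₁ []
eliminate ((b ∷ q) ∷ ps) with eliminate ps
... | inj₂ (p , qs , len , h) = inj₂ (p , (q ⊕ b · p) ∷ qs , cong suc len , λ where
        x (e ∷ es) → trans (xor-comm (b ∧ dot p x) (dot q x))
          (trans (cong (dot q x xor_) (sym (dot-· b p x)))
            (trans (sym (dot-⊕ˡ q (b · p) x)) e)) ∷ h x es)
... | inj₁ h with b
...   | false = inj₁ (refl ∷ h)
...   | true  = inj₂ (q , L.map tail ps , cong suc (length-map tail ps) , λ x es →
          xor-same (dot q x) ∷ tails x ps h es)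
  where
  tails : ∀ x ps → LA.All (λ p → lookup p zero ≡ false) ps → kills (L.map tail ps) x →
          kills ps (dot q x ∷ x)
  tails x []                []         []       = []
  tails x ((_ ∷ p) ∷ ps) (refl ∷ h) (e ∷ es) = e ∷ tails x ps h es

homogeneous-solution : (ps : List (Pt n)) → length ps < n → ∃ λ x → x ≢ 𝟘 × kills ps x
homogeneous-solution {suc n} ps lt with eliminate ps
... | inj₁ h = true ∷ 𝟘 , (λ ()) , LA.map (λ { {_ ∷ p} refl → dot-𝟘ʳ p }) h
... | inj₂ (p , qs , len , h) with homogeneous-solution qs (≤-pred (subst (_< suc n) (sym len) lt))
...   | x , x≢𝟘 , e = dot p x ∷ x , (λ eq → x≢𝟘 (cong tail eq)) , h x e

-- Linear independence

Ind : Vec (Pt n) m → Set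
Ind vs = ∀ c → lin c vs ≡ 𝟘 → c ≡ 𝟘

lookup-lin : (c : Vec Bool m) (vs : Vec (Pt n) m) (i : Fin n) →
  lookup (lin c vs) i ≡ dot (map (λ v → lookup v i) vs) c
lookup-lin []      []       i = lookup-replicate i false
lookup-lin (b ∷ c) (v ∷ vs) i = trans (lookup-zipWith _xor_ i (b · v) (lin c vs))
  (cong₂ _xor_ (scale b) (lookup-lin c vs i))
  where
  scale : ∀ b → lookup (b · v) i ≡ lookup v i ∧ b
  scale true  = sym (∧-identityʳ (lookup v i))
  scale false = trans (lookup-replicate i false) (sym (∧-zeroʳ (lookup v i)))

-- Taken coordinatewise, a linear relation is a homogeneous system with one equation per coordinate
-- and one unknown per vector.
dependent : (vs : Vec (Pt n) m) → n < m → ∃ λ c → c ≢ 𝟘 × lin c vs ≡ 𝟘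
dependent {n} {m} vs lt
  with homogeneous-solution (L.tabulate (λ i → map (λ v → lookup v i) vs))
         (subst (_< m) (sym (length-tabulate _)) lt)
... | c , c≢𝟘 , es = c , c≢𝟘 , lookup-ext _ _ λ i →
      trans (lookup-lin c vs i) (trans (LAP.tabulate⁻ es i) (sym (lookup-replicate i false)))

extend-Ind : (W : Sub n) {v : Pt n} {vs : Vec (Pt n) m} →
  All (mem W) vs → ¬ mem W v → Ind vs → Ind (v ∷ vs)
extend-Ind W vs∈ v∉ ind (true  ∷ c) e =
  ⊥-elim (v∉ (subst (mem W) (sym (⊕≡𝟘⇒≡ _ _ e)) (lin∈ W c vs∈)))
extend-Ind W vs∈ v∉ ind (false ∷ c) e = cong (false ∷_) (ind c (trans (sym (⊕-idˡ _)) e))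

-- Once a solution w with nonzero coordinate i is found, the equation `unit i` joins the system: all
-- later solutions satisfy it and w does not, so w is independent of them.
independent-solutions : ∀ m (ps : List (Pt n)) → length ps + m ≤ n →
  ∃ λ (ws : Vec (Pt n) m) → Ind ws × All (kills ps) ws
independent-solutions zero    ps le = [] , (λ { [] _ → refl }) , []
independent-solutions {n} (suc m) ps le
  with homogeneous-solution ps (≤-trans (s≤s (m≤m+n _ m)) (subst (_≤ n) (+-suc _ m) le))
... | w , w≢𝟘 , wk with nonzero-coordinate w w≢𝟘
...   | i , wi with independent-solutions m (unit i ∷ ps) (subst (_≤ n) (+-suc _ m) le)
...     | ws , ind , wsk = w ∷ ws
          , extend-Ind (ker (unit i)) (All.map LA.head wsk)
              (λ e → contradict e (trans (dot-unit i w) wi)) ind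
          , wk ∷ All.map LA.tail wsk

Ind⇒spanning : (bs : Vec (Pt n) n) → Ind bs → ∀ v → ∃ λ c → lin c bs ≡ v
Ind⇒spanning bs ind v with dependent (v ∷ bs) ≤-refl
... | true  ∷ c , _ , e  = c , sym (⊕≡𝟘⇒≡ _ _ e)
... | false ∷ c , ne , e = ⊥-elim (ne (cong (false ∷_) (ind c (trans (sym (⊕-idˡ _)) e))))

lin-lin : (e : Vec Bool m) (cs : Vec (Vec Bool l) m) (D : Vec (Pt n) l) →
  lin (lin e cs) D ≡ lin e (map (λ c → lin c D) cs)
lin-lin []      []       D = lin-𝟘 D
lin-lin (b ∷ e) (c ∷ cs) D = trans (lin-⊕ (b · c) (lin e cs) D) (cong₂ _⊕_ (scale b) (lin-lin e cs D))
  where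
  scale : ∀ b → lin (b · c) D ≡ b · lin c D
  scale true  = refl
  scale false = lin-𝟘 D

-- Steinitz: the coefficient vectors of `ws` over `D` are too many to be independent, and their
-- relation carries over to `ws`.
exchange : {ws : Vec (Pt n) m} (D : Vec (Pt n) l) → l < m → Ind ws → ¬ All (mem (span D)) ws
exchange {n} {m} {l} {ws} D lt ind ws∈ with coordinates ws∈
  where
  coordinates : ∀ {m} {ws : Vec (Pt n) m} → All (mem (span D)) ws →
    ∃ λ (cs : Vec (Vec Bool l) m) → map (λ c → lin c D) cs ≡ ws
  coordinates []              = [] , refl
  coordinates ((c , e) ∷ ws∈) with coordinates ws∈
  ... | cs , es = c ∷ cs , cong₂ _∷_ e es
... | cs , refl with dependent cs lt
...   | e , ne , eq = ne (ind e (trans (sym (lin-lin e cs D)) (trans (cong (λ c → lin c D) eq) (lin-𝟘 D))))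

-- Dimensions are only ever bounded from below by this notion; an independent family inside the
-- subspace is a witness that survives every enlargement.
record Dim≥ (m : ℕ) (W : Sub n) : Set where
  constructor dim≥
  field
    {basis} : Vec (Pt n) m
    basis∈  : All (mem W) basis
    basis-Ind : Ind basis
open Dim≥ public

dim-⊆ : {W U : Sub n} → (∀ {x} → mem W x → mem U x) → Dim≥ m W → Dim≥ m U
dim-⊆ W⊆U (dim≥ ws∈ ind) = dim≥ (All.map W⊆U ws∈) ind

dim-pred : {W : Sub n} → Dim≥ (suc m) W → Dim≥ m W
dim-pred (dim≥ {v ∷ vs} (_ ∷ vs∈) ind) =
  dim≥ vs∈ λ c e → cong tail (ind (false ∷ c) (trans (⊕-idˡ _) e))

dim-suc : {W : Sub n} (U : Sub n) → (∀ {x} → mem W x → mem U x) → ∀ {u} → mem U u → ¬ mem W u →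
  Dim≥ m W → Dim≥ (suc m) U
dim-suc {W = W} U W⊆U u∈ u∉ (dim≥ ws∈ ind) = dim≥ (u∈ ∷ All.map W⊆U ws∈) (extend-Ind W ws∈ u∉ ind)

dim-nonzero : {W : Sub n} → Dim≥ (suc m) W → ∃ λ w → mem W w × w ≢ 𝟘
dim-nonzero (dim≥ {v ∷ vs} (v∈ ∷ _) ind) = v , v∈ , λ { refl →
  contradict (cong (λ c → lookup c zero) (ind (true ∷ 𝟘) (trans (⊕-idˡ _) (lin-𝟘 vs)))) refl }

dim-escape : {W : Sub n} (D : Vec (Pt n) m) → Dim≥ (suc m) W → ¬ (∀ {x} → mem W x → mem (span D) x)
dim-escape D (dim≥ ws∈ ind) W⊆ = exchange D ≤-refl ind (All.map W⊆ ws∈)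

-- A basis vector outside ker α corrects the later ones.
dim-cut : (α : Pt n) {W : Sub n} → Dim≥ (suc m) W → Dim≥ m (W ∩ ker α)
dim-cut {n} α {W} (dim≥ {vs} vs∈ ind) with cut vs vs∈
  where
  -- Passing from c to d carries independence from `vs` to `us`: a vanishing combination of `us` is
  -- one of `vs`, and d = 𝟘 must give back c = 𝟘.
  Refines : ∀ {m} → Vec (Pt n) (suc m) → Set
  Refines {m} vs = ∃ λ (us : Vec (Pt n) m) → All (mem (W ∩ ker α)) us ×
    (∀ c → ∃ λ d → lin c us ≡ lin d vs × (d ≡ 𝟘 → c ≡ 𝟘))

  pivot : ∀ {m} v (vs : Vec (Pt n) m) → mem W v → All (mem W) vs → dot α v ≡ true → Refines (v ∷ vs)
  pivot v [] v∈ [] αv = [] , [] , λ { [] → 𝟘 , sym (lin-𝟘 (v ∷ [])) , λ _ → refl }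
  pivot v (u ∷ vs) v∈ (u∈ ∷ vs∈) αv with pivot v vs v∈ vs∈ αv | dot α u in αu
  ... | us , us∈ , h | false = u ∷ us , (u∈ , αu) ∷ us∈ , λ { (b ∷ c) → combine b c (h c) }
    where
    combine : ∀ b c → (∃ λ d → lin c us ≡ lin d (v ∷ vs) × (d ≡ 𝟘 → c ≡ 𝟘)) →
      ∃ λ d → lin (b ∷ c) (u ∷ us) ≡ lin d (v ∷ u ∷ vs) × (d ≡ 𝟘 → b ∷ c ≡ 𝟘)
    combine b c (a ∷ d , e , z) = a ∷ b ∷ d ,
      trans (cong (b · u ⊕_) e) (solve (b · u ∷ a · v ∷ lin d vs ∷ []) (v₀ :+ (v₁ :+ v₂)) (v₁ :+ (v₀ :+ v₂)) refl) ,
      λ eq → cong₂ _∷_ (cong (λ x → lookup x (suc zero)) eq)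
        (z (cong₂ _∷_ (cong (λ x → lookup x zero) eq) (cong (λ x → tail (tail x)) eq)))
  ... | us , us∈ , h | true = (u ⊕ v) ∷ us ,
      (⊕∈ W u∈ v∈ , trans (dot-⊕ʳ α u v) (cong₂ _xor_ αu αv)) ∷ us∈ , λ { (b ∷ c) → combine b c (h c) }
    where
    combine : ∀ b c → (∃ λ d → lin c us ≡ lin d (v ∷ vs) × (d ≡ 𝟘 → c ≡ 𝟘)) →
      ∃ λ d → lin (b ∷ c) ((u ⊕ v) ∷ us) ≡ lin d (v ∷ u ∷ vs) × (d ≡ 𝟘 → b ∷ c ≡ 𝟘)
    combine true c (a ∷ d , e , z) = (true xor a) ∷ true ∷ d ,
      trans (cong (u ⊕ v ⊕_) e) (trans
        (solve (u ∷ v ∷ a · v ∷ lin d vs ∷ []) (v₀ :+ v₁ :+ (v₂ :+ v₃)) ((v₁ :+ v₂) :+ (v₀ :+ v₃)) refl)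
        (cong (_⊕ (u ⊕ lin d vs)) (sym (·-xor true a v)))) , λ ()
    combine false c (a ∷ d , e , z) = a ∷ false ∷ d ,
      trans (cong (𝟘 ⊕_) e) (solve (a · v ∷ lin d vs ∷ []) (⟨0⟩ :+ (v₀ :+ v₁)) (v₀ :+ (⟨0⟩ :+ v₁)) refl) ,
      λ eq → cong (false ∷_) (z (cong₂ _∷_ (cong (λ x → lookup x zero) eq) (cong (λ x → tail (tail x)) eq)))

  cut : ∀ {m} (vs : Vec (Pt n) (suc m)) → All (mem W) vs → Refines vs
  cut (v ∷ vs) (v∈ ∷ vs∈) with dot α v in αv
  ... | true = pivot v vs v∈ vs∈ αv
  cut (v ∷ []) (v∈ ∷ []) | false = [] , [] , λ { [] → 𝟘 , sym (lin-𝟘 (v ∷ [])) , λ _ → refl }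
  cut (v ∷ vs@(_ ∷ _)) (v∈ ∷ vs∈) | false with cut vs vs∈
  ... | us , us∈ , h = v ∷ us , (v∈ , αv) ∷ us∈ , λ { (b ∷ c) → let d , e , z = h c in
        b ∷ d , cong (b · v ⊕_) e , λ eq → cong₂ _∷_ (cong (λ x → lookup x zero) eq) (z (cong tail eq)) }
... | us , us∈ , h = dim≥ us∈ λ c e → let d , e′ , z = h c in z (ind d (trans (sym e′) e))

dim-full : Dim≥ n (full {n})
dim-full {n} with independent-solutions n [] ≤-refl
... | ws , ind , _ = dim≥ (All.universal (λ _ → tt) ws) ind

restrict : Sub (suc n) → Sub n
restrict W = record { mem = λ x → mem W (false ∷ x) ; 𝟘∈ = 𝟘∈ W ; ⊕∈ = ⊕∈ W }

-- Induction on the ambient dimension. A vector `true ∷ u` of W clears the leading coordinate of v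
-- and forces the leading coefficient `dot χ u`. If there is none, the first coordinate vanishes on
-- W, and it separates v unless v also begins with `false`.
separating-functional : (W : Sub n) (v : Pt n) → ¬ mem W v →
  ¬ ¬ (∃ λ χ → (∀ w → mem W w → dot χ w ≡ false) × dot χ v ≡ true)
separating-functional {zero}  W [] v∉ _ = v∉ (𝟘∈ W)
separating-functional {suc n} W (b ∷ v) v∉ ret = em {P = ∃ λ u → mem W (true ∷ u)} λ where
    (yes (u , u∈)) → separating-functional (restrict W) (v ⊕ b · u) (λ h → v∉ (undo b u∈ h)) λ
      (χ , kill , one) → ret (dot χ u ∷ χ , (λ where
          (false ∷ w) w∈ → trans (cong (_xor dot χ w) (∧-zeroʳ (dot χ u))) (kill w w∈)
          (true ∷ w) w∈ → trans (cong (_xor dot χ w) (∧-identityʳ (dot χ u)))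
            (trans (sym (dot-⊕ʳ χ u w)) (kill (u ⊕ w) (⊕∈ W u∈ w∈))))
        , trans (swap b χ u) one)
    (no none) → pick b v v∉ none ret
  where
  undo : ∀ b {u} → mem W (true ∷ u) → mem W (false ∷ (v ⊕ b · u)) → mem W (b ∷ v)
  undo true {u} u∈ h = subst (mem W) (cong (true ∷_) (solve (v ∷ u ∷ []) (v₀ :+ v₁ :+ v₁) v₀ refl)) (⊕∈ W h u∈)
  undo false u∈ h = subst (mem W) (cong (false ∷_) (⊕-idʳ v)) h

  swap : ∀ b χ u → (dot χ u ∧ b) xor dot χ v ≡ dot χ (v ⊕ b · u)
  swap b χ u = sym (trans (dot-⊕ʳ χ v (b · u)) (trans (xor-comm (dot χ v) _)
    (cong (_xor dot χ v) (trans (dot-comm χ (b · u)) (trans (dot-· b u χ)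
      (trans (cong (b ∧_) (dot-comm u χ)) (∧-comm b _)))))))

  pick : ∀ b v → ¬ mem W (b ∷ v) → ¬ (∃ λ u → mem W (true ∷ u)) →
    ¬ ¬ (∃ λ χ → (∀ w → mem W w → dot χ w ≡ false) × dot χ (b ∷ v) ≡ true)
  pick true v _ none ret = ret (true ∷ 𝟘 , (λ where
      (true ∷ w) w∈ → ⊥-elim (none (w , w∈))
      (false ∷ w) w∈ → dot-𝟘ˡ w)
    , cong not (dot-𝟘ˡ v))
  pick false v v∉ none ret = separating-functional (restrict W) v v∉ λ (χ , kill , one) →
    ret (false ∷ χ , (λ where
        (true ∷ w) w∈ → ⊥-elim (none (w , w∈))
        (false ∷ w) w∈ → kill w w∈)
      , one)

-- Double negation moves past this quantifier because `Pt n` is finite.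
dns : {P : Pt n → Set ℓ} → (∀ v → ¬ ¬ P v) → ¬ ¬ (∀ v → P v)
dns {zero}  h ret = h [] λ p → ret λ { [] → p }
dns {suc n} h ret = dns (λ v → h (true ∷ v)) λ ht → dns (λ v → h (false ∷ v)) λ hf →
  ret λ { (true ∷ v) → ht v ; (false ∷ v) → hf v }

decide-Sub : (W : Sub n) → ¬ ¬ (∀ v → Dec (mem W v))
decide-Sub W = dns λ v → em

-- Separations

-- `A` and `B` live in the whole space and only their traces on W matter, so the same pair serves a
-- smaller subspace as long as both parts stay proper there. `B` may be 0: this is the case where G
-- fails to span W.
record Sep (G : Pt n → Set) (W : Sub n) : Set₁ where
  field
    A B      : Sub n
    disjoint : ∀ {x} → mem W x → mem A x → mem B x → x ≡ 𝟘
    A-proper : ∃ λ w → mem W w × ¬ mem A w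
    B-proper : ∃ λ w → mem W w × ¬ mem B w
    cover    : ∀ {x} → mem W x → G x → mem A x ⊎ mem B x

Sep-cong : {G G′ : Pt n → Set} {W U : Sub n} → (∀ {x} → mem U x → G′ x → G x) →
  (∀ {x} → mem W x → mem U x) → (∀ {x} → mem U x → mem W x) → Sep G W → Sep G′ U
Sep-cong G′⊆G W⊆U U⊆W s = record
  { A = A ; B = B ; disjoint = disjoint ∘ U⊆W
  ; A-proper = let w , w∈ , w∉ = A-proper in w , W⊆U w∈ , w∉
  ; B-proper = let w , w∈ , w∉ = B-proper in w , W⊆U w∈ , w∉
  ; cover = λ u g → cover (U⊆W u) (G′⊆G u g) }
  where open Sep s

∩-comm : (A B : Sub n) → ∀ {x} → mem (A ∩ B) x → mem (B ∩ A) x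
∩-comm A B (a , b) = b , a

-- If both witnesses fail, each lies in the subspace that the other avoids, and their sum lies in
-- neither: a group is not the union of two proper subgroups.
outside-both : {U A B : Sub n} → (∃ λ x → mem U x × ¬ mem A x) → (∃ λ x → mem U x × ¬ mem B x) →
  ¬ ¬ (∃ λ x → mem U x × ¬ mem A x × ¬ mem B x)
outside-both {U = U} {A} {B} (a , a∈ , a∉A) (b , b∈ , b∉B) ret = em {P = mem B a} λ where
  (no a∉B) → ret (a , a∈ , a∉A , a∉B)
  (yes a∈B) → em {P = mem A b} λ where
    (no b∉A) → ret (b , b∈ , b∉A , b∉B)
    (yes b∈A) → ret (b ⊕ a , ⊕∈ U b∈ a∈ , a∉A ∘ ⊕∈⁻ A b∈A
      , λ h → b∉B (⊕∈⁻ B a∈B (subst (mem B) (⊕-comm b a) h)))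

-- Points of a four-dimensional space cannot be covered by two separations: counting shows that each of the
-- four parts would have at most three nonzero points.

-- Duplicate-free lists are used because the parts of a separation come without a decision procedure
-- and cannot be enumerated.
AtMost : ℕ → (Pt n → Set) → Set
AtMost k P = ∀ xs → Unique xs → LA.All P xs → length xs ≤ k

partition : {P Q S : Pt n → Set} → (∀ {x} → P x → Q x ⊎ S x) → ∀ xs → Unique xs → LA.All P xs →
  ∃ λ ys → ∃ λ zs → Unique ys × Unique zs × LA.All Q ys × LA.All S zs × length ys + length zs ≡ length xs
  × (∀ {R : Pt n → Set} → LA.All R xs → LA.All R ys × LA.All R zs)
partition f [] [] [] = [] , [] , [] , [] , [] , [] , refl , λ _ → [] , []
partition f (x ∷ xs) (x∉ ∷ u) (p ∷ ps) with partition f xs u ps | f p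
... | ys , zs , uy , uz , qs , ss , len , sub | inj₁ q =
      x ∷ ys , zs , proj₁ (sub x∉) ∷ uy , uz , q ∷ qs , ss , cong suc len ,
      λ { (r ∷ rs) → r ∷ proj₁ (sub rs) , proj₂ (sub rs) }
... | ys , zs , uy , uz , qs , ss , len , sub | inj₂ s =
      ys , x ∷ zs , uy , proj₂ (sub x∉) ∷ uz , qs , s ∷ ss , trans (+-suc _ _) (cong suc len) ,
      λ { (r ∷ rs) → proj₁ (sub rs) , r ∷ proj₂ (sub rs) }

atMost-∪ : {P Q S : Pt n → Set} → (∀ {x} → P x → Q x ⊎ S x) → AtMost k Q → AtMost l S → AtMost (k + l) P
atMost-∪ {k = k} {l} f bq bs xs u ps with partition f xs u ps
... | ys , zs , uy , uz , qs , ss , len , _ =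
      subst (_≤ k + l) len (+-mono-≤ (bq ys uy qs) (bs zs uz ss))

-- Two separations that together cover W. Disjointness holds within each pair only, while `A` may
-- meet `C`. The symmetries below allow every bound to be proved for `A` alone.
record Quad (W A B C D : Sub n) : Set where
  field
    cover : ∀ {x} → mem W x → (mem A x ⊎ mem B x) ⊎ (mem C x ⊎ mem D x)
    AB : ∀ {x} → mem W x → mem A x → mem B x → x ≡ 𝟘
    CD : ∀ {x} → mem W x → mem C x → mem D x → x ≡ 𝟘
    pA : ∃ λ x → mem W x × ¬ mem A x
    pB : ∃ λ x → mem W x × ¬ mem B x
    pC : ∃ λ x → mem W x × ¬ mem C x
    pD : ∃ λ x → mem W x × ¬ mem D x

swap-AB : {W A B C D : Sub n} → Quad W A B C D → Quad W B A C D
swap-AB q = record { cover = Sum.map₁ Sum.swap ∘ cover ; AB = λ w a b → AB w b a ; CD = CD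
                   ; pA = pB ; pB = pA ; pC = pC ; pD = pD }
  where open Quad q

swap-CD : {W A B C D : Sub n} → Quad W A B C D → Quad W A B D C
swap-CD q = record { cover = Sum.map₂ Sum.swap ∘ cover ; AB = AB ; CD = λ w a b → CD w b a
                   ; pA = pA ; pB = pB ; pC = pD ; pD = pC }
  where open Quad q

swap-pairs : {W A B C D : Sub n} → Quad W A B C D → Quad W C D A B
swap-pairs q = record { cover = Sum.swap ∘ cover ; AB = CD ; CD = AB
                      ; pA = pC ; pB = pD ; pC = pA ; pD = pB }
  where open Quad q

-- Translating k, k′ and 𝟘 by a point outside A and C puts two of them into one coset of B or of D.
quad-meet : {W A B C D : Sub n} → Quad W A B C D → ∀ {k k′} → mem W k → mem W k′ →
  mem A k → mem A k′ → mem C k → mem C k′ → k ≢ 𝟘 → k′ ≢ 𝟘 → k ≡ k′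
quad-meet {W = W} {A} {B} {C} {D} q {k} {k′} k∈ k′∈ kA k′A kC k′C k≢ k′≢ =
  decidable-stable (k ≟ₚ k′) λ k≢k′ → outside-both {U = W} {A} {C} pA pC λ (x , x∈ , x∉A , x∉C) →
    let
      side : ∀ {j} → mem W j → mem A j → mem C j → mem B (j ⊕ x) ⊎ mem D (j ⊕ x)
      side {j} j∈ jA jC = case (cover (⊕∈ W j∈ x∈)) (x∉A ∘ ⊕∈⁻ A jA) (x∉C ∘ ⊕∈⁻ C jC)
      sub₀ : ∀ (E : Sub _) {j} → mem E (𝟘 ⊕ x) → mem E (j ⊕ x) → mem E j
      sub₀ E {j} h h′ = subst (mem E) (solve (x ∷ j ∷ []) (⟨0⟩ :+ v₀ :+ (v₁ :+ v₀)) v₁ refl) (⊕∈ E h h′)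
      sub₁ : ∀ (E : Sub _) → mem E (k ⊕ x) → mem E (k′ ⊕ x) → mem E (k ⊕ k′)
      sub₁ E h h′ = subst (mem E) (solve (x ∷ k ∷ k′ ∷ []) (v₁ :+ v₀ :+ (v₂ :+ v₀)) (v₁ :+ v₂) refl) (⊕∈ E h h′)
      kk′B = λ h → k≢k′ (⊕≡𝟘⇒≡ k k′ (AB (⊕∈ W k∈ k′∈) (⊕∈ A kA k′A) h))
      kk′D = λ h → k≢k′ (⊕≡𝟘⇒≡ k k′ (CD (⊕∈ W k∈ k′∈) (⊕∈ C kC k′C) h))
    in pigeon (side (𝟘∈ W) (𝟘∈ A) (𝟘∈ C)) (side k∈ kA kC) (side k′∈ k′A k′C)
         (λ h h′ → k≢ (AB k∈ kA (sub₀ B h h′))) (λ h h′ → k′≢ (AB k′∈ k′A (sub₀ B h h′))) (λ h h′ → kk′B (sub₁ B h h′))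
         (λ h h′ → k≢ (CD k∈ kC (sub₀ D h h′))) (λ h h′ → k′≢ (CD k′∈ k′C (sub₀ D h h′))) (λ h h′ → kk′D (sub₁ D h h′))
  where
  open Quad q
  case : ∀ {P Q R S : Set} → (P ⊎ Q) ⊎ (R ⊎ S) → ¬ P → ¬ R → Q ⊎ S
  case (inj₁ (inj₁ p)) ¬p ¬r = ⊥-elim (¬p p)
  case (inj₁ (inj₂ q)) ¬p ¬r = inj₁ q
  case (inj₂ (inj₁ r)) ¬p ¬r = ⊥-elim (¬r r)
  case (inj₂ (inj₂ s)) ¬p ¬r = inj₂ s
  pigeon : ∀ {P₁ P₂ P₃ Q₁ Q₂ Q₃ : Set} → P₁ ⊎ Q₁ → P₂ ⊎ Q₂ → P₃ ⊎ Q₃ →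
    (P₁ → P₂ → ⊥) → (P₁ → P₃ → ⊥) → (P₂ → P₃ → ⊥) →
    (Q₁ → Q₂ → ⊥) → (Q₁ → Q₃ → ⊥) → (Q₂ → Q₃ → ⊥) → ⊥
  pigeon (inj₁ a) (inj₁ b) _        f g h f′ g′ h′ = f a b
  pigeon (inj₁ a) (inj₂ b) (inj₁ c) f g h f′ g′ h′ = g a c
  pigeon (inj₁ a) (inj₂ b) (inj₂ c) f g h f′ g′ h′ = h′ b c
  pigeon (inj₂ a) (inj₂ b) _        f g h f′ g′ h′ = f′ a b
  pigeon (inj₂ a) (inj₁ b) (inj₁ c) f g h f′ g′ h′ = h b c
  pigeon (inj₂ a) (inj₁ b) (inj₂ c) f g h f′ g′ h′ = g′ a c

-- Translate W ∩ A by a point x outside A. The translate misses A, so it is distributed over B, C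
-- and D: at most one point in B, since A ∩ B is 0, and at most two in each of C and D, since A
-- meets each of them in at most one nonzero point. Hence 1 + 2 + 2.
quad-bound₅ : {W A B C D : Sub n} → Quad W A B C D → AtMost 5 (mem (W ∩ A))
quad-bound₅ {n} {W} {A} {B} {C} {D} q with Quad.pA q
... | x , x∈ , x∉ = atMost-∪ {S = λ w → coset C w ⊎ coset D w} split one (atMost-∪ id (two q) (two (swap-CD q)))
  where
  open Quad q using (cover; AB)
  coset : Sub n → Pt n → Set
  coset E w = mem (W ∩ A) w × mem E (w ⊕ x)
  split : ∀ {w} → mem (W ∩ A) w → coset B w ⊎ (coset C w ⊎ coset D w)
  split wWA@(w∈ , wA) with cover (⊕∈ W w∈ x∈)
  ... | inj₁ (inj₁ h) = ⊥-elim (x∉ (⊕∈⁻ A wA h))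
  ... | inj₁ (inj₂ h) = inj₁ (wWA , h)
  ... | inj₂ (inj₁ h) = inj₂ (inj₁ (wWA , h))
  ... | inj₂ (inj₂ h) = inj₂ (inj₂ (wWA , h))
  sum∈ : ∀ (E : Sub n) {w w′} → mem E (w ⊕ x) → mem E (w′ ⊕ x) → mem E (w ⊕ w′)
  sum∈ E {w} {w′} h h′ =
    subst (mem E) (solve (x ∷ w ∷ w′ ∷ []) (v₁ :+ v₀ :+ (v₂ :+ v₀)) (v₁ :+ v₂) refl) (⊕∈ E h h′)
  one : AtMost 1 (coset B)
  one [] _ _ = z≤n
  one (_ ∷ []) _ _ = s≤s z≤n
  one (w ∷ w′ ∷ _) ((w≢w′ ∷ _) ∷ _) (((w∈ , wA) , wB) ∷ ((w′∈ , w′A) , w′B) ∷ _) =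
    ⊥-elim (w≢w′ (⊕≡𝟘⇒≡ w w′ (AB (⊕∈ W w∈ w′∈) (⊕∈ A wA w′A) (sum∈ B wB w′B))))
  two : ∀ {C D} → Quad W A B C D → AtMost 2 (coset C)
  two q [] _ _ = z≤n
  two q (_ ∷ []) _ _ = s≤s z≤n
  two q (_ ∷ _ ∷ []) _ _ = s≤s (s≤s z≤n)
  two {C} q (u ∷ v ∷ w ∷ _) ((u≢v ∷ u≢w ∷ _) ∷ (v≢w ∷ _) ∷ _)
    (((u∈ , uA) , uC) ∷ ((v∈ , vA) , vC) ∷ ((w∈ , wA) , wC) ∷ _) =
    ⊥-elim (v≢w (trans (sym (⊕-cancel u v)) (trans (cong (u ⊕_)
      (quad-meet q (⊕∈ W u∈ v∈) (⊕∈ W u∈ w∈) (⊕∈ A uA vA) (⊕∈ A uA wA) (sum∈ C uC vC) (sum∈ C uC wC)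
        (u≢v ∘ ⊕≡𝟘⇒≡ u v) (u≢w ∘ ⊕≡𝟘⇒≡ u w))) (⊕-cancel u w))))

⊕-cancel-≢ : {x y : Pt n} → y ≢ 𝟘 → x ≢ x ⊕ y
⊕-cancel-≢ {x = x} {y} y≢𝟘 e = y≢𝟘 (trans (sym (⊕-cancel x y)) (trans (cong (x ⊕_) (sym e)) (⊕-self x)))

quad-no-six : {W A B C D : Sub n} → Quad W A B C D → ∀ {a b c} →
  mem (W ∩ A) a → mem (W ∩ A) b → mem (W ∩ A) c → a ≢ 𝟘 → b ≢ 𝟘 → c ≢ 𝟘 →
  a ≢ b → a ≢ c → b ≢ c → c ≢ a ⊕ b → ⊥
quad-no-six {W = W} {A} q {a} {b} {c} a∈ b∈ c∈ a≢𝟘 b≢𝟘 c≢𝟘 a≢b a≢c b≢c c≢ab = n≮n 5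
  (quad-bound₅ q (𝟘 ∷ a ∷ b ∷ c ∷ a ⊕ b ∷ a ⊕ c ∷ [])
    ( (a≢𝟘 ∘ sym ∷ b≢𝟘 ∘ sym ∷ c≢𝟘 ∘ sym ∷ a≢b ∘ ⊕≡𝟘⇒≡ a b ∘ sym ∷ a≢c ∘ ⊕≡𝟘⇒≡ a c ∘ sym ∷ [])
    ∷ (a≢b ∷ a≢c ∷ ⊕-cancel-≢ b≢𝟘 ∷ ⊕-cancel-≢ c≢𝟘 ∷ [])
    ∷ (b≢c ∷ (λ e → ⊕-cancel-≢ a≢𝟘 (trans e (⊕-comm a b)))
        ∷ (λ e → c≢ab (trans (sym (⊕-cancel a c)) (cong (a ⊕_) (sym e)))) ∷ [])
    ∷ (c≢ab ∷ (λ e → ⊕-cancel-≢ a≢𝟘 (trans e (⊕-comm a c))) ∷ [])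
    ∷ ((λ e → b≢c (trans (sym (⊕-cancel a b)) (trans (cong (a ⊕_) e) (⊕-cancel a c)))) ∷ [])
    ∷ [] ∷ [])
    (𝟘∈ (W ∩ A) ∷ a∈ ∷ b∈ ∷ c∈ ∷ ⊕∈ (W ∩ A) a∈ b∈ ∷ ⊕∈ (W ∩ A) a∈ c∈ ∷ []))

-- A subspace with at most five points has at most four: otherwise 𝟘, a, b, c, a + b, a + c would be
-- six.
quad-bound₃ : {W A B C D : Sub n} → Quad W A B C D → AtMost 3 (λ x → mem (W ∩ A) x × x ≢ 𝟘)
quad-bound₃ q [] _ _ = z≤n
quad-bound₃ q (_ ∷ []) _ _ = s≤s z≤n
quad-bound₃ q (_ ∷ _ ∷ []) _ _ = s≤s (s≤s z≤n)
quad-bound₃ q (_ ∷ _ ∷ _ ∷ []) _ _ = s≤s (s≤s (s≤s z≤n))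
quad-bound₃ q (a ∷ b ∷ c ∷ d ∷ _)
  ((a≢b ∷ a≢c ∷ a≢d ∷ _) ∷ (b≢c ∷ b≢d ∷ _) ∷ (c≢d ∷ _) ∷ _)
  ((a∈ , a≢𝟘) ∷ (b∈ , b≢𝟘) ∷ (c∈ , c≢𝟘) ∷ (d∈ , d≢𝟘) ∷ _) with c ≟ₚ (a ⊕ b)
-- If c is a + b, then d is not, and d takes its place.
... | yes refl = ⊥-elim (quad-no-six q a∈ b∈ d∈ a≢𝟘 b≢𝟘 d≢𝟘 a≢b a≢d b≢d (c≢d ∘ sym))
... | no c≢ab  = ⊥-elim (quad-no-six q a∈ b∈ c∈ a≢𝟘 b≢𝟘 c≢𝟘 a≢b a≢c b≢c c≢ab)

no-quad : {W A B C D : Sub n} → Dim≥ 4 W → ¬ Quad W A B C D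
no-quad {n} {W} {A} {B} {C} {D} (dim≥ {ws} ws∈ ind) q = n≮n 12 (≤-trans 13≤15 (count points unique points∈))
  where
  lin-injective : ∀ {c d} → lin c ws ≡ lin d ws → c ≡ d
  lin-injective {c} {d} e = ⊕≡𝟘⇒≡ c d (ind (c ⊕ d)
    (trans (lin-⊕ c d ws) (trans (cong (_⊕ lin d ws) e) (⊕-self _))))

  masks : List (Pt 4)
  -- The zero vector comes first in `allPts 4`; dropping it leaves the fifteen nonzero coefficient
  -- vectors.
  masks = L.drop 1 (allPts 4)

  masks≢𝟘 : LA.All (_≢ 𝟘) masks
  masks≢𝟘 = from-yes (LA.all? (λ c → ¬? (c ≟ₚ 𝟘)) masks)

  points : List (Pt n)
  points = L.map (λ c → lin c ws) masks

  13≤15 : 13 ≤ length points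
  13≤15 = m≤m+n 13 2

  unique : Unique points
  unique = UP.map⁺ lin-injective (from-yes (UniqueDec.unique? _≟ₚ_ masks))

  points∈ : LA.All (λ x → mem W x × x ≢ 𝟘) points
  points∈ = LAP.map⁺ (LA.map (λ {c} c≢𝟘 → lin∈ W c ws∈ , c≢𝟘 ∘ ind c) masks≢𝟘)

  part : Sub n → Pt n → Set
  part E x = mem (W ∩ E) x × x ≢ 𝟘

  count : AtMost 12 (λ x → mem W x × x ≢ 𝟘)
  count = atMost-∪ {Q = λ x → part A x ⊎ part B x} {S = λ x → part C x ⊎ part D x}
    (λ (x∈ , x≢𝟘) → Sum.map (Sum.map (λ h → (x∈ , h) , x≢𝟘) (λ h → (x∈ , h) , x≢𝟘))
                             (Sum.map (λ h → (x∈ , h) , x≢𝟘) (λ h → (x∈ , h) , x≢𝟘)) (Quad.cover q x∈))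
    (atMost-∪ id (quad-bound₃ q) (quad-bound₃ (swap-AB q)))
    (atMost-∪ id (quad-bound₃ (swap-pairs q)) (quad-bound₃ (swap-AB (swap-pairs q))))

-- Exclusion of hyperplanes of different types

Total : (G R : Pt n → Set) → Set
Total G R = ∀ x → x ≢ 𝟘 → G x ⊎ R x

Sep-exclusive : {G R : Pt n → Set} {W : Sub n} → Total G R → Dim≥ 4 W → Sep G W → ¬ Sep R W
Sep-exclusive {G = G} {R} {W} total d s t = no-quad {A = Sep.A s} {Sep.B s} {Sep.A t} {Sep.B t} d record
  { cover = cover ; AB = S.disjoint ; CD = T.disjoint
  ; pA = S.A-proper ; pB = S.B-proper ; pC = T.A-proper ; pD = T.B-proper }
  where
  module S = Sep s
  module T = Sep t
  cover : ∀ {x} → mem W x → (mem S.A x ⊎ mem S.B x) ⊎ (mem T.A x ⊎ mem T.B x)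
  cover {x} x∈ with x ≟ₚ 𝟘
  ... | yes refl = inj₁ (inj₁ (𝟘∈ S.A))
  ... | no x≢𝟘   = Sum.map (S.cover x∈) (T.cover x∈) (total x x≢𝟘)

-- What remains of a separation of `ker α` once the section by `ker β` has become one of its parts:
-- the first functional names the hyperplane, the second the section. With α = 𝟘 the hyperplane is
-- the whole space.
record One (G : Pt n → Set) (α β : Pt n) : Set where
  constructor mkOne
  field
    one! : ∀ {x y} → G x → G y → dot α x ≡ false → dot α y ≡ false →
      dot β x ≡ true → dot β y ≡ true → x ≡ y
open One

dot-true⇒≢𝟘 : {α x : Pt n} → dot α x ≡ true → x ≢ 𝟘
dot-true⇒≢𝟘 {α = α} e refl with trans (sym e) (dot-𝟘ʳ α)
... | ()

dot-sum : (α : Pt n) {x y : Pt n} {b c : Bool} → dot α x ≡ b → dot α y ≡ c → dot α (x ⊕ y) ≡ b xor c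
dot-sum α {x} {y} p q = trans (dot-⊕ʳ α x y) (cong₂ _xor_ p q)

-- One part of the separation contains the section K, hence equals K, and the other part meets K only in 𝟘.
flag : {G : Pt n → Set} {α β : Pt n} → Sep G (ker α) → ¬ Sep G (ker α ∩ ker β) → One G α β
flag {n} {G} {α} {β} s ns = mkOne λ {x} {y} gx gy αx αy βx βy →
  decidable-stable (x ≟ₚ y) λ x≢y →
    em {P = ∃ λ w → mem K w × ¬ mem A w} λ where
      (no K⊆A) → side A B disjoint A-proper cover K⊆A gx gy αx αy βx βy x≢y
      (yes pA) → em {P = ∃ λ w → mem K w × ¬ mem B w} λ where
        (no K⊆B) → side B A (λ k b a → disjoint k a b) B-proper (λ k g → Sum.swap (cover k g)) K⊆B gx gy αx αy βx βy x≢y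
        (yes pB) → ns record { A = A ; B = B ; disjoint = disjoint ∘ proj₁ ; A-proper = pA ; B-proper = pB
                             ; cover = cover ∘ proj₁ }
  where
  open Sep s
  K = ker α ∩ ker β
  side : (A B : Sub n) → (∀ {x} → mem (ker α) x → mem A x → mem B x → x ≡ 𝟘) →
    (∃ λ w → mem (ker α) w × ¬ mem A w) → (∀ {x} → mem (ker α) x → G x → mem A x ⊎ mem B x) →
    ¬ (∃ λ w → mem K w × ¬ mem A w) → ∀ {x y} → G x → G y → dot α x ≡ false → dot α y ≡ false →
    dot β x ≡ true → dot β y ≡ true → x ≢ y → ⊥
  side A B disj (w , αw , w∉) cov K⊆A {x} {y} gx gy αx αy βx βy x≢y = go (cov αx gx) (cov αy gy)
    where
    -- K and one point off `ker β` generate `ker α`, so such a point in A would bring w into A.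
    ∉A : ∀ {z} → dot α z ≡ false → dot β z ≡ true → ¬ mem A z
    ∉A {z} αz βz z∈ with dot β w in βw
    ... | false = K⊆A (w , (αw , βw) , w∉)
    ... | true  = K⊆A (z ⊕ w , (dot-sum α αz αw , dot-sum β βz βw) , λ h → w∉ (⊕∈⁻ A z∈ h))
    go : mem A x ⊎ mem B x → mem A y ⊎ mem B y → ⊥
    go (inj₁ xA) _ = ∉A αx βx xA
    go (inj₂ _) (inj₁ yA) = ∉A αy βy yA
    go (inj₂ xB) (inj₂ yB) = K⊆A (x ⊕ y , (dot-sum α αx αy , dot-sum β βx βy) ,
      λ h → x≢y (⊕≡𝟘⇒≡ x y (disj (dot-sum α αx αy) h (⊕∈ B xB yB))))

-- The parts are `ker β` and the exceptional point together with 𝟘. The point need not be found: the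
-- set of candidates is already closed under addition, because any two candidates coincide. As W may
-- be any subspace of `ker α`, the separation is available for sections too.
One⇒Sep : {G : Pt n → Set} {α β : Pt n} (W : Sub n) → (∀ {x} → mem W x → dot α x ≡ false) → One G α β →
  (∃ λ w → mem W w × dot β w ≡ true) → (∃ λ w → mem (W ∩ ker β) w × w ≢ 𝟘) → Sep G W
One⇒Sep {n} {G} {α} {β} W W⊆α one (u , u∈ , βu) (v , (v∈ , βv) , v≢𝟘) = record
  { A = ker β ; B = B
  ; disjoint = λ where
      _ _ (inj₁ e) → e
      _ βx (inj₂ (_ , _ , βx′)) → contradict βx βx′
  ; A-proper = u , u∈ , λ h → contradict h βu
  ; B-proper = v , v∈ , λ where
      (inj₁ e) → v≢𝟘 e
      (inj₂ (_ , _ , βv′)) → contradict βv βv′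
  ; cover = λ {x} x∈ gx → split x∈ gx (dot β x) refl }
  where
  P : Pt n → Set
  P x = x ≡ 𝟘 ⊎ (G x × dot α x ≡ false × dot β x ≡ true)
  B : Sub n
  B = record
    { mem = P
    ; 𝟘∈ = inj₁ refl
    ; ⊕∈ = λ where
        (inj₁ refl) y∈ → subst P (sym (⊕-idˡ _)) y∈
        x∈ (inj₁ refl) → subst P (sym (⊕-idʳ _)) x∈
        (inj₂ (g , a , b)) (inj₂ (g′ , a′ , b′)) → inj₁ (trans (cong (_ ⊕_) (one! one g′ g a′ a b′ b)) (⊕-self _)) }
  split : ∀ {x} → mem W x → G x → ∀ b → dot β x ≡ b → dot β x ≡ false ⊎ mem B x
  split x∈ gx false e = inj₁ e
  split x∈ gx true e = inj₂ (inj₂ (gx , W⊆α x∈ , e))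

-- Separating α from the span of the remaining functionals gives a vector χ dual to α: adding χ
-- changes the value of α and no other.
values : (αs : Vec (Pt n) m) → Ind αs → ∀ t → ¬ ¬ (∃ λ w → map (λ α → dot α w) αs ≡ t)
values [] ind [] ret = ret (𝟘 , refl)
values (α ∷ αs) ind (b ∷ t) ret =
  separating-functional (span αs) α (λ (c , e) → head≢ (ind (true ∷ c) (trans (cong (α ⊕_) e) (⊕-self α))))
    λ (χ , kill , one) → values αs (λ c e → cong tail (ind (false ∷ c) (trans (⊕-idˡ _) e))) t
      λ (w , e) → ret ((b xor dot α w) · χ ⊕ w , cong₂ _∷_
        (trans (dot-⊕ʳ α ((b xor dot α w) · χ) w)
          (trans (cong (_xor dot α w) (trans (dot-comm α _) (trans (dot-· _ χ α)
            (trans (cong ((b xor dot α w) ∧_) one) (∧-identityʳ _)))))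
            (trans (xor-assoc b (dot α w) (dot α w)) (trans (cong (b xor_) (xor-same (dot α w))) (xor-identityʳ b)))))
        (trans (unchanged χ w (b xor dot α w) αs (λ i → trans (dot-comm (lookup αs i) χ)
          (kill _ (unit i , lin-unit i αs)))) e))
  where
  head≢ : ∀ {c : Vec Bool m} → true ∷ c ≢ 𝟘
  head≢ ()
  unchanged : ∀ {m} χ w b (αs : Vec (Pt _) m) → (∀ i → dot (lookup αs i) χ ≡ false) →
    map (λ α → dot α (b · χ ⊕ w)) αs ≡ map (λ α → dot α w) αs
  unchanged χ w b [] h = refl
  unchanged χ w b (α ∷ αs) h = cong₂ _∷_
    (trans (dot-⊕ʳ α (b · χ) w) (cong (_xor dot α w) (trans (dot-comm α _) (trans (dot-· b χ α)
      (trans (cong (b ∧_) (trans (dot-comm χ α) (h zero))) (∧-zeroʳ b))))))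
    (unchanged χ w b αs (h ∘ suc))

dim-kills : ∀ m (ps : List (Pt n)) {W : Sub n} → length ps + m ≤ n → (∀ {x} → kills ps x → mem W x) → Dim≥ m W
dim-kills m ps le h with independent-solutions m ps le
... | ws , ind , k = dim≥ (All.map h k) ind

-- Four independent functionals do not fit into the span of three, so U leaves each exceptional
-- span, and two proper subspaces do not cover it.
avoid : {U : Sub n} → Dim≥ 4 U → (D₁ : Vec (Pt n) k) (D₂ : Vec (Pt n) l) → k ≤ 3 → l ≤ 3 →
  ¬ ¬ (∃ λ χ → mem U χ × ¬ mem (span D₁) χ × ¬ mem (span D₂) χ)
avoid {n} {U = U} d D₁ D₂ k≤3 l≤3 ret =
  em {P = ∃ λ χ → mem U χ × ¬ mem (span D₁) χ} λ where
    (no U⊆) → escape D₁ k≤3 U⊆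
    (yes e₁) → em {P = ∃ λ χ → mem U χ × ¬ mem (span D₂) χ} λ where
      (no U⊆) → escape D₂ l≤3 U⊆
      (yes e₂) → outside-both {U = U} {span D₁} {span D₂} e₁ e₂ ret
  where
  escape : ∀ {k} (D : Vec (Pt n) k) → k ≤ 3 → ¬ (∃ λ χ → mem U χ × ¬ mem (span D) χ) → ⊥
  escape D k≤3 U⊆ = decide-Sub (span D) λ dec →
    exchange D (s≤s k≤3) (basis-Ind d) (All.map (λ {x} x∈ → decidable-stable (dec x) λ x∉ → U⊆ (x , x∈ , x∉)) (basis∈ d))

-- The whole space is `ker 𝟘`, so `One⇒Sep` applies to it directly.
almost-empty⇒Sep : {G : Pt n → Set} {φ : Pt n} → 2 ≤ n → φ ≢ 𝟘 → One G 𝟘 φ → Sep G full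
almost-empty⇒Sep {φ = φ} 2≤n φ≢𝟘 one with nonzero-coordinate φ φ≢𝟘 | homogeneous-solution (φ ∷ []) 2≤n
... | i , φi | v , v≢𝟘 , e ∷ [] = One⇒Sep {α = 𝟘} {β = φ} full (λ {x} _ → dot-𝟘ˡ x) one
  (unit i , tt , trans (dot-comm φ (unit i)) (trans (dot-unit i φ) φi)) (v , (tt , e) , v≢𝟘)

-- Two points of G off the hyperplane ker φ lie in a common hyperplane ker χ outside the exceptional sets.
generic-sections : {G : Pt n → Set} {φ : Pt n} → 6 ≤ n → φ ≢ 𝟘 → ¬ Sep G full →
  (D₁ : Vec (Pt n) k) (D₂ : Vec (Pt n) l) → k ≤ 3 → l ≤ 3 →
  ¬ (∀ χ → ¬ mem (span D₁) χ → ¬ mem (span D₂) χ → ¬ ¬ One G χ φ)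
generic-sections {n} {G = G} {φ} 6≤n φ≢𝟘 ns D₁ D₂ k≤3 l≤3 h =
  ns (almost-empty⇒Sep (≤-trans (m≤m+n 2 4) 6≤n) φ≢𝟘 (mkOne λ {p} {q} gp gq _ _ φp φq →
    decidable-stable (p ≟ₚ q) λ p≢q →
      avoid {U = ann p ∩ ann q} (dim-kills 4 (p ∷ q ∷ []) 6≤n λ { {x} (e ∷ e′ ∷ []) →
          trans (dot-comm x p) e , trans (dot-comm x q) e′ }) D₁ D₂ k≤3 l≤3
        λ (χ , (χp , χq) , χ∉₁ , χ∉₂) → h χ χ∉₁ χ∉₂ λ one → p≢q (one! one gp gq χp χq φp φq)))

-- The entire input of the geometric argument, symmetric in G and R so that each case has to be
-- treated for one colour only.
record Setting (n : ℕ) (G R : Pt n → Set) : Set₁ where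
  field
    6≤n   : 6 ≤ n
    total : Total G R
    G-nonsep : ¬ Sep G full
    R-nonsep : ¬ Sep R full
    types : (W : Sub n) → (∃ λ w → mem W w × w ≢ 𝟘) → (∃ λ v → ¬ mem W v) → ¬ ¬ (Sep G W ⊎ Sep R W)

Setting-swap : {G R : Pt n → Set} → Setting n G R → Setting n R G
Setting-swap s = record
  { 6≤n = 6≤n ; total = λ x x≢𝟘 → Sum.swap (total x x≢𝟘) ; G-nonsep = R-nonsep ; R-nonsep = G-nonsep
  ; types = λ W p q ret → types W p q (ret ∘ Sum.swap) }
  where open Setting s

Ind₁ : {α : Pt n} → α ≢ 𝟘 → Ind (α ∷ [])
Ind₁ α≢𝟘 (true ∷ []) e = ⊥-elim (α≢𝟘 (trans (sym (⊕-idʳ _)) e))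
Ind₁ α≢𝟘 (false ∷ []) e = refl

Ind₂ : {α β : Pt n} → α ≢ 𝟘 → β ≢ 𝟘 → α ≢ β → Ind (α ∷ β ∷ [])
Ind₂ α≢𝟘 β≢𝟘 α≢β (true ∷ true ∷ []) e = ⊥-elim (α≢β (⊕≡𝟘⇒≡ _ _ (trans (cong (_ ⊕_) (sym (⊕-idʳ _))) e)))
Ind₂ α≢𝟘 β≢𝟘 α≢β (true ∷ false ∷ []) e =
  ⊥-elim (α≢𝟘 (trans (sym (trans (cong (_ ⊕_) (⊕-idˡ _)) (⊕-idʳ _))) e))
Ind₂ α≢𝟘 β≢𝟘 α≢β (false ∷ c) e = cong (false ∷_) (Ind₁ β≢𝟘 c (trans (sym (⊕-idˡ _)) e))

span-∋ : (vs : Vec (Pt n) m) → All (mem (span vs)) vs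
span-∋ [] = []
span-∋ (v ∷ vs) = (unit zero , lin-unit zero (v ∷ vs)) ∷ All.map (λ (c , e) → false ∷ c , trans (⊕-idˡ _) e) (span-∋ vs)

Ind-∷ : {v : Pt n} {vs : Vec (Pt n) m} → ¬ mem (span vs) v → Ind vs → Ind (v ∷ vs)
Ind-∷ {vs = vs} = extend-Ind (span vs) (span-∋ vs)

Ind-swap : {u v : Pt n} {vs : Vec (Pt n) m} → Ind (u ∷ v ∷ vs) → Ind (v ∷ u ∷ vs)
Ind-swap {u = u} {v} {vs} ind (a ∷ b ∷ c) e with ind (b ∷ a ∷ c)
  (trans (solve (b · u ∷ a · v ∷ lin c vs ∷ []) (v₀ :+ (v₁ :+ v₂)) (v₁ :+ (v₀ :+ v₂)) refl) e)
... | refl = refl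

Ind-tail : {u : Pt n} {vs : Vec (Pt n) m} → Ind (u ∷ vs) → Ind vs
Ind-tail ind c e = cong tail (ind (false ∷ c) (trans (⊕-idˡ _) e))

Ind-cong-tail : {u : Pt n} {vs : Vec (Pt n) m} {ws : Vec (Pt n) l} → (∀ {x} → mem (span ws) x → mem (span vs) x) →
  Ind ws → Ind (u ∷ vs) → Ind (u ∷ ws)
Ind-cong-tail {u = u} {vs} {ws} ⊆ indw ind = Ind-∷ (λ h → let c , e = ⊆ h in
  head≢ (ind (true ∷ c) (trans (cong (u ⊕_) e) (⊕-self u)))) indw
  where
  head≢ : ∀ {c : Vec Bool m} → true ∷ c ≢ 𝟘
  head≢ ()

span-swap : {u v : Pt n} {vs : Vec (Pt n) m} → ∀ {x} → mem (span (u ∷ v ∷ vs)) x → mem (span (v ∷ u ∷ vs)) x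
span-swap {u = u} {v} {vs} (a ∷ b ∷ c , e) = b ∷ a ∷ c ,
  trans (solve (b · v ∷ a · u ∷ lin c vs ∷ []) (v₀ :+ (v₁ :+ v₂)) (v₁ :+ (v₀ :+ v₂)) refl) e

span-tail : {u : Pt n} {vs : Vec (Pt n) m} → ∀ {x} → mem (span vs) x → mem (span (u ∷ vs)) x
span-tail (c , e) = false ∷ c , trans (⊕-idˡ _) e

hyperplane-type : {G R : Pt n → Set} → Setting n G R → {α : Pt n} → α ≢ 𝟘 → ¬ ¬ (Sep G (ker α) ⊎ Sep R (ker α))
hyperplane-type S {α} α≢𝟘 with homogeneous-solution (α ∷ []) (≤-trans (m≤m+n 2 4) (Setting.6≤n S))
  | nonzero-coordinate α α≢𝟘
... | w , w≢𝟘 , e ∷ [] | i , αi = Setting.types S (ker α) (w , e , w≢𝟘)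
      (unit i , λ h → contradict h (trans (dot-comm α (unit i)) (trans (dot-unit i α) αi)))

-- The section ker α ∩ ker γ still has at most one point of G off ker β, so it is separated by G; as G and R
-- do not both separate it, the hyperplane ker γ almost coincides with it on R.
switch : {G R : Pt n → Set} → Setting n G R → {α β γ : Pt n} → Ind (γ ∷ α ∷ β ∷ []) →
  One G α β → ¬ ¬ (¬ Sep R (ker γ ∩ ker α))
switch {n} {G} {R} S {α} {β} {γ} ind one ret =
  values (γ ∷ α ∷ β ∷ []) ind (false ∷ false ∷ true ∷ []) λ (u , e) →
    ret λ sepR → Sep-exclusive {W = W} total d
      (One⇒Sep {α = α} {β} W proj₂ one
        (u , (cong (λ t → lookup t zero) e , cong (λ t → lookup t (suc zero)) e) , cong (λ t → lookup t (suc (suc zero))) e)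
        (dim-nonzero (dim-cut β d))) sepR
  where
  open Setting S
  W = ker γ ∩ ker α
  d : Dim≥ 4 W
  d = dim-kills 4 (γ ∷ α ∷ []) 6≤n λ { (a ∷ b ∷ []) → a , b }

switch-One : {G R : Pt n → Set} → Setting n G R → {α β γ : Pt n} → Ind (γ ∷ α ∷ β ∷ []) →
  One G α β → Sep R (ker γ) → ¬ ¬ (One R γ α)
switch-One S {α} {β} {γ} ind one sepR ret = switch S {α} {β} {γ} ind one λ ns → ret (flag {α = γ} {α} sepR ns)

-- Where δ and ε vanish while γ and α are 1, there is at most one point of either colour. But this
-- set is a translate of K, which has dimension at least 6 - 4 = 2, so it contains the three points
-- w, u + w and v + w.
conflict : {G R : Pt n → Set} → Setting n G R → {α γ δ ε : Pt n} → Ind (δ ∷ ε ∷ γ ∷ α ∷ []) →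
  One G ε γ → ¬ One R δ α
conflict {n} {G} {R} S {α} {γ} {δ} {ε} ind oneG oneR =
  values (δ ∷ ε ∷ γ ∷ α ∷ []) ind (false ∷ false ∷ true ∷ true ∷ []) λ (w , e) →
    points w (cong (λ t → lookup t zero) e) (cong (λ t → lookup t (suc zero)) e)
      (cong (λ t → lookup t (suc (suc zero))) e) (cong (λ t → lookup t (suc (suc (suc zero)))) e)
      (dim-kills 2 (δ ∷ ε ∷ γ ∷ α ∷ []) {W = K} (Setting.6≤n S) λ { (a ∷ b ∷ c ∷ d ∷ []) → a , b , c , d })
  where
  K = ker δ ∩ ker ε ∩ ker γ ∩ ker α
  points : ∀ w → dot δ w ≡ false → dot ε w ≡ false → dot γ w ≡ true → dot α w ≡ true → Dim≥ 2 K → ⊥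
  points w δw εw γw αw (dim≥ {u ∷ v ∷ []} (u∈ ∷ v∈ ∷ []) uv) =
    pigeon (colour (𝟘∈ K)) (colour u∈) (colour v∈)
    where
    colour : ∀ {k} → mem K k → (G (k ⊕ w) ⊎ R (k ⊕ w)) × mem K k
    colour (δk , εk , γk , αk) = Setting.total S _ (dot-true⇒≢𝟘 {α = γ} (dot-sum γ γk γw)) , (δk , εk , γk , αk)
    cancel : ∀ {k j} → k ⊕ w ≡ j ⊕ w → k ≡ j
    cancel {k} {j} e = trans (solve (k ∷ w ∷ []) v₀ (v₀ :+ v₁ :+ v₁) refl)
      (trans (cong (_⊕ w) e) (solve (j ∷ w ∷ []) (v₀ :+ v₁ :+ v₁) v₀ refl))
    G! : ∀ {k j} → mem K k → mem K j → G (k ⊕ w) → G (j ⊕ w) → k ≡ j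
    G! (δk , εk , γk , αk) (δj , εj , γj , αj) g g′ =
      cancel (one! oneG g g′ (dot-sum ε εk εw) (dot-sum ε εj εw) (dot-sum γ γk γw) (dot-sum γ γj γw))
    R! : ∀ {k j} → mem K k → mem K j → R (k ⊕ w) → R (j ⊕ w) → k ≡ j
    R! (δk , εk , γk , αk) (δj , εj , γj , αj) g g′ =
      cancel (one! oneR g g′ (dot-sum δ δk δw) (dot-sum δ δj δw) (dot-sum α αk αw) (dot-sum α αj αw))
    u≢𝟘 : 𝟘 ≢ u
    u≢𝟘 e with uv (true ∷ false ∷ []) (trans (cong (_⊕ (𝟘 ⊕ 𝟘)) (sym e)) (trans (⊕-idˡ _) (⊕-idˡ 𝟘)))
    ... | ()
    v≢𝟘 : 𝟘 ≢ v
    v≢𝟘 e with uv (false ∷ true ∷ []) (trans (⊕-idˡ _) (trans (cong (_⊕ 𝟘) (sym e)) (⊕-idˡ 𝟘)))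
    ... | ()
    u≢v : u ≢ v
    u≢v e with uv (true ∷ true ∷ []) (trans (cong (_⊕ (v ⊕ 𝟘)) e) (trans (cong (v ⊕_) (⊕-idʳ v)) (⊕-self v)))
    ... | ()
    pigeon : _ → _ → _ → ⊥
    pigeon (inj₁ a , k) (inj₁ b , l) _ = u≢𝟘 (G! k l a b)
    pigeon (inj₁ a , k) (inj₂ b , l) (inj₁ c , m) = v≢𝟘 (G! k m a c)
    pigeon (inj₁ a , k) (inj₂ b , l) (inj₂ c , m) = u≢v (R! l m b c)
    pigeon (inj₂ a , k) (inj₂ b , l) _ = u≢𝟘 (R! k l a b)
    pigeon (inj₂ a , k) (inj₁ b , l) (inj₁ c , m) = u≢v (G! l m b c)
    pigeon (inj₂ a , k) (inj₁ b , l) (inj₂ c , m) = v≢𝟘 (R! k m a c)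

-- The mixed situation spreads to further hyperplanes through `switch`. The aim in every case is to
-- show that all generic hyperplanes have almost no point of one colour off one fixed section, which
-- `generic-sections` forbids.
mixed-flag : {G R : Pt n → Set} → Setting n G R → {α β : Pt n} → Ind (α ∷ β ∷ []) →
  Sep R (ker β) → ¬ One G α β
mixed-flag {n} {G} {R} S {α} {β} ind sepRβ one =
  em {P = ∃ λ γ → ¬ mem (span (α ∷ β ∷ [])) γ × Sep R (ker γ)} λ where
    (yes (γ , γ∉ , sepRγ)) → switch-One S (Ind-∷ γ∉ ind) one sepRγ (two-types γ γ∉)
    -- From here on every hyperplane whose functional lies outside the span of α and β has type G.
    (no noR) → em {P = ∃ λ γ → ¬ mem (span (α ∷ β ∷ [])) γ × One R β γ} λ where
      (yes (γ₀ , γ₀∉ , one′)) →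
        generic-sections {φ = β} 6≤n β≢𝟘 G-nonsep (α ∷ β ∷ []) (β ∷ γ₀ ∷ []) (m≤m+n 2 1) (m≤m+n 2 1)
          λ γ γ∉ γ∉′ ret → type γ γ∉ noR λ sepGγ →
            -- With the colours exchanged, `One R β γ₀` keeps G from separating the section of
            -- `ker γ` by `ker β`.
            switch (Setting-swap S) (Ind-∷ γ∉′ (Ind-swap (Ind-∷ (γ₀∉ ∘ λ h → span-tail h) (Ind-tail ind)))) one′ λ ns →
              ret (flag sepGγ ns)
      (no noOne) →
        generic-sections {φ = β} 6≤n β≢𝟘 G-nonsep (α ∷ β ∷ []) (α ∷ β ∷ []) (m≤m+n 2 1) (m≤m+n 2 1)
          λ γ γ∉ _ ret → type γ γ∉ noR λ sepGγ → em {P = Sep G (ker γ ∩ ker β)} λ where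
            (no ns) → ret (flag sepGγ ns)
            -- A section separated by G is not separated by R, so `ker β`, being of type R, would
            -- supply the excluded `One R β γ`.
            (yes sepGK) → noOne (γ , γ∉ , flag sepRβ λ sepRK → Sep-exclusive total
              (dim-kills 4 (γ ∷ β ∷ []) 6≤n λ { (a ∷ b ∷ []) → a , b }) sepGK
              (Sep-cong (λ _ r → r) (∩-comm (ker β) (ker γ)) (∩-comm (ker γ) (ker β)) sepRK))
  where
  open Setting S
  β≢𝟘 : β ≢ 𝟘
  β≢𝟘 refl with ind (false ∷ true ∷ []) (trans (⊕-idˡ _) (⊕-idʳ _))
  ... | ()
  α≢𝟘 : α ≢ 𝟘
  α≢𝟘 refl with ind (true ∷ false ∷ []) (trans (⊕-idˡ _) (⊕-idʳ _))
  ... | ()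
  ∉⇒≢𝟘 : ∀ {m} {vs : Vec (Pt n) m} {γ} → ¬ mem (span vs) γ → γ ≢ 𝟘
  ∉⇒≢𝟘 {vs = vs} γ∉ refl = γ∉ (𝟘∈ (span vs))

  type : ∀ γ → ¬ mem (span (α ∷ β ∷ [])) γ →
    ¬ (∃ λ γ → ¬ mem (span (α ∷ β ∷ [])) γ × Sep R (ker γ)) → ¬ ¬ Sep G (ker γ)
  type γ γ∉ noR ret = hyperplane-type S (∉⇒≢𝟘 γ∉) λ where
    (inj₁ s) → ret s
    (inj₂ s) → noR (γ , γ∉ , s)

  module _ (γ : Pt n) (γ∉ : ¬ mem (span (α ∷ β ∷ [])) γ) where
    γα : Ind (γ ∷ α ∷ [])
    γα = Ind-tail (Ind-swap (Ind-swap′ (Ind-∷ γ∉ ind)))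
      where
      Ind-swap′ : Ind (γ ∷ α ∷ β ∷ []) → Ind (γ ∷ β ∷ α ∷ [])
      Ind-swap′ = Ind-cong-tail span-swap (Ind-swap ind)

    -- Generic hyperplanes `ker δ` of type R satisfy `One R δ α` and those of type G satisfy
    -- `One G δ γ`. By `conflict` the two kinds cannot coexist generically, so the type of one
    -- generic `ker δ₀` is the type of all of them, and `generic-sections` applies to that colour.
    two-types : ¬ One R γ α
    two-types oneRγ = avoid {U = full} (dim-kills 4 [] (≤-trans (m≤m+n 4 2) 6≤n) λ _ → tt)
        (α ∷ β ∷ []) (γ ∷ α ∷ []) (m≤m+n 2 1) (m≤m+n 2 1) λ (δ₀ , _ , δ₀∉ , δ₀∉′) →
      hyperplane-type S (∉⇒≢𝟘 δ₀∉) λ where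
        (inj₂ sepR) → toR δ₀ δ₀∉ sepR λ oneδ₀ →
          generic-sections {φ = α} 6≤n α≢𝟘 R-nonsep (α ∷ β ∷ []) (δ₀ ∷ γ ∷ α ∷ []) (m≤m+n 2 1) ≤-refl
            λ δ δ∉ δ∉′ ret → hyperplane-type S (∉⇒≢𝟘 δ∉) λ where
              (inj₂ sepR′) → toR δ δ∉ sepR′ ret
              (inj₁ sepG) → toG δ (λ h → δ∉′ (span-tail h)) sepG λ oneδ →
                conflict S (Ind-swap (Ind-∷ δ∉′ (Ind-∷ δ₀∉′ γα))) oneδ oneδ₀
        (inj₁ sepG) → toG δ₀ δ₀∉′ sepG λ oneδ₀ →
          generic-sections {φ = γ} 6≤n (∉⇒≢𝟘 γ∉) G-nonsep (α ∷ β ∷ []) (δ₀ ∷ γ ∷ α ∷ []) (m≤m+n 2 1) ≤-refl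
            λ δ δ∉ δ∉′ ret → hyperplane-type S (∉⇒≢𝟘 δ∉) λ where
              (inj₁ sepG′) → toG δ (λ h → δ∉′ (span-tail h)) sepG′ ret
              (inj₂ sepR) → toR δ δ∉ sepR λ oneδ →
                conflict S (Ind-∷ δ∉′ (Ind-∷ δ₀∉′ γα)) oneδ₀ oneδ
      where
      toR : ∀ δ → ¬ mem (span (α ∷ β ∷ [])) δ → Sep R (ker δ) → ¬ ¬ One R δ α
      toR δ δ∉ sepR = switch-One S (Ind-∷ δ∉ ind) one sepR
      toG : ∀ δ → ¬ mem (span (γ ∷ α ∷ [])) δ → Sep G (ker δ) → ¬ ¬ One G δ γ
      toG δ δ∉ sepG = switch-One (Setting-swap S) (Ind-∷ δ∉ γα) oneRγ sepG

-- The common section of the two hyperplanes is not separated by both colours. The hyperplane whose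
-- colour fails there yields the flag to which `mixed-flag` applies.
uniform-type : {G R : Pt n → Set} → Setting n G R → {α β : Pt n} → α ≢ 𝟘 → β ≢ 𝟘 →
  Sep G (ker α) → ¬ Sep R (ker β)
uniform-type {G = G} S {α} {β} α≢𝟘 β≢𝟘 sepG sepR with α ≟ₚ β
... | yes refl = Sep-exclusive total (dim-kills 4 (α ∷ []) (≤-trans (m≤m+n 5 1) 6≤n) λ { (a ∷ []) → a }) sepG sepR
  where open Setting S
... | no α≢β = em {P = Sep G (ker α ∩ ker β)} λ where
    (no ns) → mixed-flag S (Ind₂ α≢𝟘 β≢𝟘 α≢β) sepR (flag sepG ns)
    (yes sepGK) → mixed-flag (Setting-swap S) (Ind₂ β≢𝟘 α≢𝟘 (α≢β ∘ sym)) sepG (flag sepR λ sepRK →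
      Sep-exclusive total (dim-kills 4 (α ∷ β ∷ []) 6≤n λ { (a ∷ b ∷ []) → a , b }) sepGK
        (Sep-cong (λ _ r → r) (∩-comm (ker β) (ker α)) (∩-comm (ker α) (ker β)) sepRK))
  where open Setting S

-- Carrying inseparability through a hyperplane section

𝟙 : Vec Bool m
𝟙 = replicate _ true

dim-bound : {W : Sub n} → n < m → ¬ Dim≥ m W
dim-bound lt (dim≥ {vs} _ ind) with dependent vs lt
... | c , c≢𝟘 , e = c≢𝟘 (ind c e)

dim-avoid : {Z : Sub n} → Dim≥ 2 Z → ∀ a → ∃ λ b → mem Z b × b ≢ 𝟘 × b ≢ a
dim-avoid (dim≥ {u ∷ v ∷ []} (u∈ ∷ v∈ ∷ []) ind) a with u ≟ₚ a
... | no u≢a = u , u∈ , (λ e → head≢ (ind (true ∷ false ∷ []) (trans (cong (_⊕ (𝟘 ⊕ 𝟘)) e) (trans (⊕-idˡ _) (⊕-idˡ 𝟘))))) , u≢a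
  where
  head≢ : true ∷ false ∷ [] ≢ 𝟘
  head≢ ()
... | yes refl = v , v∈ , (λ e → tail≢ (ind (false ∷ true ∷ []) (trans (⊕-idˡ _) (trans (⊕-idʳ v) e)))) ,
    λ e → both≢ (ind (true ∷ true ∷ []) (trans (cong (u ⊕_) (trans (⊕-idʳ v) e)) (⊕-self u)))
  where
  tail≢ : false ∷ true ∷ [] ≢ 𝟘
  tail≢ ()
  both≢ : true ∷ true ∷ [] ≢ 𝟘
  both≢ ()

Disjoint-on : Sub n → Sub n → Sub n → Set
Disjoint-on W A B = ∀ {x} → mem W x → mem A x → mem B x → x ≡ 𝟘

Covers : (Pt n → Set) → Sub n → Sub n → Sub n → Set
Covers G W A B = ∀ {x} → mem W x → G x → mem A x ⊎ mem B x

-- Inseparability in a form that can be applied to any candidate pair, and hence combined when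
-- subspaces are joined.
OneSided : (Pt n → Set) → Sub n → Set₁
OneSided G W = ∀ A B → Disjoint-on W A B → Covers G W A B →
  ¬ ¬ ((∀ {x} → mem W x → mem A x) ⊎ (∀ {x} → mem W x → mem B x))

nonsep⇒one-sided : {G : Pt n → Set} {W : Sub n} → ¬ Sep G W → OneSided G W
nonsep⇒one-sided {W = W} ns A B disj cov ret = decide-Sub A λ decA → decide-Sub B λ decB →
  em {P = ∃ λ w → mem W w × ¬ mem A w} λ where
    (no W⊆A) → ret (inj₁ λ {x} x∈ → decidable-stable (decA x) λ x∉ → W⊆A (x , x∈ , x∉))
    (yes pA) → em {P = ∃ λ w → mem W w × ¬ mem B w} λ where
      (no W⊆B) → ret (inj₂ λ {x} x∈ → decidable-stable (decB x) λ x∉ → W⊆B (x , x∈ , x∉))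
      (yes pB) → ns record { A = A ; B = B ; disjoint = disj ; A-proper = pA ; B-proper = pB ; cover = cov }

one-sided⇒nonsep : {G : Pt n → Set} {W : Sub n} → OneSided G W → ¬ Sep G W
one-sided⇒nonsep os s = os A B disjoint cover λ where
    (inj₁ W⊆A) → let w , w∈ , w∉ = A-proper in w∉ (W⊆A w∈)
    (inj₂ W⊆B) → let w , w∈ , w∉ = B-proper in w∉ (W⊆B w∈)
  where open Sep s

-- Adding to G a set of points outside Y that sum to s but are otherwise independent modulo Y
-- leaves no separation.
Carries : (Pt n → Set) → Sub n → Pt n → Set₁
Carries G Y s = ∀ A B → Disjoint-on Y A B → Covers G Y A B →
  ¬ ¬ ((∃ λ a → ∃ λ b → mem Y a × mem A a × mem B b × s ≡ a ⊕ b)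
    × (mem A s → ∀ {y} → mem Y y → mem A y) × (mem B s → ∀ {y} → mem Y y → mem B y))

one-sided⇒carries : {G : Pt n → Set} {Y : Sub n} {s : Pt n} → mem Y s → s ≢ 𝟘 → OneSided G Y → Carries G Y s
one-sided⇒carries {Y = Y} {s} s∈ s≢𝟘 os A B disj cov ret = os A B disj cov λ where
  (inj₁ Y⊆A) → ret ((s , 𝟘 , s∈ , Y⊆A s∈ , 𝟘∈ B , sym (⊕-idʳ s)) , (λ _ → Y⊆A)
    , λ sB → ⊥-elim (s≢𝟘 (disj s∈ (Y⊆A s∈) sB)))
  (inj₂ Y⊆B) → ret ((𝟘 , s , 𝟘∈ Y , 𝟘∈ A , Y⊆B s∈ , sym (⊕-idˡ s))
    , (λ sA → ⊥-elim (s≢𝟘 (disj s∈ sA (Y⊆B s∈)))) , λ _ → Y⊆B)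

-- The complement of a hyperplane in a space of dimension at least three lies on one side of every separation:
-- of the four points y, y + a, y + b, y + a + b an even number lies on either side, and two on each side
-- would give a common difference.
affine-side : {Y A B : Sub n} (ψ : Pt n) → Dim≥ 2 (Y ∩ ker ψ) → Disjoint-on Y A B →
  (∀ {y} → mem Y y → dot ψ y ≡ true → mem A y ⊎ mem B y) →
  ∀ {y₀} → mem Y y₀ → dot ψ y₀ ≡ true → mem A y₀ → ∀ {x} → mem Y x → mem A x
affine-side {n} {Y} {A} {B} ψ d disj cov {y₀} y₀∈ ψy₀ y₀A {x} x∈ = on (dot ψ x) refl
  where
  off : ∀ {y} → mem Y y → dot ψ y ≡ true → mem A y
  off {y} y∈ ψy with cov y∈ ψy
  ... | inj₁ yA = yA
  ... | inj₂ yB with y₀ ≟ₚ y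
  ...   | yes refl = y₀A
  ...   | no y₀≢y with dim-avoid d (y₀ ⊕ y)
  ...     | b , (b∈ , ψb) , b≢𝟘 , b≢ = ⊥-elim (quadrangle
              (cov (⊕∈ Y y₀∈ b∈) (dot-sum ψ ψy₀ ψb)) (cov (⊕∈ Y y∈ b∈) (dot-sum ψ ψy ψb)))
    where
    ∉AB : mem A y → mem B y → ⊥
    ∉AB h h′ = dot-true⇒≢𝟘 {α = ψ} ψy (disj y∈ h h′)
    quadrangle : mem A (y₀ ⊕ b) ⊎ mem B (y₀ ⊕ b) → mem A (y ⊕ b) ⊎ mem B (y ⊕ b) → ⊥
    quadrangle (inj₁ p) (inj₁ q) = ∉AB (⊕∈⁻ A (⊕∈⁻ A y₀A p) (subst (mem A) (⊕-comm y b) q)) yB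
    quadrangle (inj₁ p) (inj₂ q) = b≢𝟘 (disj b∈ (⊕∈⁻ A y₀A p) (⊕∈⁻ B yB q))
    quadrangle (inj₂ p) (inj₁ q) = b≢ (sym (⊕≡𝟘⇒≡ (y₀ ⊕ y) b
      (disj (⊕∈ Y (⊕∈ Y y₀∈ y∈) b∈)
        (subst (mem A) (sym (⊕-assoc y₀ y b)) (⊕∈ A y₀A q))
        (subst (mem B) (solve (y₀ ∷ y ∷ b ∷ []) (v₁ :+ (v₀ :+ v₂)) (v₀ :+ v₁ :+ v₂) refl) (⊕∈ B yB p)))))
    quadrangle (inj₂ p) (inj₂ q) = dot-true⇒≢𝟘 {α = ψ} ψy₀
      (disj y₀∈ y₀A (⊕∈⁻ B (⊕∈⁻ B yB q) (subst (mem B) (⊕-comm y₀ b) p)))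
  on : ∀ b → dot ψ x ≡ b → mem A x
  on true  ψx = off x∈ ψx
  on false ψx = ⊕∈⁻ A y₀A (off (⊕∈ Y y₀∈ x∈) (dot-sum ψ ψy₀ ψx))

-- R is confined to `ker ψ`, so all points of Y off `ker ψ` belong to G, and these already pull Y to
-- one side.
dense-one-sided : {G R : Pt n → Set} {Y : Sub n} (ψ : Pt n) → Total G R → Dim≥ 2 (Y ∩ ker ψ) →
  (∃ λ y → mem Y y × dot ψ y ≡ true) → (∀ {x} → mem Y x → R x → dot ψ x ≡ false) → OneSided G Y
dense-one-sided {G = G} {R} {Y} ψ total d (y₀ , y₀∈ , ψy₀) Rψ A B disj cov ret = case (cov′ y₀∈ ψy₀)
  where
  cov′ : ∀ {y} → mem Y y → dot ψ y ≡ true → mem A y ⊎ mem B y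
  cov′ {y} y∈ ψy with total y (dot-true⇒≢𝟘 {α = ψ} ψy)
  ... | inj₁ g = cov y∈ g
  ... | inj₂ r = contradict (Rψ y∈ r) ψy
  case : mem A y₀ ⊎ mem B y₀ → ⊥
  case (inj₁ y₀A) = ret (inj₁ (affine-side {A = A} {B} ψ d disj cov′ y₀∈ ψy₀ y₀A))
  case (inj₂ y₀B) = ret (inj₂ (affine-side {A = B} {A} ψ d (λ y b a → disj y a b) (λ y e → Sum.swap (cov′ y e)) y₀∈ ψy₀ y₀B))

-- The cyclic structure outside W: a minimal list X of points of G outside W whose sum s is a nonzero point of W.

-- Coefficients are traded for a sublist, whose strictly smaller length drives the induction towards
-- a minimal list.
select : (c : Vec Bool l) (X : Vec (Pt n) l) →
  ∃ λ m → ∃ λ (X′ : Vec (Pt n) m) → lin 𝟙 X′ ≡ lin c X × (∀ {P : Pt n → Set} → All P X → All P X′) ×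
    ((c ≡ 𝟙 × m ≡ l) ⊎ m < l)
select [] [] = 0 , [] , refl , (λ z → z) , inj₁ (refl , refl)
select (b ∷ c) (x ∷ X) with select c X | b
... | m , X′ , e , sub , inj₁ (refl , refl) | true  =
      suc m , x ∷ X′ , cong (x ⊕_) e , (λ { (p ∷ ps) → p ∷ sub ps }) , inj₁ (refl , refl)
... | m , X′ , e , sub , inj₂ lt | true =
      suc m , x ∷ X′ , cong (x ⊕_) e , (λ { (p ∷ ps) → p ∷ sub ps }) , inj₂ (s≤s lt)
... | m , X′ , e , sub , inj₁ (refl , refl) | false =
      m , X′ , trans e (sym (⊕-idˡ _)) , (λ { (p ∷ ps) → sub ps }) , inj₂ ≤-refl
... | m , X′ , e , sub , inj₂ lt | false =
      m , X′ , trans e (sym (⊕-idˡ _)) , (λ { (p ∷ ps) → sub ps }) , inj₂ (m≤n⇒m≤1+n lt)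

split-by : {A B : Sub n} (X : Vec (Pt n) l) → All (λ x → mem A x ⊎ mem B x) X →
  ∃ λ c → mem A (lin c X) × mem B (lin (𝟙 ⊕ c) X) × (c ≡ 𝟙 → All (mem A) X) × (c ≡ 𝟘 → All (mem B) X)
split-by {A = A} {B} [] [] = [] , 𝟘∈ A , 𝟘∈ B , (λ _ → []) , (λ _ → [])
split-by {A = A} {B} (x ∷ X) (h ∷ hs) with split-by {A = A} {B} X hs | h
... | c , a , b , all₁ , all₀ | inj₁ xA = true ∷ c , ⊕∈ A xA a , subst (mem B) (sym (⊕-idˡ _)) b ,
      (λ e → xA ∷ all₁ (cong tail e)) , λ ()
... | c , a , b , all₁ , all₀ | inj₂ xB = false ∷ c , subst (mem A) (sym (⊕-idˡ _)) a , ⊕∈ B xB b ,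
      (λ ()) , λ e → xB ∷ all₀ (cong tail e)

𝟙⊕≡𝟙 : (c : Vec Bool l) → 𝟙 ⊕ c ≡ 𝟙 → c ≡ 𝟘
𝟙⊕≡𝟙 c e = trans (sym (⊕-cancel 𝟙 c)) (trans (cong (𝟙 ⊕_) e) (⊕-self 𝟙))

lin-complement : (c : Vec Bool l) (X : Vec (Pt n) l) → lin 𝟙 X ≡ lin c X ⊕ lin (𝟙 ⊕ c) X
lin-complement c X = trans (cong (λ d → lin d X) (solve (𝟙 ∷ c ∷ []) v₀ (v₁ :+ (v₀ :+ v₁)) refl)) (lin-⊕ c (𝟙 ⊕ c) X)

-- When also `lin 𝟙 X` lies in W and `X` is nonempty and independent of choices, only the empty and
-- the full sum vanish modulo W: the circuit condition in the quotient by W, stated without forming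
-- the quotient.
Minimal : Sub n → Vec (Pt n) l → Set
Minimal W X = ∀ c → mem W (lin c X) → c ≡ 𝟘 ⊎ c ≡ 𝟙

-- Let c mark the members of X that lie in A, and write s = a + b with a in Y ∩ A and b in B. Then a
-- plus the marked sum equals b plus the unmarked sum, so it lies in both parts and is 0. The marked
-- sum is therefore in W, and minimality puts all of X, hence s, hence Y, on one side.
carries⇒nonsep : {G : Pt n → Set} {W Y : Sub n} {X : Vec (Pt n) l} → Minimal W X → (∀ {x} → mem Y x → mem W x) →
  All G X → Carries G Y (lin 𝟙 X) → ¬ Sep G (Y +lin X)
carries⇒nonsep {n} {l} {G} {W} {Y} {X} min Y⊆W gX car s
  with split-by {A = Sep.A s} {Sep.B s} X (sides gX (λ i → unit i , lin-unit i X))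
  where
  sides : ∀ {m} {Z : Vec (Pt n) m} → All G Z → (∀ i → ∃ λ c → lin c X ≡ lookup Z i) →
    All (λ x → mem (Sep.A s) x ⊎ mem (Sep.B s) x) Z
  sides [] h = []
  sides (g ∷ gs) h = Sep.cover s (𝟘 , proj₁ (h zero) , 𝟘∈ Y , sym (trans (⊕-idˡ _) (proj₂ (h zero)))) g ∷ sides gs (h ∘ suc)
... | c , cA , cB , all₁ , all₀ = car A B (λ y∈ → disjoint (⊆+lin Y X y∈)) (λ y∈ → cover (⊆+lin Y X y∈))
    λ ((a , b , aY , aA , bB , e) , sA⇒ , sB⇒) →
      let
        z≡ : lin (𝟙 ⊕ c) X ⊕ b ≡ a ⊕ lin c X
        z≡ = ⊕≡𝟘⇒≡ _ _ (trans (solve (lin c X ∷ lin (𝟙 ⊕ c) X ∷ a ∷ b ∷ []) ((v₁ :+ v₃) :+ (v₂ :+ v₀)) ((v₀ :+ v₁) :+ (v₂ :+ v₃)) refl)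
          (trans (cong₂ _⊕_ (sym (lin-complement c X)) (sym e)) (⊕-self _)))
        z≡𝟘 = disjoint (a , c , aY , refl) (⊕∈ A aA cA) (subst (mem B) z≡ (⊕∈ B cB bB))
        a≡ = ⊕≡𝟘⇒≡ a (lin c X) z≡𝟘
      in case (min c (subst (mem W) a≡ (Y⊆W aY))) sA⇒ sB⇒
  where
  open Sep s
  case : c ≡ 𝟘 ⊎ c ≡ 𝟙 → (mem A (lin 𝟙 X) → ∀ {y} → mem Y y → mem A y) →
    (mem B (lin 𝟙 X) → ∀ {y} → mem Y y → mem B y) → ⊥
  case (inj₁ refl) _ sB⇒ with B-proper
  ... | _ , (y , d , y∈ , refl) , w∉ =
    w∉ (⊕∈ B (sB⇒ (subst (λ d → mem B (lin d X)) (⊕-idʳ 𝟙) cB) y∈) (lin∈ B d (all₀ refl)))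
  case (inj₂ refl) sA⇒ _ with A-proper
  ... | _ , (y , d , y∈ , refl) , w∉ = w∉ (⊕∈ A (sA⇒ cA y∈) (lin∈ A d (all₁ refl)))

-- The hyperplane of W that is to be joined with X. It has to contain s, the sum of X, since
-- otherwise joining X would restore all of W; `pivot` is a vector of W that must stay outside.
record Section (G : Pt n → Set) (W : Sub n) (s : Pt n) : Set₁ where
  field
    α       : Pt n
    αs      : dot α s ≡ false
    {pivot} : Pt n
    pivot∈  : mem W pivot
    α-pivot : dot α pivot ≡ true
    carries : Carries G (W ∩ ker α) s

functional-avoiding : (W : Sub n) {s : Pt n} → Dim≥ 2 W →
  ¬ ¬ (∃ λ α → dot α s ≡ false × ∃ λ v → mem W v × dot α v ≡ true)
functional-avoiding W {s} d ret with dim-avoid d s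
... | v , v∈ , v≢𝟘 , v≢s = separating-functional (span (s ∷ [])) v
    (λ { (true ∷ [] , e) → v≢s (trans (sym e) (⊕-idʳ s)) ; (false ∷ [] , e) → v≢𝟘 (trans (sym e) (⊕-idˡ 𝟘)) })
    λ (α , kill , αv) → ret (α , kill s (true ∷ [] , ⊕-idʳ s) , v , v∈ , αv)

module _ {G R : Pt n → Set} (total : Total G R) {W : Sub n} (d : Dim≥ 4 W) {s : Pt n} (s∈ : mem W s) (s≢𝟘 : s ≢ 𝟘) where

  dense-section : (α ψ : Pt n) → dot α s ≡ false → (∃ λ v → mem W v × dot α v ≡ true) →
    (∃ λ y → mem (W ∩ ker α) y × dot ψ y ≡ true) →
    (∀ {x} → mem (W ∩ ker α) x → R x → dot ψ x ≡ false) → Section G W s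
  dense-section α ψ αs (v , v∈ , αv) y₀ Rψ = record
    { α = α ; αs = αs ; pivot∈ = v∈ ; α-pivot = αv
    ; carries = one-sided⇒carries {Y = W ∩ ker α} (s∈ , αs) s≢𝟘
        (dense-one-sided ψ total (dim-cut ψ {W ∩ ker α} (dim-cut α {W} d)) y₀ Rψ) }

  -- Choosing α nonzero somewhere on W ∩ `ker ψ` keeps the section by `ker α` from falling inside
  -- `ker ψ`: a point off `ker ψ` is moved into `ker α` by adding v.
  section-of-hyperplane : (ψ : Pt n) → (∃ λ y → mem W y × dot ψ y ≡ true) →
    (∀ {x} → mem W x → R x → dot ψ x ≡ false) → ¬ ¬ Section G W s
  section-of-hyperplane ψ (y , y∈ , ψy) Rψ ret =
    functional-avoiding (W ∩ ker ψ) {s} (dim-pred (dim-cut ψ d)) λ (α , αs , v , (v∈ , ψv) , αv) →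
      ret (dense-section α ψ αs (v , v∈ , αv) (y₀ α v∈ ψv αv (dot α y) refl) λ (x∈ , _) → Rψ x∈)
    where
    y₀ : ∀ α {v} → mem W v → dot ψ v ≡ false → dot α v ≡ true → ∀ b → dot α y ≡ b →
      ∃ λ y → mem (W ∩ ker α) y × dot ψ y ≡ true
    y₀ α v∈ ψv αv false αy = y , (y∈ , αy) , ψy
    y₀ α v∈ ψv αv true  αy = _ , (⊕∈ W y∈ v∈ , dot-sum α αy αv) , dot-sum ψ ψy ψv

  -- Two hyperplanes of W covering the points of R, both or none of which contain s: the third hyperplane
  -- through their intersection is the required section.
  section-of-two : (φ ψ : Pt n) → dot φ s ≡ dot ψ s → (∃ λ y → mem W y × dot φ y ≡ true) →
    (∃ λ y → mem W y × dot ψ y ≡ true) →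
    (∀ {x} → mem W x → R x → dot φ x ≡ false ⊎ dot ψ x ≡ false) → ¬ ¬ Section G W s
  section-of-two φ ψ same p@(y , y∈ , φy) (z , z∈ , ψz) Rcov ret =
    em {P = ∃ λ v → mem W v × dot (φ ⊕ ψ) v ≡ true} λ where
      (yes pv) → ret (dense-section (φ ⊕ ψ) φ (trans (dot-⊕ˡ φ ψ s) (trans (cong (_xor dot ψ s) same) (xor-same (dot ψ s))))
          pv (witness (dot ψ y) refl (dot φ z) refl)
          λ (x∈ , eq) r → [ id , trans (agree eq) ]′ (Rcov x∈ r))
      -- Here φ and ψ agree on W, so R is confined to a single hyperplane.
      (no none) → section-of-hyperplane φ p
          (λ {x} x∈ r → [ id , (λ ψx → agrees none x∈ ψx (dot φ x) refl) ]′ (Rcov x∈ r)) ret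
    where
    agree : ∀ {x} → dot (φ ⊕ ψ) x ≡ false → dot φ x ≡ dot ψ x
    agree {x} e = lem (dot φ x) (dot ψ x) (trans (sym (dot-⊕ˡ φ ψ x)) e)
      where
      lem : ∀ a b → a xor b ≡ false → a ≡ b
      lem true true e = refl
      lem false false e = refl
    both : ∀ {x} → dot φ x ≡ true → dot ψ x ≡ true → dot (φ ⊕ ψ) x ≡ false
    both {x} p q = trans (dot-⊕ˡ φ ψ x) (cong₂ _xor_ p q)
    agrees : ¬ (∃ λ v → mem W v × dot (φ ⊕ ψ) v ≡ true) → ∀ {x} → mem W x → dot ψ x ≡ false →
      ∀ b → dot φ x ≡ b → dot φ x ≡ false
    agrees none x∈ ψx false φx = φx
    agrees none {x} x∈ ψx true  φx = ⊥-elim (none (x , x∈ , trans (dot-⊕ˡ φ ψ x) (cong₂ _xor_ φx ψx)))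
    witness : ∀ b → dot ψ y ≡ b → ∀ c → dot φ z ≡ c → ∃ λ y → mem (W ∩ ker (φ ⊕ ψ)) y × dot φ y ≡ true
    witness true  ψy _ _ = y , (y∈ , both φy ψy) , φy
    witness false ψy true φz = z , (z∈ , both φz ψz) , φz
    witness false ψy false φz = y ⊕ z , (⊕∈ W y∈ z∈ , both (dot-sum φ φy φz) (dot-sum ψ ψy ψz)) , dot-sum φ φy φz

  -- The remaining case: R ∩ W consists of s and points of a complementary hyperplane Q.
  section-through-point : (Q : Sub n) → ¬ mem Q s → (∀ {v} → mem W v → mem Q v ⊎ mem Q (v ⊕ s)) →
    (∀ {q} → mem W q → mem Q q → q ≢ 𝟘 → G (s ⊕ q)) → ¬ ¬ Section G W s
  section-through-point Q s∉Q half green ret =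
    functional-avoiding W {s} (dim-pred (dim-pred d)) λ (α , αs , v , v∈ , αv) →
      ret record { α = α ; αs = αs ; pivot∈ = v∈ ; α-pivot = αv ; carries = carry α αs }
    where
    module _ (α : Pt n) (αs : dot α s ≡ false) where
      Y = W ∩ ker α
      sY : mem Y s
      sY = s∈ , αs

      -- Y has dimension at least three, so it has a point outside the span of s and a; that point
      -- or its translate by s lies in Q.
      another : ∀ a → ¬ ¬ (∃ λ b → mem (Y ∩ Q) b × b ≢ 𝟘 × b ≢ a)
      another a ret = decide-Sub (span (s ∷ a ∷ [])) λ dec →
        em {P = ∃ λ y → mem Y y × ¬ mem (span (s ∷ a ∷ [])) y} λ where
          (no none) → dim-escape {W = Y} (s ∷ a ∷ []) (dim-cut α d) λ {x} x∈ →
            decidable-stable (dec x) λ x∉ → none (x , x∈ , x∉)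
          (yes (y , y∈ , y∉)) → pick y y∈ y∉ (half (proj₁ y∈))
        where
        pick : ∀ y → mem Y y → ¬ mem (span (s ∷ a ∷ [])) y → mem Q y ⊎ mem Q (y ⊕ s) → ⊥
        pick y y∈ y∉ (inj₁ yQ) = ret (y , (y∈ , yQ) ,
          (λ { refl → y∉ (𝟘∈ (span (s ∷ a ∷ []))) }) ,
          λ { refl → y∉ (false ∷ true ∷ [] , trans (⊕-idˡ _) (⊕-idʳ y)) })
        pick y y∈ y∉ (inj₂ yQ) = ret (y ⊕ s , (⊕∈ Y y∈ sY , yQ) ,
          (λ e → y∉ (true ∷ false ∷ [] , trans (trans (cong (s ⊕_) (⊕-idʳ 𝟘)) (⊕-idʳ s)) (sym (⊕≡𝟘⇒≡ y s e)))) ,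
          λ e → y∉ (true ∷ true ∷ [] , trans (cong (λ t → s ⊕ (t ⊕ 𝟘)) (sym e))
            (solve (y ∷ s ∷ []) (v₁ :+ (v₀ :+ v₁ :+ ⟨0⟩)) v₀ refl)))

      -- The points s + q, s + b and s + q + b all belong to G. If q is not in A, then every
      -- distribution of them over the two sides puts one of s, b, q + b into both parts.
      Q-side : ∀ {A B} → Disjoint-on Y A B → Covers G Y A B → mem A s → ∀ {q} → mem (Y ∩ Q) q → ¬ ¬ mem A q
      Q-side {A} {B} disj cov sA {q} (q∈ , qQ) ret with q ≟ₚ 𝟘
      ... | yes refl = ret (𝟘∈ A)
      ... | no q≢𝟘 = another q λ (b , (b∈ , bQ) , b≢𝟘 , b≢q) →
        let c = q ⊕ b
            c≢𝟘 : c ≢ 𝟘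
            c≢𝟘 e = b≢q (sym (⊕≡𝟘⇒≡ q b e))
            colour : ∀ {p} → mem (Y ∩ Q) p → p ≢ 𝟘 → mem A (s ⊕ p) ⊎ mem B (s ⊕ p)
            colour (p∈ , pQ) p≢𝟘 = cov (⊕∈ Y sY p∈) (green (proj₁ p∈) pQ p≢𝟘)
        in triangle b b∈ bQ b≢𝟘 b≢q (colour (q∈ , qQ) q≢𝟘) (colour (b∈ , bQ) b≢𝟘)
             (colour (⊕∈ Y q∈ b∈ , ⊕∈ Q qQ bQ) c≢𝟘)
        where
        triangle : ∀ b → mem Y b → mem Q b → b ≢ 𝟘 → b ≢ q → mem A (s ⊕ q) ⊎ mem B (s ⊕ q) →
          mem A (s ⊕ b) ⊎ mem B (s ⊕ b) → mem A (s ⊕ (q ⊕ b)) ⊎ mem B (s ⊕ (q ⊕ b)) → ⊥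
        triangle b b∈ bQ b≢𝟘 b≢q (inj₁ p) _ _ = ret (⊕∈⁻ A sA p)
        triangle b b∈ bQ b≢𝟘 b≢q (inj₂ p) (inj₂ r) (inj₁ t) =
          b≢q (sym (⊕≡𝟘⇒≡ q b (disj (⊕∈ Y q∈ b∈) (⊕∈⁻ A sA t)
            (subst (mem B) (solve (s ∷ q ∷ b ∷ []) (v₀ :+ v₁ :+ (v₀ :+ v₂)) (v₁ :+ v₂) refl) (⊕∈ B p r)))))
        triangle b b∈ bQ b≢𝟘 b≢q (inj₂ p) (inj₂ r) (inj₂ t) =
          s≢𝟘 (disj sY sA (subst (mem B) (solve (s ∷ q ∷ b ∷ []) (v₀ :+ v₁ :+ (v₀ :+ v₂) :+ (v₀ :+ (v₁ :+ v₂))) v₀ refl)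
            (⊕∈ B (⊕∈ B p r) t)))
        triangle b b∈ bQ b≢𝟘 b≢q (inj₂ p) (inj₁ r) (inj₁ t) =
          ret (subst (mem A) (solve (s ∷ q ∷ b ∷ []) (v₀ :+ v₂ :+ (v₀ :+ (v₁ :+ v₂))) v₁ refl) (⊕∈ A r t))
        triangle b b∈ bQ b≢𝟘 b≢q (inj₂ p) (inj₁ r) (inj₂ t) =
          b≢𝟘 (disj b∈ (⊕∈⁻ A sA r)
            (subst (mem B) (solve (s ∷ q ∷ b ∷ []) (v₀ :+ v₁ :+ (v₀ :+ (v₁ :+ v₂))) v₂ refl) (⊕∈ B p t)))

      side-of-s : ∀ {A B} → Disjoint-on Y A B → Covers G Y A B → mem A s → ∀ {y} → mem Y y → ¬ ¬ mem A y
      side-of-s {A} {B} disj cov sA {y} y∈ ret with half (proj₁ y∈)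
      ... | inj₁ yQ = Q-side {A} {B} disj cov sA (y∈ , yQ) ret
      ... | inj₂ ysQ = Q-side {A} {B} disj cov sA (⊕∈ Y y∈ sY , ysQ) λ h → ret (⊕∈⁻ A sA (subst (mem A) (⊕-comm y s) h))

      sum-of-parts : Sub n → Sub n → Sub n
      sum-of-parts A B = record
        { mem = λ x → ∃ λ a → ∃ λ b → mem Y a × mem A a × mem B b × x ≡ a ⊕ b
        ; 𝟘∈ = 𝟘 , 𝟘 , 𝟘∈ Y , 𝟘∈ A , 𝟘∈ B , sym (⊕-idˡ 𝟘)
        ; ⊕∈ = λ { (a , b , aY , aA , bB , refl) (a′ , b′ , aY′ , aA′ , bB′ , refl) →
            a ⊕ a′ , b ⊕ b′ , ⊕∈ Y aY aY′ , ⊕∈ A aA aA′ , ⊕∈ B bB bB′ , ⊕-medial a b a′ b′ } }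

      carry : Carries G Y s
      carry A B disj cov ret = another 𝟘 λ (a , (a∈ , aQ) , a≢𝟘 , _) → another a λ (b , (b∈ , bQ) , b≢𝟘 , b≢a) →
        decide-Sub A λ decA → decide-Sub B λ decB →
          -- s is the sum of the three points s + a, s + b and s + a + b of G, each of which lies in
          -- one of the parts.
          ret ( subst (mem J) (solve (s ∷ a ∷ b ∷ []) (v₀ :+ v₁ :+ (v₀ :+ v₂) :+ (v₀ :+ (v₁ :+ v₂))) v₀ refl)
                  (⊕∈ J (⊕∈ J (part a∈ aQ a≢𝟘) (part b∈ bQ b≢𝟘))
                    (part (⊕∈ Y a∈ b∈) (⊕∈ Q aQ bQ) (λ e → b≢a (sym (⊕≡𝟘⇒≡ a b e)))))
              , (λ sA {y} y∈ → decidable-stable (decA y) (side-of-s {A} {B} disj cov sA y∈))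
              , (λ sB {y} y∈ → decidable-stable (decB y)
                  (side-of-s {B} {A} (λ y b a → disj y a b) (λ y g → Sum.swap (cov y g)) sB y∈)))
        where
        J = sum-of-parts A B
        part : ∀ {p} → mem Y p → mem Q p → p ≢ 𝟘 → mem J (s ⊕ p)
        part {p} p∈ pQ p≢𝟘 with cov (⊕∈ Y sY p∈) (green (proj₁ p∈) pQ p≢𝟘)
        ... | inj₁ h = s ⊕ p , 𝟘 , ⊕∈ Y sY p∈ , h , 𝟘∈ B , sym (⊕-idʳ _)
        ... | inj₂ h = 𝟘 , s ⊕ p , 𝟘∈ Y , 𝟘∈ A , h , sym (⊕-idˡ _)

  -- If s lies in neither part, each part extends to a hyperplane missing s. If s lies in P, then P
  -- and Q + s extend to hyperplanes through s unless Q + s is all of W; in that last case R ∩ W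
  -- consists of points of Q and possibly s itself.
  section : Sep R W → ¬ ¬ Section G W s
  section sep ret = decide-Sub P λ decP → decide-Sub Q λ decQ → cases (decP s) (decQ s)
    where
    open Sep sep renaming (A to P; B to Q; A-proper to P-proper; B-proper to Q-proper)

    through : (P Q : Sub n) → Disjoint-on W P Q → Covers R W P Q → (∃ λ w → mem W w × ¬ mem P w) →
      mem P s → ¬ mem Q s → ⊥
    through P Q disj cov (p , p∈ , p∉) sP s∉Q = decide-Sub Q λ decQ →
      em {P = ∃ λ v → mem W v × ¬ mem (Q +lin (s ∷ [])) v} λ where
        (yes (v , v∈ , v∉)) → separating-functional (Q +lin (s ∷ [])) v v∉ λ (ψ , ψkill , ψv) →
          separating-functional P p p∉ λ (φ , φkill , φp) →
            section-of-two φ ψ (trans (φkill s sP) (sym (ψkill s (𝟘 , true ∷ [] , 𝟘∈ Q , sym (trans (⊕-idˡ _) (⊕-idʳ s))))))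
              (p , p∈ , φp) (v , v∈ , ψv)
              (λ {x} x∈ r → Sum.map (φkill x) (λ xQ → ψkill x (x , false ∷ [] , xQ ,
                sym (trans (cong (x ⊕_) (⊕-idʳ 𝟘)) (⊕-idʳ x)))) (cov x∈ r)) ret
        (no none) → half (λ {v} v∈ → decide (decQ v) (decQ (v ⊕ s)) λ v∉ vs∉ → none (v , v∈ , λ where
            (y , true ∷ [] , y∈ , refl) → vs∉ (subst (mem Q) (solve (y ∷ s ∷ []) v₀ (v₀ :+ (v₁ :+ ⟨0⟩) :+ v₁) refl) y∈)
            (y , false ∷ [] , y∈ , refl) → v∉ (subst (mem Q) (solve (y ∷ []) v₀ (v₀ :+ (⟨0⟩ :+ ⟨0⟩)) refl) y∈)))
      where
      decide : ∀ {A B : Set} → Dec A → Dec B → (¬ A → ¬ B → ⊥) → A ⊎ B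
      decide (yes a) _ h = inj₁ a
      decide (no ¬a) (yes b) h = inj₂ b
      decide (no ¬a) (no ¬b) h = ⊥-elim (h ¬a ¬b)
      half : (∀ {v} → mem W v → mem Q v ⊎ mem Q (v ⊕ s)) → ⊥
      half hf = em {P = R s} λ where
          (no ¬Rs) → separating-functional Q s s∉Q λ (ψ , ψkill , ψs) →
            section-of-hyperplane ψ (s , s∈ , ψs) (λ {x} x∈ r → ψkill x (inQ ¬Rs x∈ r (cov x∈ r) (hf x∈))) ret
          (yes Rs) → section-through-point Q s∉Q hf (λ {q} q∈ qQ q≢𝟘 → green q∈ qQ q≢𝟘
              (total (s ⊕ q) λ e → s∉Q (subst (mem Q) (sym (⊕≡𝟘⇒≡ s q e)) qQ))) ret
        where
        inQ : ¬ R s → ∀ {x} → mem W x → R x → mem P x ⊎ mem Q x → mem Q x ⊎ mem Q (x ⊕ s) → mem Q x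
        inQ ¬Rs x∈ r (inj₂ xQ) _ = xQ
        inQ ¬Rs x∈ r (inj₁ xP) (inj₁ xQ) = xQ
        inQ ¬Rs {x} x∈ r (inj₁ xP) (inj₂ xsQ) =
          ⊥-elim (¬Rs (subst R (⊕≡𝟘⇒≡ x s (disj (⊕∈ W x∈ s∈) (⊕∈ P xP sP) xsQ)) r))
        green : ∀ {q} → mem W q → mem Q q → q ≢ 𝟘 → G (s ⊕ q) ⊎ R (s ⊕ q) → G (s ⊕ q)
        green q∈ qQ q≢𝟘 (inj₁ g) = g
        green {q} q∈ qQ q≢𝟘 (inj₂ r) with cov (⊕∈ W s∈ q∈) r
        ... | inj₁ h = ⊥-elim (q≢𝟘 (disj q∈ (⊕∈⁻ P sP h) qQ))
        ... | inj₂ h = ⊥-elim (s∉Q (⊕∈⁻ Q qQ (subst (mem Q) (⊕-comm s q) h)))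

    cases : Dec (mem P s) → Dec (mem Q s) → ⊥
    cases (yes sP) _ = through P Q disjoint cover P-proper sP λ sQ → s≢𝟘 (disjoint s∈ sP sQ)
    cases (no s∉P) (yes sQ) = through Q P (λ w q p → disjoint w p q) (λ w r → Sum.swap (cover w r)) Q-proper sQ s∉P
    cases (no s∉P) (no s∉Q) = separating-functional P s s∉P λ (φ , φkill , φs) →
      separating-functional Q s s∉Q λ (ψ , ψkill , ψs) →
        section-of-two φ ψ (trans φs (sym ψs)) (s , s∈ , φs) (s , s∈ , ψs)
          (λ {x} x∈ r → Sum.map (φkill x) (ψkill x) (cover x∈ r)) ret

-- Descending induction from hyperplanes to smaller sections

outer-span : (G : Pt n → Set) → Sub n → Sub n
outer-span {n} G W = record
  -- Lists with repetitions make closure under addition a concatenation; `no-outer-circuit` works by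
  -- induction on their length.
  { mem = λ v → ∃ λ l → ∃ λ (X : Vec (Pt n) l) → All (λ x → G x × ¬ mem W x) X × lin 𝟙 X ≡ v
  ; 𝟘∈ = 0 , [] , [] , refl
  ; ⊕∈ = λ { (l , X , gX , refl) (l′ , X′ , gX′ , refl) → join X X′ gX gX′ } }
  where
  join : ∀ {l l′} (X : Vec (Pt n) l) (X′ : Vec (Pt n) l′) → All (λ x → G x × ¬ mem W x) X →
    All (λ x → G x × ¬ mem W x) X′ →
    ∃ λ l → ∃ λ (Z : Vec (Pt n) l) → All (λ x → G x × ¬ mem W x) Z × lin 𝟙 Z ≡ lin 𝟙 X ⊕ lin 𝟙 X′
  join [] X′ [] gX′ = _ , X′ , gX′ , sym (⊕-idˡ _)
  join (x ∷ X) X′ (g ∷ gX) gX′ with join X X′ gX gX′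
  ... | l , Z , gZ , e = suc l , x ∷ Z , g ∷ gZ , trans (cong (x ⊕_) e) (sym (⊕-assoc x _ _))

module _ {n : ℕ} {G R : Pt n → Set} (S : Setting n G R) (hyperplanes : ∀ α → α ≢ 𝟘 → ¬ ¬ Sep G (ker α)) where
  open Setting S

  module _ {W : Sub n} (d : Dim≥ 4 W) (W-proper : ∃ λ v → ¬ mem W v) (nsW : ¬ Sep G W)
    (maximal : ∀ U → (∀ {x} → mem W x → mem U x) → (∃ λ u → mem U u × ¬ mem W u) → (∃ λ v → ¬ mem U v) → ¬ ¬ Sep G U)
    where

    -- The bound `b` on the length is the induction measure: shorter lists with sum in W have sum 𝟘,
    -- which makes a counterexample `Minimal`.
    no-outer-circuit : ∀ b {l} (X : Vec (Pt n) l) → l < b → All (λ x → G x × ¬ mem W x) X →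
      mem W (lin 𝟙 X) → lin 𝟙 X ≡ 𝟘
    no-outer-circuit (suc b) {l} X (s≤s l≤b) gX s∈ = decidable-stable (lin 𝟙 X ≟ₚ 𝟘) λ s≢𝟘 →
      types W (let w , w∈ , w≢𝟘 = dim-nonzero d in w , w∈ , w≢𝟘) W-proper λ where
        (inj₁ sepG) → nsW sepG
        (inj₂ sepR) → section total d s∈ s≢𝟘 sepR λ sec → spanning s≢𝟘 λ v∈ → impossible s≢𝟘 sec v∈
      where
      s = lin 𝟙 X

      shorter : ∀ (c : Vec Bool l) → mem W (lin c X) → c ≡ 𝟙 ⊎ lin c X ≡ 𝟘
      shorter c h with select c X
      ... | _ , X′ , e , sub , inj₁ (c≡𝟙 , _) = inj₁ c≡𝟙
      ... | _ , X′ , e , sub , inj₂ lt = inj₂ (trans (sym e)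
        (no-outer-circuit b X′ (<-≤-trans lt l≤b) (sub gX) (subst (mem W) (sym e) h)))

      minimal : s ≢ 𝟘 → Minimal W X
      minimal s≢𝟘 c h with shorter c h
      ... | inj₁ c≡𝟙 = inj₂ c≡𝟙
      ... | inj₂ e with shorter (𝟙 ⊕ c) (⊕∈⁻ W h (subst (mem W) (lin-complement c X) s∈))
      ...   | inj₁ e′ = inj₁ (𝟙⊕≡𝟙 c e′)
      ...   | inj₂ e′ = ⊥-elim (s≢𝟘 (trans (lin-complement c X) (trans (cong₂ _⊕_ e e′) (⊕-self 𝟘))))

      nonempty : ∀ {l} (X : Vec (Pt n) l) → All (λ x → G x × ¬ mem W x) X → lin 𝟙 X ≢ 𝟘 →
        ∃ λ u → mem (W +lin X) u × ¬ mem W u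
      nonempty [] [] ne = ⊥-elim (ne refl)
      nonempty (x ∷ X) ((_ , x∉) ∷ _) _ = x , (𝟘 , unit zero , 𝟘∈ W ,
        sym (trans (⊕-idˡ _) (lin-unit zero (x ∷ X)))) , x∉

      spanning : s ≢ 𝟘 → ¬ ¬ (∀ v → mem (W +lin X) v)
      spanning s≢𝟘 ret = decide-Sub (W +lin X) λ dec → em {P = ∃ λ v → ¬ mem (W +lin X) v} λ where
        (no all) → ret λ v → decidable-stable (dec v) λ v∉ → all (v , v∉)
        (yes pU) → maximal (W +lin X) (⊆+lin W X) (nonempty X gX s≢𝟘) pU
          (carries⇒nonsep {W = W} {W} (minimal s≢𝟘) id (All.map proj₁ gX)
            (one-sided⇒carries {Y = W} s∈ s≢𝟘 (nonsep⇒one-sided nsW)))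

      impossible : s ≢ 𝟘 → Section G W s → (∀ v → mem (W +lin X) v) → ⊥
      impossible s≢𝟘 sec all = separating-functional H pivot pivot∉ λ (χ , kill , one) →
          hyperplanes χ (λ { refl → contradict (dot-𝟘ˡ pivot) one }) λ sep →
            carries⇒nonsep {W = W} {Y} (minimal s≢𝟘) proj₁ (All.map proj₁ gX) carries
              (Sep-cong (λ _ g → g) (λ {x} → inside χ kill one (all x)) (λ {x} → kill x) sep)
        where
        open Section sec
        Y = W ∩ ker α
        H = Y +lin X
        pivot∉ : ¬ mem H pivot
        pivot∉ (y , c , (y∈ , αy) , e) =
          -- By minimality the pivot would be y or y + s, and α vanishes on both.
          [ (λ { refl → contradict (trans (cong (dot α) (trans e (trans (cong (y ⊕_) (lin-𝟘 X)) (⊕-idʳ y)))) αy) α-pivot })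
          , (λ { refl → contradict (trans (cong (dot α) e) (dot-sum α αy αs)) α-pivot }) ]′
          (minimal s≢𝟘 c (⊕∈⁻ W y∈ (subst (mem W) e pivot∈)))
        -- H has codimension one: if w is outside `ker α`, adding the pivot brings it back into Y,
        -- and χ would then be 1 on the given vector.
        inside : ∀ χ → (∀ w → mem H w → dot χ w ≡ false) → dot χ pivot ≡ true →
          ∀ {x} → mem (W +lin X) x → dot χ x ≡ false → mem H x
        inside χ kill one {x} (w , c , w∈ , refl) χx = go (dot α w) refl
          where
          go : ∀ b → dot α w ≡ b → mem H x
          go false αw = w , c , (w∈ , αw) , refl
          go true αw = contradict χx (subst (λ z → dot χ z ≡ true)
            (solve (w ∷ pivot ∷ lin c X ∷ []) (v₀ :+ v₁ :+ v₂ :+ v₁) (v₀ :+ v₂) refl)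
            (dot-sum χ (kill _ (w ⊕ pivot , c , (⊕∈ W w∈ pivot∈ , dot-sum α αw α-pivot) , refl)) one))

    -- Without outer circuits the span of the points of G outside W meets W only in 0, so W and this
    -- span separate the whole space.
    maximal-impossible : ⊥
    maximal-impossible = decide-Sub W λ decW → G-nonsep record
      { A = W ; B = outer-span G W
      ; disjoint = λ { _ x∈ (l , X , gX , refl) → no-outer-circuit (suc l) X ≤-refl gX x∈ }
      ; A-proper = let v , v∉ = W-proper in v , tt , v∉
      ; B-proper = let w , w∈ , w≢𝟘 = dim-nonzero d in w , tt , λ (l , X , gX , e) →
          w≢𝟘 (trans (sym e) (no-outer-circuit (suc l) X ≤-refl gX (subst (mem W) (sym e) w∈)))
      ; cover = λ {x} _ g → side g (decW x) }
      where
      side : ∀ {x} → G x → Dec (mem W x) → mem W x ⊎ mem (outer-span G W) x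
      side g (yes x∈) = inj₁ x∈
      side {x} g (no x∉) = inj₂ (1 , x ∷ [] , (g , x∉) ∷ [] , ⊕-idʳ x)

  -- Induction on an upper bound `f` for the codimension: every proper enlargement raises the
  -- dimension bound m, which cannot exceed n.
  sections-separated : ∀ {W} → Dim≥ 4 W → (∃ λ v → ¬ mem W v) → ¬ ¬ Sep G W
  sections-separated = λ d → go n d (m≤m+n n 4) d
    where
    go : ∀ f {m W} → Dim≥ m W → n ≤ f + m → Dim≥ 4 W → (∃ λ v → ¬ mem W v) → ¬ Sep G W → ⊥
    go zero {W = W} dm n≤m d4 (v , v∉) ns = dim-bound (s≤s n≤m) (dim-suc {W = W} full (λ _ → tt) {v} tt v∉ dm)
    go (suc f) {m} {W} dm n≤ d4 proper ns = maximal-impossible d4 proper ns λ U W⊆U (u , u∈ , u∉) properU nsU →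
      go f (dim-suc {W = W} U W⊆U u∈ u∉ dm) (subst (n ≤_) (sym (+-suc f m)) n≤) (dim-⊆ {W = W} {U} W⊆U d4) properU nsU

-- Coordinate subspaces

count : Pt n → ℕ
count []          = 0
count (true ∷ x)  = suc (count x)
count (false ∷ x) = count x

mask : Pt n → Sub n
mask P = record
  { mem = λ v → ∀ i → lookup v i ≡ true → lookup P i ≡ true
  ; 𝟘∈ = λ i e → contradict (lookup-replicate i false) e
  ; ⊕∈ = λ {x} {y} x⊆ y⊆ i e → either (x⊆ i) (y⊆ i) (trans (sym (lookup-zipWith _xor_ i x y)) e) }
  where
  either : ∀ {a b c} → (a ≡ true → c ≡ true) → (b ≡ true → c ≡ true) → a xor b ≡ true → c ≡ true
  either {true} f g e = f refl
  either {false} f g e = g e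

lookup-unit : (i : Fin n) → lookup (unit i) i ≡ true
lookup-unit zero    = refl
lookup-unit (suc i) = lookup-unit i

lookup-unit⁻ : (i j : Fin n) → lookup (unit i) j ≡ true → i ≡ j
lookup-unit⁻ zero    zero    e = refl
lookup-unit⁻ zero    (suc j) e = contradict (lookup-replicate j false) e
lookup-unit⁻ (suc i) (suc j) e = cong suc (lookup-unit⁻ i j e)

unit≢𝟘 : (i : Fin n) → unit i ≢ 𝟘
unit≢𝟘 i e = contradict (lookup-replicate i false) (trans (cong (λ v → lookup v i) (sym e)) (lookup-unit i))

unit∈mask : (P : Pt n) (i : Fin n) → lookup P i ≡ true → mem (mask P) (unit i)
unit∈mask P i Pi j e with lookup-unit⁻ i j e
... | refl = Pi

lookup-𝟙⊕ : (x : Pt n) (i : Fin n) → lookup (𝟙 ⊕ x) i ≡ not (lookup x i)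
lookup-𝟙⊕ x i = trans (lookup-zipWith _xor_ i 𝟙 x) (cong (_xor lookup x i) (lookup-replicate i true))

generated-by-units : (A : Sub n) (v : Pt n) → (∀ i → lookup v i ≡ true → mem A (unit i)) → mem A v
generated-by-units A [] h = 𝟘∈ A
generated-by-units A (true ∷ v) h =
  subst (mem A) (cong (true ∷_) (⊕-idˡ v)) (⊕∈ A (h zero refl) (generated-by-units (restrict A) v (λ i → h (suc i))))
generated-by-units A (false ∷ v) h = generated-by-units (restrict A) v (λ i → h (suc i))

lin-shift : (c : Vec Bool m) (ws : Vec (Pt n) m) → lin c (map (false ∷_) ws) ≡ false ∷ lin c ws
lin-shift [] [] = refl
lin-shift (true ∷ c) (w ∷ ws) = cong ((false ∷ w) ⊕_) (lin-shift c ws)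
lin-shift (false ∷ c) (w ∷ ws) = cong (𝟘 ⊕_) (lin-shift c ws)

shift-All : (W : Sub (suc n)) {ws : Vec (Pt n) m} → All (mem (restrict W)) ws → All (mem W) (map (false ∷_) ws)
shift-All W []         = []
shift-All W (w∈ ∷ ws∈) = w∈ ∷ shift-All W ws∈

shift-Ind : {ws : Vec (Pt n) m} → Ind ws → Ind (map (false ∷_) ws)
shift-Ind {ws = ws} ind c e = ind c (cong tail (trans (sym (lin-shift c ws)) e))

shift-Ind-∷ : (u : Pt n) {ws : Vec (Pt n) m} → Ind ws → Ind ((true ∷ u) ∷ map (false ∷_) ws)
shift-Ind-∷ u {ws} ind (true ∷ c) e =
  contradict (cong (λ v → lookup v zero) (trans (cong ((true ∷ u) ⊕_) (sym (lin-shift c ws))) e)) refl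
shift-Ind-∷ u ind (false ∷ c) e = cong (false ∷_) (shift-Ind ind c (trans (sym (⊕-idˡ _)) e))

dim-mask : (P : Pt n) → Dim≥ (count P) (mask P)
dim-mask [] = dim≥ [] λ { [] _ → refl }
dim-mask (true ∷ P) with dim-mask P
... | dim≥ ws∈ ind = dim≥
      ((λ { zero _ → refl ; (suc i) e → contradict (lookup-replicate i false) e }) ∷
        shift-All (mask (true ∷ P)) (All.map (λ w∈ → λ { (suc i) e → w∈ i e }) ws∈))
      (shift-Ind-∷ 𝟘 ind)
dim-mask (false ∷ P) with dim-mask P
... | dim≥ ws∈ ind = dim≥
      (shift-All (mask (false ∷ P)) (All.map (λ w∈ → λ { (suc i) e → w∈ i e }) ws∈)) (shift-Ind ind)

dim-≤ : {W : Sub n} → k ≤ m → Dim≥ m W → Dim≥ k W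
dim-≤ {m = zero} z≤n d = d
dim-≤ {k = k} {suc m} {W} k≤ d with m≤n⇒m<n∨m≡n k≤
... | inj₁ k<     = dim-≤ {m = m} {W} (≤-pred k<) (dim-pred d)
... | inj₂ refl = d

count≤ : (x : Pt n) → count x ≤ n
count≤ [] = z≤n
count≤ (true ∷ x) = s≤s (count≤ x)
count≤ (false ∷ x) = m≤n⇒m≤1+n (count≤ x)

some-false : (x : Pt n) → count x < n → ∃ λ i → lookup x i ≡ false
some-false (false ∷ x) _ = zero , refl
some-false (true ∷ x) (s≤s lt) with some-false x lt
... | i , e = suc i , e

≢𝟙⇒some-false : (x : Pt n) → x ≢ 𝟙 → ∃ λ i → lookup x i ≡ false
≢𝟙⇒some-false [] ne = ⊥-elim (ne refl)
≢𝟙⇒some-false (false ∷ x) ne = zero , refl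
≢𝟙⇒some-false (true ∷ x) ne with ≢𝟙⇒some-false x (ne ∘ cong (true ∷_))
... | i , e = suc i , e

mask-proper : {P : Pt n} → (∃ λ i → lookup P i ≡ false) → ∃ λ v → ¬ mem (mask P) v
mask-proper (i , e) = unit i , λ h → contradict e (h i (lookup-unit i))

count-complement : (x : Pt n) → count x + count (𝟙 ⊕ x) ≡ n
count-complement [] = refl
count-complement (true ∷ x) = cong suc (count-complement x)
count-complement (false ∷ x) = trans (+-suc _ _) (cong suc (count-complement x))

count-unit : (i : Fin n) → count (unit i) ≡ 1
count-unit {suc n} zero = cong suc (count-𝟘 n)
  where
  count-𝟘 : ∀ n → count (𝟘 {n}) ≡ 0
  count-𝟘 zero = refl
  count-𝟘 (suc n) = count-𝟘 n
count-unit (suc i) = count-unit i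

infixr 6 _∪ₘ_
_∪ₘ_ : Pt n → Pt n → Pt n
_∪ₘ_ = zipWith _∨_

count-∪ : (P y : Pt n) → count (P ∪ₘ y) ≤ count P + count y
count-∪ [] [] = z≤n
count-∪ (true ∷ P) (true ∷ y) = s≤s (≤-trans (count-∪ P y) (+-monoʳ-≤ (count P) (m≤n+m _ 1)))
count-∪ (true ∷ P) (false ∷ y) = s≤s (count-∪ P y)
count-∪ (false ∷ P) (true ∷ y) = ≤-trans (s≤s (count-∪ P y)) (≤-reflexive (sym (+-suc _ _)))
count-∪ (false ∷ P) (false ∷ y) = count-∪ P y

count-∪-overlap : (P y : Pt n) (i : Fin n) → lookup P i ≡ true → lookup y i ≡ true →
  count (P ∪ₘ y) < count P + count y
count-∪-overlap (true ∷ P) (true ∷ y) zero _ _ = s≤s (≤-trans (s≤s (count-∪ P y)) (≤-reflexive (sym (+-suc _ _))))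
count-∪-overlap (true ∷ P) (true ∷ y) (suc i) p q =
  s≤s (≤-trans (count-∪-overlap P y i p q) (+-monoʳ-≤ (count P) (m≤n+m _ 1)))
count-∪-overlap (true ∷ P) (false ∷ y) (suc i) p q = s≤s (count-∪-overlap P y i p q)
count-∪-overlap (false ∷ P) (true ∷ y) (suc i) p q =
  ≤-trans (s≤s (count-∪-overlap P y i p q)) (≤-reflexive (sym (+-suc _ _)))
count-∪-overlap (false ∷ P) (false ∷ y) (suc i) p q = count-∪-overlap P y i p q

count-∪-≥ : (P y : Pt n) → count P ≤ count (P ∪ₘ y)
count-∪-≥ [] [] = z≤n
count-∪-≥ (true ∷ P) (_ ∷ y) = s≤s (count-∪-≥ P y)
count-∪-≥ (false ∷ P) (true ∷ y) = m≤n⇒m≤1+n (count-∪-≥ P y)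
count-∪-≥ (false ∷ P) (false ∷ y) = count-∪-≥ P y

count-∪-> : (P y : Pt n) (i : Fin n) → lookup P i ≡ false → lookup y i ≡ true → count P < count (P ∪ₘ y)
count-∪-> (false ∷ P) (true ∷ y) zero _ _ = s≤s (count-∪-≥ P y)
count-∪-> (true ∷ P) (_ ∷ y) (suc i) p q = s≤s (count-∪-> P y i p q)
count-∪-> (false ∷ P) (true ∷ y) (suc i) p q = m≤n⇒m≤1+n (count-∪-> P y i p q)
count-∪-> (false ∷ P) (false ∷ y) (suc i) p q = count-∪-> P y i p q

inside-or-sticks-out : (x P : Pt n) → mem (mask P) x ⊎ (∃ λ i → lookup x i ≡ true × lookup P i ≡ false)
inside-or-sticks-out [] [] = inj₁ λ ()
inside-or-sticks-out (true ∷ x) (false ∷ P) = inj₂ (zero , refl , refl)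
inside-or-sticks-out (true ∷ x) (true ∷ P) with inside-or-sticks-out x P
... | inj₁ h = inj₁ λ { zero _ → refl ; (suc i) e → h i e }
... | inj₂ (i , p , q) = inj₂ (suc i , p , q)
inside-or-sticks-out (false ∷ x) (b ∷ P) with inside-or-sticks-out x P
... | inj₁ h = inj₁ λ { (suc i) e → h i e }
... | inj₂ (i , p , q) = inj₂ (suc i , p , q)

split-units : (A B : Sub n) (y : Pt n) → (∀ i → lookup y i ≡ true → mem A (unit i) ⊎ mem B (unit i)) →
  ∃ λ c → mem A c × mem B (y ⊕ c) × mem (mask y) c ×
    (c ≡ y → ∀ i → lookup y i ≡ true → mem A (unit i)) × (c ≡ 𝟘 → ∀ i → lookup y i ≡ true → mem B (unit i))
split-units A B [] h = [] , 𝟘∈ A , 𝟘∈ B , (λ ()) , (λ _ ()) , (λ _ ())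
split-units A B (false ∷ y) h with split-units (restrict A) (restrict B) y (λ i → h (suc i))
... | c , cA , cB , c⊆ , all₁ , all₀ = false ∷ c , cA , cB , (λ { (suc i) e → c⊆ i e }) ,
      (λ { e (suc i) → all₁ (cong tail e) i }) , (λ { e (suc i) → all₀ (cong tail e) i })
split-units A B (true ∷ y) h with split-units (restrict A) (restrict B) y (λ i → h (suc i)) | h zero refl
... | c , cA , cB , c⊆ , all₁ , all₀ | inj₁ uA =
      true ∷ c , subst (mem A) (cong (true ∷_) (⊕-idˡ c)) (⊕∈ A uA cA) , cB ,
      (λ { zero _ → refl ; (suc i) e → c⊆ i e }) ,
      (λ { e zero _ → uA ; e (suc i) → all₁ (cong tail e) i }) , λ ()
... | c , cA , cB , c⊆ , all₁ , all₀ | inj₂ uB =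
      false ∷ c , cA , subst (mem B) (cong (true ∷_) (⊕-idˡ (y ⊕ c))) (⊕∈ B uB cB) ,
      (λ { (suc i) e → c⊆ i e }) , (λ ()) , λ { e zero _ → uB ; e (suc i) → all₀ (cong tail e) i }

-- The units in the support of y form a circuit with y. If y lies in A, adding the units on that
-- side gives a vector of both parts, so the sum of those units is y and no unit of the support is
-- left for B; likewise for B.
circuit-one-sided : {G : Pt n → Set} → (∀ i → G (unit i)) → ∀ y → G y → OneSided G (mask y)
circuit-one-sided {G = G} units y gy A B disj cov ret
  with split-units A B y (λ i e → cov (unit∈mask y i e) (units i))
... | c , cA , cB , c⊆ , all₁ , all₀ = case (cov y⊆y gy)
  where
  y⊆y : mem (mask y) y
  y⊆y i e = e
  generate : (E : Sub _) → (∀ i → lookup y i ≡ true → mem E (unit i)) → ∀ {x} → mem (mask y) x → mem E x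
  generate E h {x} x⊆ = generated-by-units E x (λ i e → h i (x⊆ i e))
  case : mem A y ⊎ mem B y → ⊥
  case (inj₁ yA) = ret (inj₁ (generate A (all₁ (sym (⊕≡𝟘⇒≡ y c (disj (⊕∈ (mask y) {y} {c} y⊆y c⊆) (⊕∈ A yA cA) cB))))))
  case (inj₂ yB) = ret (inj₂ (generate B (all₀ (disj c⊆ cA (⊕∈⁻ B yB cB)))))

-- The common unit is nonzero and cannot lie in both parts, so both coordinate subspaces choose the
-- same side.
union-one-sided : {G : Pt n → Set} {P y : Pt n} {i : Fin n} → OneSided G (mask P) → OneSided G (mask y) →
  lookup P i ≡ true → lookup y i ≡ true → OneSided G (mask (P ∪ₘ y))
union-one-sided {n} {G} {P} {y} {i} osP osy Pi yi A B disj cov ret =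
  osP A B (λ {v} h → disj (P⊆ {v} h)) (λ {v} h → cov (P⊆ {v} h)) λ sideP →
    osy A B (λ {v} h → disj (y⊆ {v} h)) (λ {v} h → cov (y⊆ {v} h)) λ sidey → combine sideP sidey
  where
  lookup-∪ : ∀ j → lookup (P ∪ₘ y) j ≡ lookup P j ∨ lookup y j
  lookup-∪ j = lookup-zipWith _∨_ j P y
  P⊆ : ∀ {x} → mem (mask P) x → mem (mask (P ∪ₘ y)) x
  P⊆ h j e = trans (lookup-∪ j) (cong (_∨ lookup y j) (h j e))
  y⊆ : ∀ {x} → mem (mask y) x → mem (mask (P ∪ₘ y)) x
  y⊆ h j e = trans (lookup-∪ j) (trans (cong (lookup P j ∨_) (h j e)) (∨-zeroʳ (lookup P j)))
  uP = unit∈mask P i Pi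
  uy = unit∈mask y i yi
  generate : (E : Sub n) → (∀ {x} → mem (mask P) x → mem E x) → (∀ {x} → mem (mask y) x → mem E x) →
    ∀ {x} → mem (mask (P ∪ₘ y)) x → mem E x
  generate E hP hy {x} x⊆ = generated-by-units E x λ j e → go j (lookup P j) refl (trans (sym (lookup-∪ j)) (x⊆ j e))
    where
    go : ∀ j b → lookup P j ≡ b → lookup P j ∨ lookup y j ≡ true → mem E (unit j)
    go j true Pj _ = hP {unit j} (unit∈mask P j Pj)
    go j false Pj e = hy {unit j} (unit∈mask y j (trans (sym (cong (_∨ lookup y j) Pj)) e))
  combine : (∀ {x} → mem (mask P) x → mem A x) ⊎ (∀ {x} → mem (mask P) x → mem B x) →
    (∀ {x} → mem (mask y) x → mem A x) ⊎ (∀ {x} → mem (mask y) x → mem B x) → ⊥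
  combine (inj₁ p) (inj₁ q) = ret (inj₁ (generate A p q))
  combine (inj₂ p) (inj₂ q) = ret (inj₂ (generate B p q))
  combine (inj₁ p) (inj₂ q) = unit≢𝟘 i (disj (P⊆ {unit i} uP) (p {unit i} uP) (q {unit i} uy))
  combine (inj₂ p) (inj₁ q) = unit≢𝟘 i (disj (P⊆ {unit i} uP) (q {unit i} uy) (p {unit i} uP))

-- The span of the circuit formed by 𝟙, x and the units outside the support of x.
contracted : Pt n → Sub n
contracted x = mask (𝟙 ⊕ x) +lin (x ∷ [])

-- If 𝟙 and x are on different sides, then 𝟙 + c lies in both parts, yet c avoids the support of x
-- and cannot be 𝟙. If they are on the same side, the units left for the other side have sum 𝟘.
contracted-one-sided : {G : Pt n → Set} → (∀ i → G (unit i)) → G 𝟙 → ∀ x → G x → x ≢ 𝟘 → OneSided G (contracted x)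
contracted-one-sided {n} {G} units g𝟙 x gx x≢𝟘 A B disj cov ret
  with split-units A B (𝟙 ⊕ x) (λ i e → cov (⊆+lin (mask (𝟙 ⊕ x)) (x ∷ []) (unit∈mask (𝟙 ⊕ x) i e)) (units i))
... | c , cA , cB , c⊆ , all₁ , all₀ = case (cov 𝟙∈ g𝟙) (cov x∈ gx)
  where
  z = 𝟙 ⊕ x
  W = contracted x
  base : ∀ {v} → mem (mask z) v → mem W v
  base = ⊆+lin (mask z) (x ∷ [])
  x∈ : mem W x
  x∈ = 𝟘 , true ∷ [] , 𝟘∈ (mask z) , solve (x ∷ []) v₀ (⟨0⟩ :+ (v₀ :+ ⟨0⟩)) refl
  𝟙∈ : mem W 𝟙
  𝟙∈ = z , true ∷ [] , (λ i e → e) , solve (𝟙 ∷ x ∷ []) v₀ (v₀ :+ v₁ :+ (v₁ :+ ⟨0⟩)) refl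
  contains : (E : Sub n) → mem E x → (∀ i → lookup z i ≡ true → mem E (unit i)) → ∀ {v} → mem W v → mem E v
  contains E xE h (y , d , y∈ , refl) = ⊕∈ E (generated-by-units E y λ i e → h i (y∈ i e)) (lin∈ E d (xE ∷ []))
  proper : ∀ {c} → mem (mask z) c → 𝟙 ⊕ c ≢ 𝟘
  proper {c} c⊆ e = x≢𝟘 (lookup-ext x 𝟘 λ i → trans (not-true (trans (sym (lookup-𝟙⊕ x i))
      (c⊆ i (trans (cong (λ v → lookup v i) (sym (⊕≡𝟘⇒≡ 𝟙 c e))) (lookup-replicate i true))))) (sym (lookup-replicate i false)))
  together : ∀ {A B} → Disjoint-on W A B → ∀ {c} → mem A c → mem B (z ⊕ c) → mem (mask z) c → mem A 𝟙 → mem A x →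
    z ≡ c
  together {A} {B} disj {c} cA cB c⊆ 𝟙A xA = ⊕≡𝟘⇒≡ z c
    (disj (⊕∈ W (base (λ i e → e)) (base c⊆)) (⊕∈ A (⊕∈ A 𝟙A xA) cA) cB)
  apart : ∀ {A B} → Disjoint-on W A B → ∀ {c} → mem A c → mem B (z ⊕ c) → mem (mask z) c → mem A 𝟙 → mem B x → ⊥
  apart {A} {B} disj {c} cA cB c⊆ 𝟙A xB = proper c⊆ (disj (⊕∈ W 𝟙∈ (base c⊆)) (⊕∈ A 𝟙A cA)
    (subst (mem B) (solve (𝟙 ∷ x ∷ c ∷ []) (v₁ :+ (v₀ :+ v₁ :+ v₂)) (v₀ :+ v₂) refl) (⊕∈ B xB cB)))
  flipA : mem A (z ⊕ (z ⊕ c))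
  flipA = subst (mem A) (sym (⊕-cancel z c)) cA
  flip⊆ : mem (mask z) (z ⊕ c)
  flip⊆ = ⊕∈ (mask z) {z} {c} (λ i e → e) c⊆
  swapped : Disjoint-on W B A
  swapped w b a = disj w a b
  case : mem A 𝟙 ⊎ mem B 𝟙 → mem A x ⊎ mem B x → ⊥
  case (inj₁ 𝟙A) (inj₁ xA) = ret (inj₁ (contains A xA (all₁ (sym (together {A} {B} disj cA cB c⊆ 𝟙A xA)))))
  case (inj₁ 𝟙A) (inj₂ xB) = apart {A} {B} disj cA cB c⊆ 𝟙A xB
  case (inj₂ 𝟙B) (inj₁ xA) = apart {B} {A} swapped cB flipA flip⊆ 𝟙B xA
  case (inj₂ 𝟙B) (inj₂ xB) = ret (inj₂ (contains B xB (all₀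
    (trans (sym (⊕-cancel z c)) (trans (cong (z ⊕_) (sym (together {B} {A} swapped cB flipA flip⊆ 𝟙B xB))) (⊕-self z))))))

-- Every vector of `contracted x` is constant on the support of x, and a unit from the support has
-- this property only if it is x.
contracted-proper : (x : Pt n) → x ≢ 𝟘 → (∀ i → x ≢ unit i) → ∃ λ v → ¬ mem (contracted x) v
contracted-proper {n} x x≢𝟘 x≢unit with nonzero-coordinate x x≢𝟘
... | i , xi = unit i , λ where
    (y , false ∷ [] , y∈ , e) → contradict (trans (lookup-𝟙⊕ x i) (cong not xi))
      (y∈ i (trans (cong (λ v → lookup v i) (trans (solve (y ∷ []) v₀ (v₀ :+ (⟨0⟩ :+ ⟨0⟩)) refl) (sym e))) (lookup-unit i)))
    (y , true ∷ [] , y∈ , e) → x≢unit i (lookup-ext x (unit i) λ j →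
      same {y} j (lookup x j) refl (lookup (unit i) j) refl (y∈ j)
        (trans (cong (λ v → lookup v j) e) 
          (trans (lookup-zipWith _xor_ j y (x ⊕ 𝟘)) (cong (λ v → lookup y j xor lookup v j) (⊕-idʳ x)))))
  where
  same : ∀ {y : Pt n} j a → lookup x j ≡ a → ∀ b → lookup (unit i) j ≡ b →
    (lookup y j ≡ true → lookup (𝟙 ⊕ x) j ≡ true) → lookup (unit i) j ≡ lookup y j xor lookup x j → lookup x j ≡ lookup (unit i) j
  same j true xj true uj h e = trans xj (sym uj)
  same j false xj false uj h e = trans xj (sym uj)
  same j false xj true uj h e with lookup-unit⁻ i j uj
  ... | refl = contradict xj xi
  same {y} j true xj false uj h e = contradict (trans (lookup-𝟙⊕ x j) (cong not xj))
    (h (flip (lookup y j) (trans (sym uj) (trans e (cong (lookup y j xor_) xj)))))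
    where
    flip : ∀ b → false ≡ b xor true → b ≡ true
    flip true e = refl

-- Identifying the circuit in coordinates

module _ {n : ℕ} {G : Pt n → Set} (6≤n : 6 ≤ n) (units : ∀ i → G (unit i)) (loopless : ¬ G 𝟘) (ns : ¬ Sep G full)
  (sections : ∀ W → Dim≥ 4 W → (∃ λ v → ¬ mem W v) → ¬ ¬ Sep G W) where

  private
    small⇒proper : {P : Pt n} → count P ≤ 5 → ∃ λ i → lookup P i ≡ false
    small⇒proper {P} le = some-false P (≤-trans (s≤s le) 6≤n)

  large⇒𝟙 : ∀ {y} → 4 ≤ count y → OneSided G (mask y) → y ≡ 𝟙
  large⇒𝟙 {y} le os = decidable-stable (y ≟ₚ 𝟙) λ y≢𝟙 →
    sections (mask y) (dim-≤ {W = mask y} le (dim-mask y)) (mask-proper {P = y} (≢𝟙⇒some-false y y≢𝟙)) (one-sided⇒nonsep os)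

  count-𝟙 : count (𝟙 {n}) ≡ n
  count-𝟙 = go n
    where
    go : ∀ n → count (𝟙 {n}) ≡ n
    go zero = refl
    go (suc n) = cong suc (go n)

  -- P is a connected set of at most three units. It and its complement do not separate G, so some y
  -- of G has support crossing the boundary of P, and this support also has size at most three since
  -- y is not 𝟙. The union is again connected: with four or five units it would be an inseparable
  -- proper section, and with at most three it continues the growth, whose remaining steps `f`
  -- counts.
  grow : ¬ G 𝟙 → ∀ f P i → lookup P i ≡ true → OneSided G (mask P) → count P ≤ 3 → 4 ≤ count P + f → ⊥
  grow ¬g𝟙 zero P i Pi os le ge = n≮n 3 (≤-trans (subst (4 ≤_) (+-identityʳ _) ge) le)
  grow ¬g𝟙 (suc f) P i Pi os le ge =
    em {P = ∃ λ y → G y × (∃ λ j → lookup y j ≡ true × lookup P j ≡ true) × (∃ λ k → lookup y k ≡ true × lookup P k ≡ false)} λ where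
      (yes (y , gy , (j , yj , Pj) , (k , yk , Pk))) → step y gy j yj Pj k yk Pk
      (no none) → ns record
        { A = mask P ; B = mask (𝟙 ⊕ P)
        ; disjoint = λ {x} _ p q → lookup-ext x 𝟘 λ j → zero-at x j p q (lookup x j) refl
        ; A-proper = let v , v∉ = mask-proper {P = P} (small⇒proper {P} (≤-trans le (m≤m+n 3 2))) in v , tt , v∉
        ; B-proper = let v , v∉ = mask-proper {P = 𝟙 ⊕ P} (i , trans (lookup-𝟙⊕ P i) (cong not Pi)) in v , tt , v∉
        ; cover = λ {x} _ gx → side x gx none (inside-or-sticks-out x P) (inside-or-sticks-out x (𝟙 ⊕ P)) }
    where
    zero-at : ∀ x j → mem (mask P) x → mem (mask (𝟙 ⊕ P)) x → ∀ b → lookup x j ≡ b → lookup x j ≡ lookup 𝟘 j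
    zero-at x j p q false xj = trans xj (sym (lookup-replicate j false))
    zero-at x j p q true xj = contradict (trans (lookup-𝟙⊕ P j) (cong not (p j xj))) (q j xj)
    side : ∀ x → G x → ¬ _ → mem (mask P) x ⊎ _ → mem (mask (𝟙 ⊕ P)) x ⊎ _ → mem (mask P) x ⊎ mem (mask (𝟙 ⊕ P)) x
    side x gx none (inj₁ h) _ = inj₁ h
    side x gx none (inj₂ _) (inj₁ h) = inj₂ h
    side x gx none (inj₂ (k , xk , Pk)) (inj₂ (j , xj , Pj)) =
      ⊥-elim (none (x , gx , (j , xj , not-false (trans (sym (lookup-𝟙⊕ P j)) Pj)) , (k , xk , Pk)))
      where
      not-false : ∀ {b} → not b ≡ false → b ≡ true
      not-false {true} e = refl
    step : ∀ y → G y → ∀ j → lookup y j ≡ true → lookup P j ≡ true → ∀ k → lookup y k ≡ true → lookup P k ≡ false → ⊥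
    step y gy j yj Pj k yk Pk with 4 ≤? count y
    ... | yes large = ¬g𝟙 (subst G (large⇒𝟙 large (circuit-one-sided units y gy)) gy)
    ... | no small with 4 ≤? count (P ∪ₘ y)
    ...   | no small′ = grow ¬g𝟙 f (P ∪ₘ y) j (trans (lookup-zipWith _∨_ j P y) (cong (_∨ lookup y j) Pj)) os′
              (≤-pred (≰⇒> small′)) (≤-trans (subst (4 ≤_) (+-suc _ f) ge) (+-monoˡ-≤ f (count-∪-> P y k Pk yk)))
      where os′ = union-one-sided {P = P} {y} {j} os (circuit-one-sided units y gy) Pj yj
    ...   | yes large = n≮n n (≤-trans (s≤s (≤-reflexive (trans (sym count-𝟙) (cong count (sym (large⇒𝟙 {P ∪ₘ y} large os′))))))
              (≤-trans (s≤s count≤5) 6≤n))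
      where
      os′ = union-one-sided {P = P} {y} {j} os (circuit-one-sided units y gy) Pj yj
      -- At most 3 + 3 coordinates, at least one of them shared; since 6 ≤ n, the union is not
      -- everything.
      count≤5 : count (P ∪ₘ y) ≤ 5
      count≤5 = ≤-pred (≤-trans (count-∪-overlap P y j Pj yj) (+-mono-≤ le (≤-pred (≰⇒> small))))

  𝟙∈G : ¬ ¬ G 𝟙
  𝟙∈G ¬g𝟙 = grow ¬g𝟙 3 (unit i₀) i₀ (lookup-unit i₀) (circuit-one-sided units (unit i₀) (units i₀))
      (subst (_≤ 3) (sym (count-unit i₀)) (m≤m+n 1 2)) (subst (λ c → 4 ≤ c + 3) (sym (count-unit i₀)) ≤-refl)
    where
    i₀ : Fin n
    i₀ = fromℕ< (≤-trans (m≤m+n 1 5) 6≤n)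

  only-units : G 𝟙 → ∀ x → G x → (∃ λ i → x ≡ unit i) ⊎ x ≡ 𝟙
  only-units g𝟙 x gx with 4 ≤? count x
  ... | yes large = inj₂ (large⇒𝟙 large (circuit-one-sided units x gx))
  ... | no small with FP.any? (λ i → x ≟ₚ unit i)
  ...   | yes e = inj₁ e
  -- At least 6 - 3 units lie outside the support of x, and x adds one dimension: the four that
  -- `sections` asks for.
  ...   | no x≢unit = ⊥-elim (sections (contracted x)
            (dim-suc {W = mask (𝟙 ⊕ x)} (contracted x) (⊆+lin (mask (𝟙 ⊕ x)) (x ∷ [])) x∈ x∉
              (dim-≤ {W = mask (𝟙 ⊕ x)} 3≤ (dim-mask (𝟙 ⊕ x))))
            (contracted-proper x x≢𝟘 λ i e → x≢unit (i , e)) (one-sided⇒nonsep (contracted-one-sided units g𝟙 x gx x≢𝟘)))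
    where
    x≢𝟘 : x ≢ 𝟘
    x≢𝟘 refl = loopless gx
    x∈ : mem (contracted x) x
    x∈ = 𝟘 , true ∷ [] , 𝟘∈ (mask (𝟙 ⊕ x)) , solve (x ∷ []) v₀ (⟨0⟩ :+ (v₀ :+ ⟨0⟩)) refl
    x∉ : ¬ mem (mask (𝟙 ⊕ x)) x
    x∉ h with nonzero-coordinate x x≢𝟘
    ... | i , xi = contradict (trans (lookup-𝟙⊕ x i) (cong not xi)) (h i xi)
    3≤ : 3 ≤ count (𝟙 ⊕ x)
    3≤ = +-cancelˡ-≤ 3 3 _ (≤-trans 6≤n (≤-trans (≤-reflexive (sym (count-complement x)))
      (+-monoˡ-≤ (count (𝟙 ⊕ x)) (≤-pred (≰⇒> small)))))

-- Sums and cardinalities of point sets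

∅ : PSet n
∅ _ = false

single : Pt n → PSet n
single e x = x == e

single-refl : (e : Pt n) → single e e ≡ true
single-refl e = dec-true (e ≟ₚ e) refl

single⇒≡ : {x e : Pt n} → single e x ≡ true → x ≡ e
single⇒≡ {x = x} {e} h with x ≟ₚ e
... | yes p = p

infixl 6 _Δ_
_Δ_ : PSet n → PSet n → PSet n
(X Δ Y) x = X x xor Y x

bit : Bool → ℕ
bit true  = 1
bit false = 0

bit≤1 : ∀ c → bit c ≤ 1
bit≤1 true  = ≤-refl
bit≤1 false = z≤n

sumL : PSet n → List (Pt n) → Pt n
sumL S L = foldr _⊕ᵥ_ 𝟘 (filt S L)

sumL-∷ : (S : PSet n) (x : Pt n) (L : List (Pt n)) → sumL S (x ∷ L) ≡ S x · x ⊕ sumL S L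
sumL-∷ S x L with S x
... | true  = refl
... | false = sym (⊕-idˡ _)

length-filt-∷ : (S : PSet n) (x : Pt n) (L : List (Pt n)) → length (filt S (x ∷ L)) ≡ bit (S x) + length (filt S L)
length-filt-∷ S x L with S x
... | true  = refl
... | false = refl

sumL-cong : {S S′ : PSet n} → S ≗ S′ → ∀ L → sumL S L ≡ sumL S′ L
sumL-cong h [] = refl
sumL-cong {S = S} {S′} h (x ∷ L) = trans (sumL-∷ S x L)
  (trans (cong₂ _⊕_ (cong (_· x) (h x)) (sumL-cong h L)) (sym (sumL-∷ S′ x L)))

sumL-Δ : (S S′ : PSet n) → ∀ L → sumL (S Δ S′) L ≡ sumL S L ⊕ sumL S′ L
sumL-Δ S S′ [] = sym (⊕-self 𝟘)
sumL-Δ S S′ (x ∷ L) = begin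
  sumL (S Δ S′) (x ∷ L)                               ≡⟨ sumL-∷ (S Δ S′) x L ⟩
  (S x xor S′ x) · x ⊕ sumL (S Δ S′) L               ≡⟨ cong₂ _⊕_ (·-xor (S x) (S′ x) x) (sumL-Δ S S′ L) ⟩
  (S x · x ⊕ S′ x · x) ⊕ (sumL S L ⊕ sumL S′ L)     ≡⟨ ⊕-medial (S x · x) (S′ x · x) (sumL S L) (sumL S′ L) ⟩
  (S x · x ⊕ sumL S L) ⊕ (S′ x · x ⊕ sumL S′ L)     ≡⟨ sym (cong₂ _⊕_ (sumL-∷ S x L) (sumL-∷ S′ x L)) ⟩
  sumL S (x ∷ L) ⊕ sumL S′ (x ∷ L)                   ∎
  where open ≡-Reasoning

sumS-cong : {S S′ : PSet n} → S ≗ S′ → sumS S ≡ sumS S′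
sumS-cong h = sumL-cong h (allPts _)

sumS-Δ : (S S′ : PSet n) → sumS (S Δ S′) ≡ sumS S ⊕ sumS S′
sumS-Δ S S′ = sumL-Δ S S′ (allPts _)

sumS-∅ : sumS (∅ {n}) ≡ 𝟘
sumS-∅ {n} = trans (sumS-Δ ∅ ∅) (⊕-self (sumS (∅ {n})))

sumL∈ : (W : Sub n) {S : PSet n} → (∀ x → x ∈ S → mem W x) → ∀ L → mem W (sumL S L)
sumL∈ W h [] = 𝟘∈ W
sumL∈ W {S} h (x ∷ L) = subst (mem W) (sym (sumL-∷ S x L)) (⊕∈ W (head (S x) refl) (sumL∈ W h L))
  where
  head : ∀ b → S x ≡ b → mem W (b · x)
  head true  e = h x e
  head false e = 𝟘∈ W

sumS∈ : (W : Sub n) {S : PSet n} → (∀ x → x ∈ S → mem W x) → mem W (sumS S)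
sumS∈ W h = sumL∈ W h (allPts _)

double : List (Pt n) → List (Pt (suc n))
double = concatMap (λ v → (false ∷ v) ∷ (true ∷ v) ∷ [])

count-single-double : ∀ c (e : Pt n) L → length (filt (single (c ∷ e)) (double L)) ≡ length (filt (single e) L)
count-single-double c e [] = refl
count-single-double c e (v ∷ L) = begin
  length (filt S ((false ∷ v) ∷ (true ∷ v) ∷ double L))
    ≡⟨ length-filt-∷ S (false ∷ v) _ ⟩
  bit (S (false ∷ v)) + length (filt S ((true ∷ v) ∷ double L))
    ≡⟨ cong (bit (S (false ∷ v)) +_) (length-filt-∷ S (true ∷ v) _) ⟩
  bit (S (false ∷ v)) + (bit (S (true ∷ v)) + length (filt S (double L)))
    ≡⟨ sym (+-assoc (bit (S (false ∷ v))) _ _) ⟩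
  bit (S (false ∷ v)) + bit (S (true ∷ v)) + length (filt S (double L))
    ≡⟨ cong₂ _+_ (heads c) (count-single-double c e L) ⟩
  bit (single e v) + length (filt (single e) L)
    ≡⟨ sym (length-filt-∷ (single e) v L) ⟩
  length (filt (single e) (v ∷ L)) ∎
  where
  open ≡-Reasoning
  S = single (c ∷ e)
  heads : ∀ c → bit (single (c ∷ e) (false ∷ v)) + bit (single (c ∷ e) (true ∷ v)) ≡ bit (single e v)
  heads c with v ≟ₚ e
  heads true  | yes refl = refl
  heads false | yes refl = refl
  heads true  | no _ = refl
  heads false | no _ = refl

card-single : (e : Pt n) → card (single e) ≡ 1
card-single []      = refl
card-single (c ∷ e) = trans (count-single-double c e (allPts _)) (card-single e)

times : ℕ → Pt n → Pt n
times zero    x = 𝟘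
times (suc k) x = x ⊕ times k x

sumL-single : (e : Pt n) (L : List (Pt n)) → sumL (single e) L ≡ times (length (filt (single e) L)) e
sumL-single e [] = refl
sumL-single e (x ∷ L) with x ≟ₚ e
... | yes refl = cong (x ⊕_) (sumL-single e L)
... | no _     = sumL-single e L

sumS-single : (e : Pt n) → sumS (single e) ≡ e
sumS-single e = trans (sumL-single e (allPts _)) (trans (cong (λ k → times k e) (card-single e)) (⊕-idʳ e))

card-∪ : (S : PSet n) (e : Pt n) → e ∉ S → card (S ∪｛ e ｝) ≡ suc (card S)
card-∪ S e e∉ = trans (go (allPts _)) (trans (cong (card S +_) (card-single e)) (+-comm (card S) 1))
  where
  go : ∀ L → length (filt (S ∪｛ e ｝) L) ≡ length (filt S L) + length (filt (single e) L)
  go [] = refl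
  go (x ∷ L) = trans (length-filt-∷ (S ∪｛ e ｝) x L) (trans (cong₂ _+_ (bits (S x) refl (x == e) refl) (go L))
    (trans (rearrange (bit (S x)) _ _ _) (sym (cong₂ _+_ (length-filt-∷ S x L) (length-filt-∷ (single e) x L)))))
    where
    bits : ∀ c → S x ≡ c → ∀ d → (x == e) ≡ d → bit (S x ∨ (x == e)) ≡ bit (S x) + bit (x == e)
    bits true  p true  q = contradict (trans (cong S (single⇒≡ q)) e∉) p
    bits true  p false q rewrite p | q = refl
    bits false p d     q rewrite p = refl
    rearrange : ∀ p q r s → (p + q) + (r + s) ≡ (p + r) + (q + s)
    rearrange p q r s = trans (+-assoc p q (r + s)) (trans (cong (p +_) (trans (sym (+-assoc q r s))
      (trans (cong (_+ s) (+-comm q r)) (+-assoc r q s)))) (sym (+-assoc p r (q + s))))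

card-mono : {Z X : PSet n} → Z ⊆ X → ∀ {e} → e ∈ X → e ∉ Z → card Z < card X
card-mono {Z = Z} {X} Z⊆X {e} e∈ e∉ = subst (_≤ card X) (card-∪ Z e e∉) (go (allPts _))
  where
  go : ∀ L → length (filt (Z ∪｛ e ｝) L) ≤ length (filt X L)
  go [] = z≤n
  go (x ∷ L) = ≤-trans (≤-reflexive (length-filt-∷ (Z ∪｛ e ｝) x L))
    (≤-trans (+-mono-≤ (bits (Z x) refl (x == e) refl) (go L)) (≤-reflexive (sym (length-filt-∷ X x L))))
    where
    bits : ∀ c → Z x ≡ c → ∀ d → (x == e) ≡ d → bit (Z x ∨ (x == e)) ≤ bit (X x)
    bits true  p d     q rewrite p | Z⊆X x p = ≤-refl
    bits false p true  q = subst (λ c → bit (Z x ∨ (x == e)) ≤ bit c)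
      (sym (trans (cong X (single⇒≡ {x = x} {e} q)) e∈)) (bit≤1 (Z x ∨ (x == e)))
    bits false p false q rewrite p | q = z≤n

-- Additive functions on point sets

record Additive (Φ : PSet k → Pt n) : Set where
  field
    Φ-cong : ∀ {X Y} → X ≗ Y → Φ X ≡ Φ Y
    Φ-Δ    : ∀ X Y → Φ (X Δ Y) ≡ Φ X ⊕ Φ Y
open Additive

additive-∅ : {Φ : PSet k → Pt n} → Additive Φ → Φ ∅ ≡ 𝟘
additive-∅ {Φ = Φ} A = trans (Φ-Δ A ∅ ∅) (⊕-self (Φ ∅))

slice : Bool → PSet k → PSet (suc k)
slice c Z (d ∷ v) = not (c xor d) ∧ Z v

additive-slice : {Φ : PSet (suc k) → Pt n} → Additive Φ → ∀ c → Additive (Φ ∘ slice c)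
additive-slice A c = record
  { Φ-cong = λ h → Φ-cong A λ { (d ∷ v) → cong (not (c xor d) ∧_) (h v) }
  ; Φ-Δ = λ X Y → trans (Φ-cong A λ { (d ∷ v) → ∧-distribˡ-xor (not (c xor d)) (X v) (Y v) }) (Φ-Δ A (slice c X) (slice c Y)) }

slice-single : ∀ c (e : Pt k) → slice c (single e) ≗ single (c ∷ e)
slice-single c e (d ∷ v) with v ≟ₚ e
slice-single true e (true ∷ v) | yes _ = refl
slice-single true e (false ∷ v) | yes _ = refl
slice-single false e (true ∷ v) | yes _ = refl
slice-single false e (false ∷ v) | yes _ = refl
slice-single true e (true ∷ v) | no _ = refl
slice-single true e (false ∷ v) | no _ = refl
slice-single false e (true ∷ v) | no _ = refl
slice-single false e (false ∷ v) | no _ = refl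

-- Singletons generate all point sets under symmetric difference; the induction splits a set by the
-- first coordinate of its points.
additive-unique : {Φ Ψ : PSet k → Pt n} → Additive Φ → Additive Ψ →
  (∀ e → Φ (single e) ≡ Ψ (single e)) → ∀ Z → Φ Z ≡ Ψ Z
additive-unique {zero} {Φ = Φ} {Ψ} A B h Z = go (Z []) refl
  where
  go : ∀ c → Z [] ≡ c → Φ Z ≡ Ψ Z
  go true  e = trans (Φ-cong A {Y = single []} λ { [] → e }) (trans (h []) (Φ-cong B λ { [] → sym e }))
  go false e = trans (Φ-cong A {Y = ∅} λ { [] → e })
    (trans (additive-∅ A) (trans (sym (additive-∅ B)) (Φ-cong B λ { [] → sym e })))
additive-unique {suc k} {Φ = Φ} {Ψ} A B h Z = begin
  Φ Z                                    ≡⟨ Φ-cong A parts ⟩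
  Φ (slice false Z₀ Δ slice true Z₁)     ≡⟨ Φ-Δ A _ _ ⟩
  Φ (slice false Z₀) ⊕ Φ (slice true Z₁) ≡⟨ cong₂ _⊕_ (rec false Z₀) (rec true Z₁) ⟩
  Ψ (slice false Z₀) ⊕ Ψ (slice true Z₁) ≡⟨ sym (Φ-Δ B _ _) ⟩
  Ψ (slice false Z₀ Δ slice true Z₁)     ≡⟨ sym (Φ-cong B parts) ⟩
  Ψ Z                                    ∎
  where
  open ≡-Reasoning
  Z₀ Z₁ : PSet k
  Z₀ v = Z (false ∷ v)
  Z₁ v = Z (true ∷ v)
  parts : Z ≗ slice false Z₀ Δ slice true Z₁
  parts (true ∷ v)  = refl
  parts (false ∷ v) with Z (false ∷ v)
  ... | true = refl
  ... | false = refl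
  rec : ∀ c Y → Φ (slice c Y) ≡ Ψ (slice c Y)
  rec c = additive-unique (additive-slice A c) (additive-slice B c) λ e →
    trans (Φ-cong A (slice-single c e)) (trans (h (c ∷ e)) (sym (Φ-cong B (slice-single c e))))

-- Isomorphisms

Indep-cong : {X Y : PSet n} → X ≗ Y → Indep X → Indep Y
Indep-cong h ind Z Z⊆Y = ind Z λ x x∈ → trans (h x) (Z⊆Y x x∈)

image : (T′ : PSet b) (g : Pt b → Pt a) → PSet a → PSet b
image T′ g X y = T′ y ∧ X (g y)

image-Δ : (T′ : PSet b) (g : Pt b → Pt a) (X Y : PSet a) → image T′ g (X Δ Y) ≗ image T′ g X Δ image T′ g Y
image-Δ T′ g X Y y = ∧-distribˡ-xor (T′ y) (X (g y)) (Y (g y))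

Linear : (Pt b → Pt a) → Set
Linear g = ∀ x y → g (x ⊕ y) ≡ g x ⊕ g y

linear-𝟘 : {g : Pt b → Pt a} → Linear g → g 𝟘 ≡ 𝟘
linear-𝟘 {g = g} lin = trans (cong g (sym (⊕-self 𝟘))) (trans (lin 𝟘 𝟘) (⊕-self (g 𝟘)))

module _ {T : PSet a} {T′ : PSet b} (g : Pt b → Pt a) (g-lin : Linear g) (D : Sub b)
  (T′⊆D : ∀ y → y ∈ T′ → mem D y) (injective : ∀ {y} → mem D y → g y ≡ 𝟘 → y ≡ 𝟘)
  (g∈ : ∀ y → y ∈ T′ → g y ∈ T) (lift : ∀ x → x ∈ T → ∃ λ y → y ∈ T′ × g y ≡ x) where

  private
    f′ : ∀ x c → T x ≡ c → Pt b
    f′ x true  e = proj₁ (lift x e)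
    -- A default value: an isomorphism constrains f only on T.
    f′ x false e = 𝟘

    f : Pt a → Pt b
    f x = f′ x (T x) refl

    f-spec : ∀ x → x ∈ T → f x ∈ T′ × g (f x) ≡ x
    f-spec x x∈ = go (T x) refl
      where
      go : ∀ c (e : T x ≡ c) → f′ x c e ∈ T′ × g (f′ x c e) ≡ x
      go true  e = proj₂ (lift x e)
      go false e = contradict e x∈

    g-injective : ∀ {y z} → mem D y → mem D z → g y ≡ g z → y ≡ z
    g-injective {y} {z} y∈ z∈ e = ⊕≡𝟘⇒≡ y z (injective (⊕∈ D y∈ z∈)
      (trans (g-lin y z) (trans (cong (_⊕ g z) e) (⊕-self (g z)))))

    f∈ : ∀ x → x ∈ T → f x ∈ T′
    f∈ x x∈ = proj₁ (f-spec x x∈)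

    gf : ∀ x → x ∈ T → g (f x) ≡ x
    gf x x∈ = proj₂ (f-spec x x∈)

    fg : ∀ y → y ∈ T′ → f (g y) ≡ y
    fg y y∈ = g-injective (T′⊆D _ (f∈ _ (g∈ y y∈))) (T′⊆D y y∈) (gf _ (g∈ y y∈))

    -- Both sides are additive in X once X is cut down to T, so singletons suffice.
    sum-image : ∀ X → X ⊆ T → g (sumS (image T′ g X)) ≡ sumS X
    sum-image X X⊆T = trans (additive-unique
        record { Φ-cong = λ h → cong g (sumS-cong λ y → cong (T′ y ∧_) (h (g y)))
               ; Φ-Δ = λ X Y → trans (cong g (trans (sumS-cong (image-Δ T′ g X Y)) (sumS-Δ _ _))) (g-lin _ _) }
        record { Φ-cong = λ h → sumS-cong λ x → cong (T x ∧_) (h x)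
               ; Φ-Δ = λ X Y → trans (sumS-cong λ x → ∧-distribˡ-xor (T x) (X x) (Y x)) (sumS-Δ _ _) }
        singles X)
      (sumS-cong λ x → bool-ext (λ h → proj₂ (∧-true h)) (λ h → ∧-true⁺ (X⊆T x h) h))
      where
      singles : ∀ e → g (sumS (image T′ g (single e))) ≡ sumS (λ x → T x ∧ single e x)
      singles e = go (T e) refl
        where
        go : ∀ c → T e ≡ c → g (sumS (image T′ g (single e))) ≡ sumS (λ x → T x ∧ single e x)
        go true e∈ = begin
          g (sumS (image T′ g (single e))) ≡⟨ cong g (sumS-cong λ y → bool-ext
              (λ h → let y∈ , gy≡e = ∧-true h in
                subst (λ z → single z y ≡ true) (trans (sym (fg y y∈)) (cong f (single⇒≡ gy≡e))) (single-refl y))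
              (λ h → subst (λ z → T′ z ∧ single e (g z) ≡ true) (sym (single⇒≡ h))
                (∧-true⁺ (f∈ e e∈) (subst (λ z → single e z ≡ true) (sym (gf e e∈)) (single-refl e))))) ⟩
          g (sumS (single (f e)))          ≡⟨ cong g (sumS-single (f e)) ⟩
          g (f e)                          ≡⟨ gf e e∈ ⟩
          e                                ≡⟨ sym (sumS-single e) ⟩
          sumS (single e)                  ≡⟨ sumS-cong (λ x → bool-ext
              (λ h → ∧-true⁺ (subst (_∈ T) (sym (single⇒≡ h)) e∈) h) (λ h → proj₂ (∧-true h))) ⟩
          sumS (λ x → T x ∧ single e x)   ∎
          where open ≡-Reasoning
        go false e∉ = begin
          g (sumS (image T′ g (single e))) ≡⟨ cong g (sumS-cong {S′ = ∅} λ y → bool-ext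
              (λ h → let y∈ , gy≡e = ∧-true h in contradict e∉ (subst (_∈ T) (single⇒≡ gy≡e) (g∈ y y∈))) λ ()) ⟩
          g (sumS (∅ {b}))                 ≡⟨ cong g sumS-∅ ⟩
          g 𝟘                              ≡⟨ linear-𝟘 g-lin ⟩
          𝟘                                ≡⟨ sym sumS-∅ ⟩
          sumS (∅ {a})                     ≡⟨ sumS-cong (λ x → bool-ext (λ ())
              (λ h → let x∈ , x≡e = ∧-true h in contradict e∉ (subst (_∈ T) (single⇒≡ x≡e) x∈))) ⟩
          sumS (λ x → T x ∧ single e x)   ∎
          where open ≡-Reasoning

  -- The linear map runs from T′ back to T because `_≅_` forms images by pulling back along `g`.
  -- Being injective on a subspace containing T′, it matches vanishing sums in both directions.
  linear-iso : T ≅ T′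
  linear-iso = record
    { f = f ; g = g ; f∈ = f∈ ; g∈ = g∈ ; gf = gf ; fg = fg
    ; indep = λ X X⊆T → mk⇔ (forward X X⊆T) (backward X X⊆T) }
    where
    forward : ∀ X → X ⊆ T → Indep X → Indep (image T′ g X)
    forward X X⊆T ind Z′ Z′⊆ (y , y∈) e = ind Z Z⊆X (g y , Z∋gy)
        (trans (sym (sum-image Z Z⊆T)) (trans (cong g (trans (sumS-cong image-Z) e)) (linear-𝟘 g-lin)))
      where
      Z : PSet a
      Z x = T x ∧ Z′ (f x)
      Z⊆T : Z ⊆ T
      Z⊆T x h = proj₁ (∧-true h)
      Z⊆X : Z ⊆ X
      Z⊆X x h = let x∈T , fx∈ = ∧-true h in subst (_∈ X) (gf x x∈T) (proj₂ (∧-true (Z′⊆ (f x) fx∈)))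
      Z′⊆T′ : ∀ y → y ∈ Z′ → y ∈ T′
      Z′⊆T′ y h = proj₁ (∧-true (Z′⊆ y h))
      image-Z : image T′ g Z ≗ Z′
      image-Z y = bool-ext
        (λ h → let y∈ , gy∈ = ∧-true h in subst (_∈ Z′) (fg y y∈) (proj₂ (∧-true gy∈)))
        (λ h → ∧-true⁺ (Z′⊆T′ y h) (∧-true⁺ (g∈ y (Z′⊆T′ y h)) (subst (_∈ Z′) (sym (fg y (Z′⊆T′ y h))) h)))
      Z∋gy : g y ∈ Z
      Z∋gy = proj₂ (∧-true {T′ y} (trans (image-Z y) y∈))
    backward : ∀ X → X ⊆ T → Indep (image T′ g X) → Indep X
    backward X X⊆T ind Z Z⊆X (x , x∈) e = ind (image T′ g Z)
      (λ y h → let y∈ , gy∈ = ∧-true h in ∧-true⁺ y∈ (Z⊆X (g y) gy∈))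
      (f x , ∧-true⁺ (f∈ x x∈T) (subst (_∈ Z) (sym (gf x x∈T)) x∈))
      (injective (sumS∈ D λ y h → T′⊆D y (proj₁ (∧-true h))) (trans (sum-image Z λ x h → X⊆T x (Z⊆X x h)) e))
      where x∈T = X⊆T x (Z⊆X x x∈)

≅-sym : {T : PSet a} {T′ : PSet b} → T ≅ T′ → T′ ≅ T
≅-sym {T = T} {T′} I = record
  { f = g ; g = f ; f∈ = g∈ ; g∈ = f∈ ; gf = fg ; fg = gf
  ; indep = λ X′ X′⊆T′ →
      let X = image T f X′
          back : image T′ g X ≗ X′
          back y = bool-ext
            (λ h → let y∈ , gy∈ = ∧-true h in subst (_∈ X′) (fg y y∈) (proj₂ (∧-true gy∈)))
            (λ h → let y∈ = X′⊆T′ y h in ∧-true⁺ y∈ (∧-true⁺ (g∈ y y∈) (subst (_∈ X′) (sym (fg y y∈)) h)))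
          e = indep X (λ x h → proj₁ (∧-true h))
      in mk⇔ (λ ind → Equivalence.from e (Indep-cong (sym ∘ back) ind))
              (λ ind → Indep-cong back (Equivalence.to e ind)) }
  where open _≅_ I

dependent-subset : {X : PSet n} → ¬ Indep X → ¬ ¬ (∃ λ Z → Z ⊆ X × (∃ λ y → y ∈ Z) × sumS Z ≡ 𝟘)
dependent-subset dep ret = dep λ Z Z⊆X ne e → ret (Z , Z⊆X , ne , e)

module _ {T : PSet a} {T′ : PSet b} (I : T ≅ T′) where
  open _≅_ I

  private
    img = image T′ g

    Δ⊆ : ∀ {X Z : PSet a} → Z ⊆ X → (X Δ Z) ⊆ X
    Δ⊆ {X} {Z} Z⊆X x h with X x in e | Z x in e′
    ... | true | _ = refl
    ... | false | true = contradict e (Z⊆X x e′)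

  -- A circuit of T is mapped to a circuit of T′, since its image is dependent but no proper subset is.
  iso-sum : ∀ X → X ⊆ T → sumS X ≡ 𝟘 → sumS (img X) ≡ 𝟘
  iso-sum X X⊆T e = go (suc (card X)) X X⊆T e ≤-refl
    where
    go : ∀ f X → X ⊆ T → sumS X ≡ 𝟘 → card X < f → sumS (img X) ≡ 𝟘
    go (suc fuel) X X⊆T e lt = decidable-stable (sumS (img X) ≟ₚ 𝟘) λ ne →
      em {P = ∃ λ x → x ∈ X} λ where
        (no none) → ne (trans (sumS-cong {S′ = ∅} λ y → ≢true⇒≡false (λ h → ⊥-elim (none (g y , proj₂ (∧-true h))))) sumS-∅)
        (yes X≠∅) → em {P = ∃ λ Z → Z ⊆ X × (∃ λ z → z ∈ Z) × (∃ λ x → x ∈ X × x ∉ Z) × sumS Z ≡ 𝟘} λ where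
          -- A proper nonempty part with sum 𝟘 splits X into two smaller sets with sum 𝟘.
          (yes (Z , Z⊆X , (z , z∈) , (x , x∈ , x∉) , sZ)) →
            let
              Y = X Δ Z
              z∉Y : z ∉ Y
              z∉Y = cong₂ _xor_ (Z⊆X z z∈) z∈
              X≗ : img X ≗ img Z Δ img Y
              X≗ y = trans (cong (T′ y ∧_) (split (X (g y)) (Z (g y)))) (image-Δ T′ g Z Y y)
              rest = go fuel Y (λ v h → X⊆T v (Δ⊆ Z⊆X v h)) (trans (sumS-Δ X Z) (trans (cong₂ _⊕_ e sZ) (⊕-self 𝟘)))
                (<-≤-trans (card-mono (Δ⊆ Z⊆X) (Z⊆X z z∈) z∉Y) (≤-pred lt))
              part = go fuel Z (λ v h → X⊆T v (Z⊆X v h)) sZ (<-≤-trans (card-mono Z⊆X x∈ x∉) (≤-pred lt))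
            in ne (trans (sumS-cong X≗) (trans (sumS-Δ (img Z) (img Y)) (trans (cong₂ _⊕_ part rest) (⊕-self 𝟘))))
          -- Now X is a circuit. A dependent part of its image, pulled back, is a dependent part of
          -- X and hence all of X.
          (no circuit) → dependent-subset (λ ind → Equivalence.from (indep X X⊆T) ind X (λ _ h → h) X≠∅ e)
            λ (Z′ , Z′⊆ , (z , z∈) , sZ′) →
              let
                Z = image T f Z′
                Z′⊆T′ : ∀ y → y ∈ Z′ → y ∈ T′
                Z′⊆T′ y h = proj₁ (∧-true (Z′⊆ y h))
                Z⊆X : Z ⊆ X
                Z⊆X x h = let x∈T , fx∈ = ∧-true h in subst (_∈ X) (gf x x∈T) (proj₂ (∧-true (Z′⊆ (f x) fx∈)))
                back : img Z ≗ Z′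
                back y = bool-ext
                  (λ h → let y∈ , gy∈ = ∧-true h in subst (_∈ Z′) (fg y y∈) (proj₂ (∧-true gy∈)))
                  (λ h → let y∈ = Z′⊆T′ y h in ∧-true⁺ y∈ (∧-true⁺ (g∈ y y∈) (subst (_∈ Z′) (sym (fg y y∈)) h)))
              in em {P = ∃ λ x → x ∈ X × x ∉ Z} λ where
                (no X⊆Z) → ne (trans (sumS-cong λ y → bool-ext
                  (λ h → let y∈ , gy∈ = ∧-true h in trans (sym (back y)) (∧-true⁺ y∈ (≢false⇒≡true λ gy∉ → X⊆Z (g y , gy∈ , gy∉))))
                  (Z′⊆ y)) sZ′)
                (yes missing) → dependent-subset {X = Z}
                  (λ ind → Indep-cong back (Equivalence.to (indep Z λ x h → proj₁ (∧-true h)) ind) Z′ (λ _ h → h) (z , z∈) sZ′)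
                  λ (Y , Y⊆Z , Y≠∅ , sY) → circuit (Y , (λ x h → Z⊆X x (Y⊆Z x h)) , Y≠∅ ,
                    (let x , x∈ , x∉ = missing in x , x∈ , ≢true⇒≡false (λ h → contradict x∉ (Y⊆Z x h))) , sY)
      where
      split : ∀ p q → p ≡ q xor (p xor q)
      split true true = refl
      split true false = refl
      split false true = refl
      split false false = refl

isZero⇒≡ : (x : Pt n) → isZero x ≡ true → x ≡ 𝟘
isZero⇒≡ [] e = refl
isZero⇒≡ (false ∷ x) e = cong (false ∷_) (isZero⇒≡ x e)

isZero-𝟘 : isZero (𝟘 {n}) ≡ true
isZero-𝟘 {zero}  = refl
isZero-𝟘 {suc n} = isZero-𝟘 {n}

compl∈ : {T : PSet n} {x : Pt n} → x ≢ 𝟘 → x ∉ T → x ∈ compl n T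
compl∈ {T = T} {x} x≢𝟘 x∉ rewrite x∉ with isZero x in e
... | true  = ⊥-elim (x≢𝟘 (isZero⇒≡ x e))
... | false = refl

compl∈⁻ : {T : PSet n} {x : Pt n} → x ∈ compl n T → x ≢ 𝟘 × x ∉ T
compl∈⁻ {n} {T} {x} h = (λ { refl → contradict (not-true (proj₁ (∧-true h))) (isZero-𝟘 {n}) }) ,
  not-true (proj₂ (∧-true {not (isZero x)} h))

-- The linear correspondence between the spans of T and T′ extending a matroid isomorphism.

module _ {T : PSet a} {T′ : PSet b} (I : T ≅ T′) where
  open _≅_ I

  Graph : Pt a → Pt b → Set
  Graph u v = ∃ λ X → X ⊆ T × sumS X ≡ u × sumS (image T′ g X) ≡ v

  graph-𝟘 : Graph 𝟘 𝟘
  graph-𝟘 = ∅ , (λ _ ()) , sumS-∅ , trans (sumS-cong {S′ = ∅} λ y → ∧-zeroʳ (T′ y)) sumS-∅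

  graph-⊕ : ∀ {u v u′ v′} → Graph u v → Graph u′ v′ → Graph (u ⊕ u′) (v ⊕ v′)
  graph-⊕ (X , X⊆T , refl , refl) (Y , Y⊆T , refl , refl) = X Δ Y , sub , sumS-Δ X Y ,
    trans (sumS-cong (image-Δ T′ g X Y)) (sumS-Δ (image T′ g X) (image T′ g Y))
    where
    sub : (X Δ Y) ⊆ T
    sub x h with X x in e | Y x in e′
    ... | true | _ = X⊆T x e
    ... | false | true = Y⊆T x e′

  graph-∈ : ∀ {x} → x ∈ T → Graph x (f x)
  graph-∈ {x} x∈ = single x , (λ y h → subst (_∈ T) (sym (single⇒≡ h)) x∈) , sumS-single x ,
    trans (sumS-cong λ y → bool-ext
      (λ h → let y∈ , gy≡x = ∧-true h in
        subst (λ z → single z y ≡ true) (trans (sym (fg y y∈)) (cong f (single⇒≡ gy≡x))) (single-refl y))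
      (λ h → subst (λ z → T′ z ∧ single x (g z) ≡ true) (sym (single⇒≡ h))
        (∧-true⁺ (f∈ x x∈) (subst (λ z → single x z ≡ true) (sym (gf x x∈)) (single-refl x)))))
      (sumS-single (f x))

  graph-∈′ : ∀ {y} → y ∈ T′ → Graph (g y) y
  graph-∈′ {y} y∈ = subst (Graph (g y)) (fg y y∈) (graph-∈ (g∈ y y∈))

  graph-zeroˡ : ∀ {v} → Graph 𝟘 v → v ≡ 𝟘
  graph-zeroˡ (X , X⊆T , e , refl) = iso-sum I X X⊆T e

  graph-zeroʳ : ∀ {u} → Graph u 𝟘 → u ≡ 𝟘
  graph-zeroʳ (X , X⊆T , refl , e) = trans (sumS-cong back) (iso-sum (≅-sym I) (image T′ g X) (λ y h → proj₁ (∧-true h)) e)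
    where
    back : X ≗ image T f (image T′ g X)
    back x = bool-ext
      (λ h → let x∈ = X⊆T x h in ∧-true⁺ x∈ (∧-true⁺ (f∈ x x∈) (subst (_∈ X) (sym (gf x x∈)) h)))
      (λ h → let x∈ , h′ = ∧-true h in subst (_∈ X) (gf x x∈) (proj₂ (∧-true {T′ (f x)} h′)))

  graph-injective : ∀ {u u′ v} → Graph u v → Graph u′ v → u ≡ u′
  graph-injective {u} {u′} {v} p q = ⊕≡𝟘⇒≡ u u′ (graph-zeroʳ (subst (Graph _) (⊕-self v) (graph-⊕ p q)))

  graph-functional : ∀ {u v v′} → Graph u v → Graph u v′ → v ≡ v′
  graph-functional {u} {v} {v′} p q = ⊕≡𝟘⇒≡ v v′ (graph-zeroˡ (subst (λ z → Graph z _) (⊕-self u) (graph-⊕ p q)))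

-- The invariant carried through the construction of comatroids

Hereditary : PSet n → Set₁
Hereditary {n} T = (W : Sub n) → (∃ λ w → mem W w × w ≢ 𝟘) → ¬ ¬ (Sep (_∈ T) W ⊎ Sep (_∈ compl n T) W)

-- The ambient spaces differ. If W′ is not contained in the span of T′, this span and 0 separate it;
-- otherwise W′ corresponds to a subspace in the span of T, and the separation is transported back.
hereditary-≅ : {T : PSet a} {T′ : PSet b} → T ≅ T′ → Hereditary T → Hereditary T′
hereditary-≅ {a} {b} {T} {T′} I her W′ (w , w∈ , w≢𝟘) ret =
  dns (λ v → em {P = ∃ λ u → Graph I u v}) λ dec → em {P = ∃ λ v → mem W′ v × ¬ ∃ λ u → Graph I u v} λ where
    (yes (v , v∈ , v∉)) → ret (inj₁ record
      { A = range ; B = nil ; disjoint = λ _ _ z → z ; A-proper = v , v∈ , v∉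
      ; B-proper = w , w∈ , w≢𝟘 ; cover = λ _ y∈ → inj₁ (_ , graph-∈′ I y∈) })
    (no spanned) →
      let all : ∀ {v} → mem W′ v → ∃ λ u → Graph I u v
          all {v} v∈ = decidable-stable (dec v) λ v∉ → spanned (v , v∈ , v∉)
          u , uw = all w∈
      in her W (u , (w , w∈ , uw) , λ e → w≢𝟘 (graph-zeroˡ I (subst (λ z → Graph I z w) e uw))) λ s → ret (Sum.map
          (transport all λ {v} {u} uv v∈ → subst (_∈ T) (graph-injective I (graph-∈′ I v∈) uv) (g∈ v v∈))
          (transport all λ {v} {u} uv v∈ → let v≢𝟘 , v∉ = compl∈⁻ {T = T′} v∈ in
            compl∈ {T = T} (λ { refl → v≢𝟘 (graph-zeroˡ I uv) })
              (≢true⇒≡false (λ u∈ → contradict v∉ (subst (_∈ T′) (graph-functional I (graph-∈ I u∈) uv) (f∈ u u∈)))))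
          s)
  where
  open _≅_ I
  range : Sub b
  range = record { mem = λ v → ∃ λ u → Graph I u v ; 𝟘∈ = 𝟘 , graph-𝟘 I
                 ; ⊕∈ = λ (u , p) (u′ , p′) → u ⊕ u′ , graph-⊕ I p p′ }
  W : Sub a
  W = record { mem = λ u → ∃ λ v → mem W′ v × Graph I u v ; 𝟘∈ = 𝟘 , 𝟘∈ W′ , graph-𝟘 I
             ; ⊕∈ = λ (v , v∈ , p) (v′ , v′∈ , p′) → v ⊕ v′ , ⊕∈ W′ v∈ v′∈ , graph-⊕ I p p′ }
  push : Sub a → Sub b
  push A = record { mem = λ v → ∃ λ u → mem A u × Graph I u v ; 𝟘∈ = 𝟘 , 𝟘∈ A , graph-𝟘 I
                  ; ⊕∈ = λ (u , u∈ , p) (u′ , u′∈ , p′) → u ⊕ u′ , ⊕∈ A u∈ u′∈ , graph-⊕ I p p′ }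
  transport : {G : Pt a → Set} {G′ : Pt b → Set} → (∀ {v} → mem W′ v → ∃ λ u → Graph I u v) →
    (∀ {v u} → Graph I u v → G′ v → G u) → Sep G W → Sep G′ W′
  transport all G⇒ s = record
    { A = push A ; B = push B
    ; disjoint = λ v∈ (u , uA , p) (u′ , uB , p′) →
        let u≡ = graph-injective I p p′
            u≡𝟘 = disjoint (_ , v∈ , p) uA (subst (mem B) (sym u≡) uB)
        in graph-zeroˡ I (subst (λ z → Graph I z _) u≡𝟘 p)
    ; A-proper = proper A A-proper ; B-proper = proper B B-proper
    ; cover = λ v∈ gv → let u , p = all v∈ in
        Sum.map (λ h → u , h , p) (λ h → u , h , p) (cover (_ , v∈ , p) (G⇒ p gv)) }
    where
    open Sep s
    proper : ∀ A → (∃ λ u → mem W u × ¬ mem A u) → ∃ λ v → mem W′ v × ¬ mem (push A) v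
    proper A (u , (v , v∈ , p) , u∉) = v , v∈ , λ (u′ , u′∈ , p′) → u∉ (subst (mem A) (graph-injective I p′ p) u′∈)

image-Sub : {p : Pt a → Pt b} → Linear p → Sub a → Sub b
image-Sub {p = p} p-lin W = record
  { mem = λ u → ∃ λ v → mem W v × p v ≡ u ; 𝟘∈ = 𝟘 , 𝟘∈ W , linear-𝟘 p-lin
  ; ⊕∈ = λ { (v , v∈ , refl) (v′ , v′∈ , refl) → v ⊕ v′ , ⊕∈ W v∈ v′∈ , p-lin v v′ } }

preimage-Sub : {p : Pt a → Pt b} → Linear p → Sub b → Sub a
preimage-Sub {p = p} p-lin A = record
  { mem = λ v → mem A (p v) ; 𝟘∈ = subst (mem A) (sym (linear-𝟘 p-lin)) (𝟘∈ A)
  ; ⊕∈ = λ {v} {v′} h h′ → subst (mem A) (sym (p-lin v v′)) (⊕∈ A h h′) }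

Sep-preimage : {G : Pt a → Set} {G′ : Pt b → Set} {W : Sub a} {p : Pt a → Pt b} (p-lin : Linear p) →
  (∀ {v} → mem W v → p v ≡ 𝟘 → v ≡ 𝟘) → (∀ {v} → mem W v → v ≢ 𝟘 → G v → G′ (p v)) →
  Sep G′ (image-Sub p-lin W) → Sep G W
Sep-preimage {W = W} {p} p-lin inj G⇒ s = record
  { A = preimage-Sub p-lin A ; B = preimage-Sub p-lin B
  ; disjoint = λ v∈ a b → inj v∈ (disjoint (_ , v∈ , refl) a b)
  ; A-proper = proper A A-proper ; B-proper = proper B B-proper
  ; cover = λ {v} v∈ gv → side v∈ gv (v ≟ₚ 𝟘) }
  where
  open Sep s
  proper : ∀ A → (∃ λ u → mem (image-Sub p-lin W) u × ¬ mem A u) → ∃ λ v → mem W v × ¬ mem A (p v)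
  proper A (_ , (v , v∈ , refl) , u∉) = v , v∈ , u∉
  side : ∀ {v} → mem W v → _ → Dec (v ≡ 𝟘) → mem A (p v) ⊎ mem B (p v)
  side v∈ gv (yes refl) = inj₁ (𝟘∈ (preimage-Sub p-lin A))
  side v∈ gv (no v≢𝟘)   = cover (_ , v∈ , refl) (G⇒ v∈ v≢𝟘 gv)

take-linear : Linear (take a {b})
take-linear x y = take-zipWith _xor_ x y

drop-linear : Linear (drop a {b})
drop-linear {a = a} x y = drop-zipWith {m = a} _xor_ x y

take-drop-𝟘 : (v : Pt (a + b)) → take a v ≡ 𝟘 → drop a v ≡ 𝟘 → v ≡ 𝟘
take-drop-𝟘 {zero} v _ e = e
take-drop-𝟘 {suc a} (c ∷ v) e e′ = cong₂ _∷_ (cong (λ { (x ∷ _) → x }) e) (take-drop-𝟘 {a} v (cong (λ { (_ ∷ x) → x }) e) e′)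

-- If W projects nontrivially to both summands, the kernels of the two projections separate it.
-- Otherwise one projection embeds W into a single summand.
hereditary-⊕ : {T₁ : PSet a} {T₂ : PSet b} → Hereditary T₁ → Hereditary T₂ → Hereditary (T₁ ⊕ₘ T₂)
hereditary-⊕ {a} {b} {T₁} {T₂} her₁ her₂ W (w , w∈ , w≢𝟘) ret =
  em {P = ∃ λ v → mem W v × drop a v ≢ 𝟘} λ where
    (no ¬drop) →
      let drop≡𝟘 : ∀ {v} → mem W v → drop a v ≡ 𝟘
          drop≡𝟘 {v} v∈ = decidable-stable (drop a v ≟ₚ 𝟘) λ ne → ¬drop (v , v∈ , ne)
          inj : ∀ {v} → mem W v → take a v ≡ 𝟘 → v ≡ 𝟘
          inj {v} v∈ e = take-drop-𝟘 {a} v e (drop≡𝟘 v∈)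
      in her₁ (image-Sub take-linear W) (take a w , (w , w∈ , refl) , w≢𝟘 ∘ inj w∈) λ s → ret (Sum.map
        (Sep-preimage take-linear inj λ {v} v∈ v≢𝟘 h →
          [ (λ h → proj₁ (∧-true h))
          , (λ h → ⊥-elim (v≢𝟘 (inj v∈ (isZero⇒≡ (take a v) (proj₁ (∧-true h)))))) ]′ (∨-true h))
        (Sep-preimage take-linear inj λ {v} v∈ v≢𝟘 h → compl∈ {T = T₁} (v≢𝟘 ∘ inj v∈)
          (≢true⇒≡false (λ h′ → contradict (proj₂ (compl∈⁻ {T = T₁ ⊕ₘ T₂} h)) (left v h′ (drop≡𝟘 v∈)))))
        s)
    (yes pd) → em {P = ∃ λ v → mem W v × take a v ≢ 𝟘} λ where
      (yes pt) → ret (inj₁ record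
        { A = preimage-Sub (drop-linear {a}) nil ; B = preimage-Sub (take-linear {a} {b}) nil
        ; disjoint = λ {v} _ e e′ → take-drop-𝟘 {a} v e′ e
        ; A-proper = pd ; B-proper = pt
        ; cover = λ {v} _ h → Sum.map (λ h → isZero⇒≡ (drop a v) (proj₂ (∧-true {T₁ (take a v)} h)))
            (λ h → isZero⇒≡ (take a v) (proj₁ (∧-true h))) (∨-true h) })
      (no ¬take) →
        let take≡𝟘 : ∀ {v} → mem W v → take a v ≡ 𝟘
            take≡𝟘 {v} v∈ = decidable-stable (take a v ≟ₚ 𝟘) λ ne → ¬take (v , v∈ , ne)
            inj : ∀ {v} → mem W v → drop a v ≡ 𝟘 → v ≡ 𝟘
            inj {v} v∈ e = take-drop-𝟘 {a} v (take≡𝟘 v∈) e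
        in her₂ (image-Sub (drop-linear {a}) W) (drop a w , (w , w∈ , refl) , w≢𝟘 ∘ inj w∈) λ s → ret (Sum.map
          (Sep-preimage (drop-linear {a}) inj λ {v} v∈ v≢𝟘 h →
            [ (λ h → ⊥-elim (v≢𝟘 (inj v∈ (isZero⇒≡ (drop a v) (proj₂ (∧-true {T₁ (take a v)} h))))))
            , (λ h → proj₂ (∧-true {isZero (take a v)} h)) ]′ (∨-true h))
          (Sep-preimage (drop-linear {a}) inj λ {v} v∈ v≢𝟘 h → compl∈ {T = T₂} (v≢𝟘 ∘ inj v∈)
            (≢true⇒≡false (λ h′ → contradict (proj₂ (compl∈⁻ {T = T₁ ⊕ₘ T₂} h)) (right v (take≡𝟘 v∈) h′))))
          s)
  where
  left : ∀ v → take a v ∈ T₁ → drop a v ≡ 𝟘 → v ∈ (T₁ ⊕ₘ T₂)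
  left v h e rewrite h | e | isZero-𝟘 {b} = refl
  right : ∀ v → take a v ≡ 𝟘 → drop a v ∈ T₂ → v ∈ (T₁ ⊕ₘ T₂)
  right v e h rewrite e | h | isZero-𝟘 {a} with T₁ 𝟘 ∧ isZero (drop a v)
  ... | true  = refl
  ... | false = refl

hereditary-compl : {T : PSet n} → Hereditary T → Hereditary (compl n T)
hereditary-compl {n} {T} her W p ret = her W p λ where
    (inj₁ s) → ret (inj₂ (Sep-cong (λ {x} _ h → double-compl x h) id id s))
    (inj₂ s) → ret (inj₁ s)
  where
  double-compl : ∀ x → x ∈ compl n (compl n T) → x ∈ T
  double-compl x h with compl∈⁻ {T = compl n T} {x} h | T x in e
  ... | _ , _ | true = refl
  ... | x≢𝟘 , x∉ | false = contradict x∉ (compl∈ {T = T} x≢𝟘 e)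

comat⇒hereditary : {T : PSet n} → Comat T → Hereditary T
comat⇒hereditary (empty none) W (w , w∈ , w≢𝟘) ret = ret (inj₁ record
  { A = nil ; B = nil ; disjoint = λ _ e _ → e ; A-proper = w , w∈ , w≢𝟘 ; B-proper = w , w∈ , w≢𝟘
  ; cover = λ {x} _ h → contradict (none x) h })
comat⇒hereditary (dsum c₁ c₂ I) = hereditary-≅ (≅-sym I) (hereditary-⊕ (comat⇒hereditary c₁) (comat⇒hereditary c₂))
comat⇒hereditary (cmpl c _ N≅S T≅) = hereditary-≅ (≅-sym T≅) (hereditary-compl (hereditary-≅ N≅S (comat⇒hereditary c)))

search : {P : Pt n → Set} → (∀ v → Dec (P v)) → Dec (∃ P)
search {zero} P? with P? []
... | yes p = yes ([] , p)
... | no ¬p = no λ { ([] , p) → ¬p p }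
search {suc n} P? with search (λ v → P? (true ∷ v)) | search (λ v → P? (false ∷ v))
... | yes (v , p) | _           = yes (true ∷ v , p)
... | no _        | yes (v , p) = yes (false ∷ v , p)
... | no ¬t       | no ¬f       = no λ { (true ∷ v , p) → ¬t (v , p) ; (false ∷ v , p) → ¬f (v , p) }

does⇒ : {P : Set} {d : Dec P} → does d ≡ true → P
does⇒ {d = yes p} _ = p

-- Enumerations of point sets

count≡0⇒All≢ : (x : Pt n) (L : List (Pt n)) → length (filt (single x) L) ≡ 0 → LA.All (x ≢_) L
count≡0⇒All≢ x [] e = []
count≡0⇒All≢ x (y ∷ L) e with y ≟ₚ x
... | no y≢x = y≢x ∘ sym ∷ count≡0⇒All≢ x L e

multiplicity≤1⇒unique : (L : List (Pt n)) → (∀ x → length (filt (single x) L) ≤ 1) → Unique L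
multiplicity≤1⇒unique [] h = []
multiplicity≤1⇒unique (x ∷ L) h =
  count≡0⇒All≢ x L (n≤0⇒n≡0 (≤-pred (subst (_≤ 1) (trans (length-filt-∷ (single x) x L)
    (cong (λ c → bit c + length (filt (single x) L)) (single-refl x))) (h x)))) ∷
  multiplicity≤1⇒unique L λ y → ≤-trans (m≤n+m _ (bit (single y x))) (subst (_≤ 1) (length-filt-∷ (single y) x L) (h y))

filt-All : {P : Pt n → Set} (S : PSet n) {L : List (Pt n)} → LA.All P L → LA.All P (filt S L)
filt-All S [] = []
filt-All S {x ∷ _} (p ∷ ps) with S x
... | true  = p ∷ filt-All S ps
... | false = filt-All S ps

filt-unique : (S : PSet n) {L : List (Pt n)} → Unique L → Unique (filt S L)
filt-unique S [] = []
filt-unique S {x ∷ _} (x∉ ∷ u) with S x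
... | true  = filt-All S x∉ ∷ filt-unique S u
... | false = filt-unique S u

elems-unique : (S : PSet n) → Unique (elems S)
elems-unique S = filt-unique S (multiplicity≤1⇒unique (allPts _) λ x → ≤-reflexive (card-single x))

elems∈ : (S : PSet n) (L : List (Pt n)) → LA.All (_∈ S) (filt S L)
elems∈ S [] = []
elems∈ S (x ∷ L) with S x in e
... | true  = e ∷ elems∈ S L
... | false = elems∈ S L

subfamily : (L : List (Pt n)) → Vec Bool (length L) → PSet n
subfamily [] [] = ∅
subfamily (x ∷ L) (true ∷ c)  = single x Δ subfamily L c
subfamily (x ∷ L) (false ∷ c) = subfamily L c

sum-subfamily : (L : List (Pt n)) (c : Vec Bool (length L)) → sumS (subfamily L c) ≡ lin c (fromList L)
sum-subfamily [] [] = sumS-∅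
sum-subfamily (x ∷ L) (true ∷ c) = trans (sumS-Δ (single x) (subfamily L c)) (cong₂ _⊕_ (sumS-single x) (sum-subfamily L c))
sum-subfamily (x ∷ L) (false ∷ c) = trans (sum-subfamily L c) (sym (⊕-idˡ _))

Δ-∈ : {X Y : PSet n} {x : Pt n} → x ∈ (X Δ Y) → x ∈ X ⊎ x ∈ Y
Δ-∈ {X = X} {Y} {x} h with X x | Y x
... | true  | _    = inj₁ refl
... | false | true = inj₂ refl

subfamily-⊆ : {P : Pt n → Set} (L : List (Pt n)) (c : Vec Bool (length L)) → LA.All P L → ∀ {x} → x ∈ subfamily L c → P x
subfamily-⊆ [] [] [] ()
subfamily-⊆ {P = P} (y ∷ L) (true ∷ c) (p ∷ ps) {x} h with Δ-∈ {X = single y} {subfamily L c} {x} h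
... | inj₁ e  = subst P (sym (single⇒≡ e)) p
... | inj₂ h′ = subfamily-⊆ L c ps h′
subfamily-⊆ (y ∷ L) (false ∷ c) (p ∷ ps) h = subfamily-⊆ L c ps h

subfamily-nonempty : (L : List (Pt n)) (c : Vec Bool (length L)) → Unique L → c ≢ 𝟘 → ∃ λ x → x ∈ subfamily L c
subfamily-nonempty [] [] _ ne = ⊥-elim (ne refl)
subfamily-nonempty (x ∷ L) (true ∷ c) (x∉ ∷ _) _ = x , cong₂ _xor_ (single-refl x)
  (≢true⇒≡false (λ h → ⊥-elim (subfamily-⊆ L c x∉ h refl)))
subfamily-nonempty (x ∷ L) (false ∷ c) (_ ∷ u) ne = subfamily-nonempty L c u λ e → ne (cong (false ∷_) e)

Indep⇒Ind : {Y : PSet n} → Indep Y → Ind (fromList (elems Y))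
Indep⇒Ind {Y = Y} ind c e = decidable-stable (c ≟ₚ 𝟘) λ ne →
  ind (subfamily (elems Y) c) (λ x → subfamily-⊆ (elems Y) c (elems∈ Y (allPts _)))
    (subfamily-nonempty (elems Y) c (elems-unique Y) ne) (trans (sum-subfamily (elems Y) c) e)

sum-of-subset : {Y : PSet n} (Z : PSet n) → Z ⊆ Y → ∀ L → ∃ λ c → lin c (fromList (filt Y L)) ≡ sumL Z L
sum-of-subset Z Z⊆Y [] = [] , refl
sum-of-subset {Y = Y} Z Z⊆Y (x ∷ L) with sum-of-subset Z Z⊆Y L | Y x in e
... | c , eq | true  = Z x ∷ c , trans (cong (Z x · x ⊕_) eq) (sym (sumL-∷ Z x L))
... | c , eq | false = c , trans eq (sym (trans (sumL-∷ Z x L)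
      (trans (cong (λ b → b · x ⊕ sumL Z L) (≢true⇒≡false (λ h → contradict e (Z⊆Y x h)))) (⊕-idˡ _))))

indep-∪ : (W : Sub n) {Y : PSet n} {e : Pt n} → (∀ x → x ∈ Y → mem W x) → ¬ mem W e → Indep Y → Indep (Y ∪｛ e ｝)
indep-∪ W {Y} {e} Y⊆W e∉ ind Z Z⊆ ne sZ = go (Z e) refl
  where
  go : ∀ c → Z e ≡ c → ⊥
  go false Ze = ind Z (λ x h → [ id , (λ x≡e → contradict Ze (subst (_∈ Z) (single⇒≡ {x = x} {e} x≡e) h)) ]′ (∨-true (Z⊆ x h))) ne sZ
  go true Ze = e∉ (subst (mem W) (trans (sumS-Δ Z (single e)) (trans (cong₂ _⊕_ sZ (sumS-single e)) (⊕-idˡ e)))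
      (sumS∈ W {S = Z Δ single e} λ x h → Y⊆W x (member x h (Z x) refl (x == e) refl)))
    where
    member : ∀ x → Z x xor (x == e) ≡ true → ∀ p → Z x ≡ p → ∀ q → (x == e) ≡ q → x ∈ Y
    member x h true p true q = contradict (cong₂ _xor_ p q) h
    member x h true p false q = [ id , contradict q ]′ (∨-true (Z⊆ x p))
    member x h false p true q = contradict p (subst (_∈ Z) (sym (single⇒≡ {x = x} {e} q)) Ze)
    member x h false p false q = contradict (cong₂ _xor_ p q) h

-- Ranks, flats and direct sums in terms of subspaces

spanning-basis : {T : PSet n} {r : ℕ} → Rank T r →
  ∃ λ (bs : Vec (Pt n) r) → Ind bs × All (_∈ T) bs × (∀ x → x ∈ T → ∃ λ c → lin c bs ≡ x)
spanning-basis {n} {T} ((Y , Y⊆T , indY , refl) , maximal) =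
  bs , Indep⇒Ind indY , from-list (LA.map (Y⊆T _) (elems∈ Y (allPts n))) , spans
  where
  bs = fromList (elems Y)
  from-list : {P : Pt n → Set} {L : List (Pt n)} → LA.All P L → All P (fromList L)
  from-list [] = []
  from-list (p ∷ ps) = p ∷ from-list ps
  Y⊆span : ∀ x → x ∈ Y → mem (span bs) x
  Y⊆span x x∈ with sum-of-subset (single x) (λ y h → subst (_∈ Y) (sym (single⇒≡ h)) x∈) (allPts n)
  ... | c , e = c , trans e (sumS-single x)
  spans : ∀ x → x ∈ T → ∃ λ c → lin c bs ≡ x
  spans x x∈ with search (λ c → lin c bs ≟ₚ x)
  ... | yes h = h
  ... | no x∉ = ⊥-elim (n≮n (card Y) (subst (_≤ card Y)
          (card-∪ Y x (≢true⇒≡false (λ h → ⊥-elim (x∉ (Y⊆span x h)))))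
          (maximal (Y ∪｛ x ｝) (λ y h → [ Y⊆T y , (λ e → subst (_∈ T) (sym (single⇒≡ e)) x∈) ]′ (∨-true h))
            (indep-∪ (span bs) Y⊆span x∉ indY))))

_∩ᵈ_ : PSet n → {P : Pt n → Set} → (∀ x → Dec (P x)) → PSet n
(T ∩ᵈ P?) x = T x ∧ does (P? x)

∩ᵈ-∈ : {T : PSet n} {P : Pt n → Set} (P? : ∀ x → Dec (P x)) {x : Pt n} → x ∈ T → P x → x ∈ (T ∩ᵈ P?)
∩ᵈ-∈ P? {x} x∈ p = ∧-true⁺ x∈ (dec-true (P? x) p)

∩ᵈ-∈⁻ : {T : PSet n} {P : Pt n → Set} (P? : ∀ x → Dec (P x)) {x : Pt n} → x ∈ (T ∩ᵈ P?) → x ∈ T × P x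
∩ᵈ-∈⁻ P? {x} h = let x∈ , p = ∧-true h in x∈ , does⇒ {d = P? x} p

-- A point of T outside W extends every independent set inside W, so adding it raises the rank.
section-flat : {T : PSet n} (W : Sub n) (W? : ∀ x → Dec (mem W x)) → Flat T (T ∩ᵈ W?)
section-flat {T = T} W W? = (λ x h → proj₁ (∧-true h)) , λ where
    e e∈ e∉ n m ((Y , Y⊆F , indY , refl) , _) (_ , maximal) →
      subst (_≤ m) (card-∪ Y e (≢true⇒≡false (λ h → contradict e∉ (Y⊆F e h))))
        (maximal (Y ∪｛ e ｝) (λ x h →
          [ (λ h → cong (_∨ (x == e)) (Y⊆F x h))
          , (λ x≡e → trans (cong ((T ∩ᵈ W?) x ∨_) x≡e) (∨-zeroʳ ((T ∩ᵈ W?) x))) ]′ (∨-true h))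
          (indep-∪ W (λ x h → proj₂ (∩ᵈ-∈⁻ {T = T} W? (Y⊆F x h))) (λ h → contradict e∉ (∩ᵈ-∈ {T = T} W? e∈ h)) indY))

take-++ : (x : Pt a) (y : Pt b) → take a (x ++ y) ≡ x
take-++ [] y = refl
take-++ (c ∷ x) y = cong (c ∷_) (take-++ x y)

drop-++ : (x : Pt a) (y : Pt b) → drop a (x ++ y) ≡ y
drop-++ [] y = refl
drop-++ (c ∷ x) y = drop-++ x y

-- The direct sum lives in the doubled space; adding the two halves maps it back and is injective on
-- pairs from A and B because these meet in 0.
direct-sum : {T : PSet n} (A B : Sub n) (A? : ∀ x → Dec (mem A x)) (B? : ∀ x → Dec (mem B x)) →
  (∀ {x} → mem A x → mem B x → x ≡ 𝟘) → (∀ {x} → x ∈ T → mem A x ⊎ mem B x) → T ≅ ((T ∩ᵈ A?) ⊕ₘ (T ∩ᵈ B?))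
direct-sum {n} {T} A B A? B? disj cov = linear-iso
  (λ y → take n y ⊕ drop n y)
  (λ x y → trans (cong₂ _⊕_ (take-linear {n} x y) (drop-linear {n} x y)) (⊕-medial (take n x) (take n y) (drop n x) (drop n y)))
  (preimage-Sub (take-linear {n} {n}) A ∩ preimage-Sub (drop-linear {n}) B)
  (λ y h → [ (λ h → let p , q = ∧-true h in proj₂ (∩ᵈ-∈⁻ {T = T} A? p) , subst (mem B) (sym (isZero⇒≡ (drop n y) q)) (𝟘∈ B))
           , (λ h → let p , q = ∧-true {isZero (take n y)} h in
                subst (mem A) (sym (isZero⇒≡ (take n y) p)) (𝟘∈ A) , proj₂ (∩ᵈ-∈⁻ {T = T} B? q)) ]′ (∨-true h))
  (λ {y} (yA , yB) e → let t≡d = ⊕≡𝟘⇒≡ (take n y) (drop n y) e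
                           d≡𝟘 = disj (subst (mem A) t≡d yA) yB
                       in take-drop-𝟘 {n} y (trans t≡d d≡𝟘) d≡𝟘)
  (λ y h → [ (λ h → let p , q = ∧-true h in
                subst (_∈ T) (sym (trans (cong (take n y ⊕_) (isZero⇒≡ (drop n y) q)) (⊕-idʳ _))) (proj₁ (∧-true p)))
           , (λ h → let p , q = ∧-true {isZero (take n y)} h in
                subst (_∈ T) (sym (trans (cong (_⊕ drop n y) (isZero⇒≡ (take n y) p)) (⊕-idˡ _))) (proj₁ (∧-true q))) ]′ (∨-true h))
  (λ x x∈ → [ (λ xA → x ++ 𝟘 , left x (∩ᵈ-∈ {T = T} A? x∈ xA) ,
                trans (cong₂ _⊕_ (take-++ x (𝟘 {n})) (drop-++ x (𝟘 {n}))) (⊕-idʳ x))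
            , (λ xB → 𝟘 ++ x , right x (∩ᵈ-∈ {T = T} B? x∈ xB) ,
                trans (cong₂ _⊕_ (take-++ (𝟘 {n}) x) (drop-++ (𝟘 {n}) x)) (⊕-idˡ x)) ]′ (cov x∈))
  where
  left : ∀ x → x ∈ (T ∩ᵈ A?) → (x ++ 𝟘) ∈ ((T ∩ᵈ A?) ⊕ₘ (T ∩ᵈ B?))
  left x h rewrite take-++ x (𝟘 {n}) | drop-++ x (𝟘 {n}) | h | isZero-𝟘 {n} = refl
  right : ∀ x → x ∈ (T ∩ᵈ B?) → (𝟘 ++ x) ∈ ((T ∩ᵈ A?) ⊕ₘ (T ∩ᵈ B?))
  right x h rewrite take-++ (𝟘 {n}) x | drop-++ (𝟘 {n}) x | h | isZero-𝟘 {n}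
    with (T 𝟘 ∧ does (A? 𝟘)) ∧ isZero x
  ... | true  = refl
  ... | false = refl

subspace-basis : (W : Sub n) → (∀ x → Dec (mem W x)) →
  ∃ λ d → ∃ λ (ws : Vec (Pt n) d) → Ind ws × All (mem W) ws × (∀ x → mem W x → mem (span ws) x)
subspace-basis {zero} W W? = 0 , [] , (λ { [] _ → refl }) , [] , λ { [] _ → [] , refl }
subspace-basis {suc n} W W? with subspace-basis (restrict W) (λ x → W? (false ∷ x)) | search (λ u → W? (true ∷ u))
... | d , ws , ind , ws∈ , spans | no none = d , map (false ∷_) ws , shift-Ind ind , shift-All W ws∈ , λ where
      (true ∷ x) x∈ → ⊥-elim (none (x , x∈))
      (false ∷ x) x∈ → let c , e = spans x x∈ in c , trans (lin-shift c ws) (cong (false ∷_) e)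
... | d , ws , ind , ws∈ , spans | yes (u , u∈) =
      suc d , (true ∷ u) ∷ map (false ∷_) ws , shift-Ind-∷ u ind , u∈ ∷ shift-All W ws∈ , λ where
        (true ∷ x) x∈ → let c , e = spans (u ⊕ x) (⊕∈ W u∈ x∈) in true ∷ c ,
          trans (cong ((true ∷ u) ⊕_) (trans (lin-shift c ws) (cong (false ∷_) e))) (cong (true ∷_) (⊕-cancel u x))
        (false ∷ x) x∈ → let c , e = spans x x∈ in
          false ∷ c , trans (⊕-idˡ _) (trans (lin-shift c ws) (cong (false ∷_) e))

lin-linear : (vs : Vec (Pt n) m) → Linear (λ c → lin c vs)
lin-linear vs c d = lin-⊕ c d vs

Ind-injective : {vs : Vec (Pt n) m} → Ind vs → ∀ {c d} → lin c vs ≡ lin d vs → c ≡ d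
Ind-injective {vs = vs} ind {c} {d} e = ⊕≡𝟘⇒≡ c d (ind (c ⊕ d)
  (trans (lin-⊕ c d vs) (trans (cong (_⊕ lin d vs) e) (⊕-self (lin d vs)))))

coordinate-iso : {T : PSet n} (vs : Vec (Pt n) m) → Ind vs → (U : PSet m) →
  (∀ c → c ∈ U → lin c vs ∈ T) → (∀ x → x ∈ T → ∃ λ c → c ∈ U × lin c vs ≡ x) → T ≅ U
coordinate-iso vs ind U g∈ lift =
  linear-iso (λ c → lin c vs) (lin-linear vs) full (λ _ _ → tt) (λ {c} _ → ind c) g∈ lift

-- The geometric setting of a minimal non-comatroid

module _ {T : PSet k} (simple : Simple T) (¬comat : ¬ Comat T) (flats : ∀ F → ProperFlat T F → Comat F)
  {r : ℕ} (6≤r : 6 ≤ r) (bs : Vec (Pt k) r) (ind : Ind bs) (bs∈ : All (_∈ T) bs)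
  (spans : ∀ x → x ∈ T → ∃ λ c → lin c bs ≡ x) where

  private
    ι : Pt r → Pt k
    ι c = lin c bs

    S R : PSet r
    S c = T (ι c)
    R = compl r S

    along : Sub r → Sub k
    along = image-Sub (lin-linear bs)

    along? : (W : Sub r) → (∀ c → Dec (mem W c)) → ∀ x → Dec (mem (along W) x)
    along? W W? x = search λ c → W? c ×-dec (ι c ≟ₚ x)

    along⁻ : (W : Sub r) {c : Pt r} → mem (along W) (ι c) → mem W c
    along⁻ W (d , d∈ , e) = subst (mem W) (Ind-injective ind e) d∈

    module _ (W : Sub r) (W? : ∀ c → Dec (mem W c)) where
      F : PSet k
      F = T ∩ᵈ along? W W?

      comat-section : (∃ λ v → ¬ mem W v) → Comat F
      -- The flat is proper because it misses a basis vector, which belongs to T: a proper W cannot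
      -- contain all units.
      comat-section (v , v∉) with FP.any? (λ i → ¬? (W? (unit i)))
      ... | no all = ⊥-elim (v∉ (generated-by-units W v λ i _ → decidable-stable (W? (unit i)) λ h → all (i , h)))
      ... | yes (i , ui∉) = flats F (section-flat (along W) (along? W W?) , lookup bs i , AllP.lookup⁺ bs∈ i ,
          ≢true⇒≡false (λ h → ⊥-elim (ui∉ (along⁻ W (subst (mem (along W)) (sym (lin-unit i bs))
            (proj₂ (∩ᵈ-∈⁻ {T = T} (along? W W?) h)))))))

      F∈ : ∀ {c} → c ∈ S → mem W c → ι c ∈ F
      F∈ {c} c∈S c∈W = ∩ᵈ-∈ {T = T} (along? W W?) c∈S (c , c∈W , refl)

      F∈⁻ : ∀ {x} → x ∈ F → ∃ λ c → mem W c × c ∈ S × ι c ≡ x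
      F∈⁻ h with ∩ᵈ-∈⁻ {T = T} (along? W W?) h
      ... | x∈ , (c , c∈ , refl) = c , c∈ , x∈ , refl

  coordinates : T ≅ S
  coordinates = coordinate-iso bs ind S (λ _ c∈ → c∈) λ x x∈ →
    let c , e = spans x x∈ in c , subst (_∈ T) (sym e) x∈ , e

  S-loopless : Simple S
  S-loopless _ 𝟘∈S refl = simple (ι 𝟘) 𝟘∈S (lin-𝟘 bs)

  R-loopless : Simple R
  R-loopless x x∈ = proj₁ (compl∈⁻ {T = S} x∈)

  S-nonsep : ¬ Sep (_∈ S) full
  S-nonsep s = decide-Sub A λ A? → decide-Sub B λ B? → ¬comat (dsum
      (comat-section A A? (let v , _ , v∉ = A-proper in v , v∉))
      (comat-section B B? (let v , _ , v∉ = B-proper in v , v∉))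
      (direct-sum (along A) (along B) (along? A A?) (along? B B?)
        (λ { (c , cA , refl) dB → trans (cong ι (disjoint tt cA (along⁻ B dB))) (lin-𝟘 bs) })
        λ {x} x∈ → let c , e = spans x x∈ in
          Sum.map (λ h → c , h , e) (λ h → c , h , e) (cover tt (subst (_∈ T) (sym e) x∈))))
    where open Sep s

  -- The part of R in W is the complement of a flat inside W rather than inside the whole space, so
  -- the complement is taken in coordinates with respect to a basis of W.
  R-part : (W : Sub r) (W? : ∀ c → Dec (mem W c)) → (∃ λ v → ¬ mem W v) → Comat (R ∩ᵈ W?)
  R-part W W? proper with subspace-basis W W?
  ... | d , ws , indw , ws∈ , spansW = cmpl (comat-section W W? proper) loopless
      (linear-iso (λ c → lin (lin c ws) bs)
        (λ c d → trans (cong ι (lin-⊕ c d ws)) (lin-⊕ (lin c ws) (lin d ws) bs))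
        full (λ _ _ → tt) (λ {c} _ e → indw c (ind (lin c ws) e))
        (λ c c∈ → F∈ W W? c∈ (lin∈ W c ws∈))
        λ x x∈ → let c , c∈W , c∈S , e = F∈⁻ W W? x∈
                     d , e′ = spansW _ c∈W
                 in d , subst (_∈ S) (sym e′) c∈S , trans (cong ι e′) e)
      (coordinate-iso ws indw (compl d U)
        (λ c h → let c≢𝟘 , c∉ = compl∈⁻ {T = U} h in
          ∩ᵈ-∈ {T = R} W? (compl∈ {T = S} (λ e → c≢𝟘 (indw c e)) c∉) (lin∈ W c ws∈))
        λ x h → let xR , x∈W = ∩ᵈ-∈⁻ {T = R} W? h
                    x≢𝟘 , x∉ = compl∈⁻ {T = S} {x} xR
                    c , e = spansW x x∈W
                in c , compl∈ {T = U} {c} (λ z → x≢𝟘 (trans (sym e) (trans (cong (λ c → lin c ws) z) (lin-𝟘 ws))))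
                     (trans (cong S e) x∉) , e)
    where
    U : PSet d
    U c = S (lin c ws)
    loopless : Simple U
    loopless _ 𝟘∈U refl = S-loopless _ 𝟘∈U (lin-𝟘 ws)

  R-nonsep : ¬ Sep (_∈ R) full
  R-nonsep s = decide-Sub A λ A? → decide-Sub B λ B? →
      let comat-R : Comat R
          comat-R = dsum
            (R-part A A? (let v , _ , v∉ = A-proper in v , v∉))
            (R-part B B? (let v , _ , v∉ = B-proper in v , v∉))
            (direct-sum A B A? B? (disjoint tt) (cover tt))
      in ¬comat (cmpl comat-R R-loopless
          (linear-iso id (λ _ _ → refl) full (λ _ _ → tt) (λ _ e → e) (λ _ h → h) (λ x h → x , h , refl))
          (coordinate-iso bs ind (compl r R)
            (λ c h → let c≢𝟘 , c∉R = compl∈⁻ {T = R} {c} h in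
              ≢false⇒≡true λ c∉S → contradict c∉R (compl∈ {T = S} {c} c≢𝟘 c∉S))
            λ x x∈ → let c , e = spans x x∈
                         c∈S = subst (_∈ T) (sym e) x∈
                     in c , compl∈ {T = R} (S-loopless c c∈S)
                          (≢true⇒≡false (λ h → contradict (proj₂ (compl∈⁻ {T = S} {c} h)) c∈S)) , e))
    where
    open Sep s

  section-types : (W : Sub r) → (∃ λ w → mem W w × w ≢ 𝟘) → (∃ λ v → ¬ mem W v) → ¬ ¬ (Sep (_∈ S) W ⊎ Sep (_∈ R) W)
  section-types W nonzero proper ret = decide-Sub W λ W? →
    let
      SW = S ∩ᵈ W?
      F≅SW : F W W? ≅ SW
      F≅SW = coordinate-iso bs ind SW
        (λ c h → let c∈S , c∈W = ∩ᵈ-∈⁻ {T = S} W? h in F∈ W W? c∈S c∈W)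
        λ x h → let c , c∈W , c∈S , e = F∈⁻ W W? h in c , ∩ᵈ-∈ {T = S} W? c∈S c∈W , e
    in hereditary-≅ F≅SW (comat⇒hereditary (comat-section W W? proper)) W nonzero λ s → ret (Sum.map
      (Sep-cong (λ x∈W x∈S → ∩ᵈ-∈ {T = S} W? x∈S x∈W) id id)
      -- R is contained in the complement of the section of S, so a separation of the latter serves
      -- R.
      (Sep-cong (λ {x} x∈W x∈R → let x≢𝟘 , x∉S = compl∈⁻ {T = S} x∈R in
        compl∈ {T = SW} x≢𝟘 (≢true⇒≡false (λ h → contradict x∉S (proj₁ (∩ᵈ-∈⁻ {T = S} W? h))))) id id)
      s)

  setting : Setting r (_∈ S) (_∈ R)
  setting = record
    { 6≤n = 6≤r ; total = λ x x≢𝟘 → total x x≢𝟘 (S x) refl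
    ; G-nonsep = S-nonsep ; R-nonsep = R-nonsep ; types = section-types }
    where
    total : ∀ x → x ≢ 𝟘 → ∀ c → S x ≡ c → x ∈ S ⊎ x ∈ R
    total x x≢𝟘 true  e = inj₁ e
    total x x≢𝟘 false e = inj₂ (compl∈ {T = S} x≢𝟘 e)

-- Circuits

circuit-≅ : {T : PSet a} {T′ : PSet b} → T ≅ T′ → IsCircuit T′ → IsCircuit T
circuit-≅ {T = T} {T′} I (dep , proper) =
  (λ ind → dep (Indep-cong (λ y → bool-ext (λ h → proj₁ (∧-true h)) (λ h → ∧-true⁺ h (g∈ y h)))
    (Equivalence.to (indep T λ _ h → h) ind))) ,
  λ X X⊆T (e , e∈ , e∉) → Equivalence.from (indep X X⊆T) (proper (image T′ g X) (λ y h → proj₁ (∧-true h))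
    (f e , f∈ e e∈ , ≢true⇒≡false (λ h → contradict e∉ (subst (_∈ X) (gf e e∈) (proj₂ (∧-true {T′ (f e)} h))))))
  where open _≅_ I

circuit-stable : {T : PSet n} → ¬ ¬ IsCircuit T → IsCircuit T
circuit-stable nn = (λ ind → nn λ (dep , _) → dep ind) ,
  λ X X⊆T p Z Z⊆X ne e → nn λ (_ , proper) → proper X X⊆T p Z Z⊆X ne e

Δ-single-∈ : (Z : PSet n) (x : Pt n) → x ∈ Z → ∀ y → y ∈ (Z Δ single x) → y ∈ Z × y ≢ x
Δ-single-∈ Z x x∈ y h = inZ (Z y) refl , λ { refl → contradict (cong₂ _xor_ x∈ (single-refl x)) h }
  where
  inZ : ∀ c → Z y ≡ c → y ∈ Z
  inZ true  e = e
  inZ false e = contradict e (subst (_∈ Z) (sym (single⇒≡ {x = y} {x} (trans (sym (cong (_xor single x y) e)) h))) x∈)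

coordinate-of-sum : {Z : PSet n} {x : Pt n} (i : Fin n) → x ∈ Z → (∀ y → y ∈ Z → y ≢ x → lookup y i ≡ false) →
  lookup (sumS Z) i ≡ lookup x i
coordinate-of-sum {Z = Z} {x} i x∈ h = begin
  lookup (sumS Z) i                                ≡⟨ cong (λ v → lookup v i) (solve (sumS Z ∷ x ∷ []) v₀ (v₀ :+ v₁ :+ v₁) refl) ⟩
  lookup (sumS Z ⊕ x ⊕ x) i                        ≡⟨ lookup-zipWith _xor_ i (sumS Z ⊕ x) x ⟩
  lookup (sumS Z ⊕ x) i xor lookup x i             ≡⟨ cong (_xor lookup x i) rest ⟩
  lookup x i                                       ∎
  where
  open ≡-Reasoning
  rest : lookup (sumS Z ⊕ x) i ≡ false
  rest = trans (sym (dot-unit i (sumS Z ⊕ x))) (subst (λ v → dot (unit i) v ≡ false)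
    (trans (sumS-Δ Z (single x)) (cong (sumS Z ⊕_) (sumS-single x)))
    (sumS∈ (ker (unit i)) {S = Z Δ single x} λ y y∈ →
      let y∈Z , y≢x = Δ-single-∈ Z x x∈ y y∈ in trans (dot-unit i y) (h y y∈Z y≢x)))

lookup-unit-≢ : (i j : Fin n) → unit j ≢ unit i → lookup (unit j) i ≡ false
lookup-unit-≢ i j ne = ≢true⇒≡false (λ h → ⊥-elim (ne (cong unit (lookup-unit⁻ j i h))))

-- Coordinate i is nonzero only at `unit i` and at 𝟙. A nonempty subset that misses one of the
-- points therefore has a coordinate carried by exactly one of its members, and its sum is not 𝟘.
standard-circuit : {P : PSet n} → 2 ≤ n → (∀ i → unit i ∈ P) → 𝟙 ∈ P → (∀ x → x ∈ P → (∃ λ i → x ≡ unit i) ⊎ x ≡ 𝟙) →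
  IsCircuit P
standard-circuit {n} {P} 2≤n units 𝟙∈ only = dependent-P , proper
  where
  unit≢𝟙 : ∀ i → unit i ≢ 𝟙
  unit≢𝟙 i e with some-false (unit i) (subst (_< n) (sym (count-unit i)) 2≤n)
  ... | j , ej = contradict (trans (cong (λ v → lookup v j) (sym e)) ej) (lookup-replicate j true)

  is-unit : ∀ x → x ∈ P → x ≢ 𝟙 → ∃ λ i → x ≡ unit i
  is-unit x x∈ x≢𝟙 = [ id , (λ e → ⊥-elim (x≢𝟙 e)) ]′ (only x x∈)

  vanishing : ∀ y i → y ∈ P → y ≢ 𝟙 → y ≢ unit i → lookup y i ≡ false
  vanishing y i y∈ y≢𝟙 y≢ with is-unit y y∈ y≢𝟙
  ... | j , refl = lookup-unit-≢ i j y≢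

  dependent-P : ¬ Indep P
  dependent-P ind = ind P (λ _ h → h) (𝟙 , 𝟙∈) (trans (sym (⊕-cancel 𝟙 (sumS P)))
      (trans (cong (𝟙 ⊕_) (trans (⊕-comm 𝟙 (sumS P))
        (trans (sym (trans (sumS-Δ P (single 𝟙)) (cong (sumS P ⊕_) (sumS-single 𝟙)))) sum-units)))
        (⊕-self 𝟙)))
    where
    U = P Δ single 𝟙
    U⊆ : ∀ y → y ∈ U → y ∈ P × y ≢ 𝟙
    U⊆ = Δ-single-∈ P 𝟙 𝟙∈
    unit∈U : ∀ i → unit i ∈ U
    unit∈U i = cong₂ _xor_ (units i) (≢true⇒≡false (λ h → ⊥-elim (unit≢𝟙 i (single⇒≡ h))))
    sum-units : sumS U ≡ 𝟙
    sum-units = lookup-ext _ _ λ i → trans (coordinate-of-sum i (unit∈U i)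
        (λ y y∈ y≢ → let y∈P , y≢𝟙 = U⊆ y y∈ in vanishing y i y∈P y≢𝟙 y≢))
      (trans (lookup-unit i) (sym (lookup-replicate i true)))

  proper : ∀ X → X ⊆ P → (∃ λ e → e ∈ P × e ∉ X) → Indep X
  proper X X⊆P (e , e∈ , e∉) Z Z⊆X (z , z∈) sZ = go (Z 𝟙) refl
    where
    Z⊆P : ∀ y → y ∈ Z → y ∈ P
    Z⊆P y h = X⊆P y (Z⊆X y h)
    vanishes : ∀ i {x} → lookup (sumS Z) i ≡ lookup x i → lookup x i ≡ true → ⊥
    vanishes i eq xi = contradict (trans (sym eq) (trans (cong (λ v → lookup v i) sZ) (lookup-replicate i false))) xi
    go : ∀ c → Z 𝟙 ≡ c → ⊥
    go false Z𝟙 with is-unit z (Z⊆P z z∈) (λ { refl → contradict Z𝟙 z∈ })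
    ... | i , refl = vanishes i {unit i} (coordinate-of-sum i z∈ λ y y∈ y≢ →
            vanishing y i (Z⊆P y y∈) (λ { refl → contradict Z𝟙 y∈ }) y≢) (lookup-unit i)
    go true Z𝟙 with is-unit e e∈ (λ { refl → contradict e∉ (Z⊆X 𝟙 Z𝟙) })
    ... | i , refl = vanishes i {𝟙} (coordinate-of-sum i Z𝟙 λ y y∈ y≢ →
            vanishing y i (Z⊆P y y∈) y≢ λ { refl → contradict e∉ (Z⊆X y y∈) }) (lookup-replicate i true)

-- Bases of one colour and the final decision

spanning-points : {G : Pt n → Set} → 1 ≤ n → ¬ Sep G full → ∀ m → m ≤ n → ¬ ¬ (∃ λ (vs : Vec (Pt n) m) → All G vs × Ind vs)
spanning-points _ ns zero _ ret = ret ([] , [] , λ { [] _ → refl })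
spanning-points {n} {G} 1≤n ns (suc m) m<n ret = spanning-points 1≤n ns m (≤-trans (n≤1+n m) m<n) λ (vs , vs∈ , ind) →
  let χ , χ≢𝟘 , kill = homogeneous-solution (toList vs) (subst (_< n) (sym (length-toList vs)) m<n)
      vs∈ker = to-ker χ vs kill
  in em {P = ∃ λ g → G g × dot χ g ≡ true} λ where
    (yes (g , gG , χg)) → ret (g ∷ vs , gG ∷ vs∈ , extend-Ind (ker χ) vs∈ker (λ h → contradict h χg) ind)
    -- All of G would lie in `ker χ`, which together with 0 separates the whole space.
    (no none) →
      let i , χi = nonzero-coordinate χ χ≢𝟘
          ui = trans (dot-comm χ (unit i)) (trans (dot-unit i χ) χi)
      in ns record
        { A = ker χ ; B = nil ; disjoint = λ _ _ e → e
        ; A-proper = unit i , tt , (λ h → contradict h ui)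
        ; B-proper = unit i , tt , unit≢𝟘 i
        ; cover = λ {x} _ gx → inj₁ (≢true⇒≡false (λ h → ⊥-elim (none (x , gx , h)))) }
  where
  to-ker : ∀ {m} χ (vs : Vec (Pt n) m) → kills (toList vs) χ → All (mem (ker χ)) vs
  to-ker χ [] [] = []
  to-ker χ (v ∷ vs) (e ∷ es) = trans (dot-comm χ v) e ∷ to-ker χ vs es

lin-map-Ind : {ws : Vec (Pt n) m} (bs : Vec (Pt l) n) → Ind bs → Ind ws → Ind (map (λ w → lin w bs) ws)
lin-map-Ind {ws = ws} bs indb indw c e = indw c (indb (lin c ws) (trans (lin-lin c ws bs) e))

image-dim : {W : Sub n} (bs : Vec (Pt l) n) → Ind bs → Dim≥ m W → Dim≥ m (image-Sub (lin-linear bs) W)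
image-dim {W = W} bs indb (dim≥ ws∈ indw) = dim≥ (images ws∈) (lin-map-Ind bs indb indw)
  where
  images : ∀ {m} {ws : Vec (Pt _) m} → All (mem W) ws → All (mem (image-Sub (lin-linear bs) W)) (map (λ w → lin w bs) ws)
  images [] = []
  images (w∈ ∷ ws∈) = (_ , w∈ , refl) ∷ images ws∈

-- P may be either colour, so coordinates are chosen anew with respect to a basis inside P;
-- inseparability and the separation of sections are carried along this change of basis.
uniform⇒circuit : {P : PSet n} {R : Pt n → Set} → Setting n (_∈ P) R → Simple P →
  (∀ α → α ≢ 𝟘 → ¬ ¬ Sep (_∈ P) (ker α)) → IsCircuit P
uniform⇒circuit {n} {P} s simple hyperplanes = circuit-stable λ ret →
  spanning-points (≤-trans (m≤m+n 1 5) 6≤n) G-nonsep n ≤-refl λ (bs , bs∈ , ind) →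
    let
      P′ : PSet n
      P′ c = P (lin c bs)

      units : ∀ i → unit i ∈ P′
      units i = subst (_∈ P) (sym (lin-unit i bs)) (AllP.lookup⁺ bs∈ i)

      loopless : ¬ 𝟘 ∈ P′
      loopless h = simple _ h (lin-𝟘 bs)

      nonsep : ¬ Sep (_∈ P′) full
      nonsep sep = G-nonsep (push bs ind sep)

      sections : ∀ W → Dim≥ 4 W → (∃ λ v → ¬ mem W v) → ¬ ¬ Sep (_∈ P′) W
      sections W d (v , v∉) ret = sections-separated s hyperplanes (image-dim {W = W} bs ind d)
        (lin v bs , λ (w , w∈ , e) → v∉ (subst (mem W) (Ind-injective ind e) w∈)) λ sep →
          ret (Sep-preimage (lin-linear bs) (λ {v} _ e → ind v e) (λ _ _ h → h) sep)
    in 𝟙∈G 6≤n units loopless nonsep sections λ 𝟙∈ → ret (circuit-≅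
        (coordinate-iso bs ind P′ (λ _ h → h) λ x x∈ →
          let c , e = Ind⇒spanning bs ind x in c , subst (_∈ P) (sym e) x∈ , e)
        (standard-circuit (≤-trans (m≤m+n 2 4) 6≤n) units 𝟙∈ (only-units 6≤n units loopless nonsep sections 𝟙∈)))
  where
  open Setting s
  push : ∀ bs → Ind bs → Sep (λ c → lin c bs ∈ P) full → Sep (_∈ P) full
  push bs ind sep = record
    { A = image-Sub (lin-linear bs) A ; B = image-Sub (lin-linear bs) B
    ; disjoint = λ { _ (c , cA , refl) (d , dB , e) →
        trans (cong (λ c → lin c bs) (disjoint tt cA (subst (mem B) (Ind-injective ind e) dB))) (lin-𝟘 bs) }
    ; A-proper = proper A A-proper ; B-proper = proper B B-proper
    ; cover = λ {x} _ x∈ → let c , e = Ind⇒spanning bs ind x in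
        Sum.map (λ h → c , h , e) (λ h → c , h , e) (cover tt (subst (_∈ P) (sym e) x∈)) }
    where
    open Sep sep
    proper : ∀ A → (∃ λ v → ⊤ × ¬ mem A v) → ∃ λ x → ⊤ × ¬ mem (image-Sub (lin-linear bs) A) x
    proper A (v , _ , v∉) = lin v bs , tt , λ (w , w∈ , e) → v∉ (subst (mem A) (Ind-injective ind e) w∈)

hyperplanes-alike : {G R : Pt n → Set} → Setting n G R → {α : Pt n} → α ≢ 𝟘 → Sep G (ker α) →
  ∀ β → β ≢ 𝟘 → ¬ ¬ Sep G (ker β)
hyperplanes-alike s α≢𝟘 sep β β≢𝟘 ret = hyperplane-type s β≢𝟘 λ where
  (inj₁ sep′) → ret sep′
  (inj₂ sep′) → uniform-type s α≢𝟘 β≢𝟘 sep sep′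

circuit-or-complement : {S : PSet n} → Setting n (_∈ S) (_∈ compl n S) → Simple S →
  ¬ ¬ (IsCircuit S ⊎ IsCircuit (compl n S))
circuit-or-complement {n} {S} s simple ret = hyperplane-type s α≢𝟘 λ where
    (inj₁ sep) → ret (inj₁ (uniform⇒circuit s simple (hyperplanes-alike s α≢𝟘 sep)))
    (inj₂ sep) → ret (inj₂ (uniform⇒circuit (Setting-swap s) (λ x x∈ → proj₁ (compl∈⁻ {T = S} x∈))
      (hyperplanes-alike (Setting-swap s) α≢𝟘 sep)))
  where
  α≢𝟘 : unit (fromℕ< (≤-trans (m≤m+n 1 5) (Setting.6≤n s))) ≢ 𝟘
  α≢𝟘 = unit≢𝟘 _

triangle-is-all : {P : PSet n} → IsCircuit P → ∀ {u v} → u ∈ P → v ∈ P → (u ⊕ v) ∈ P → u ≢ v → v ≢ 𝟘 →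
  ∀ {e} → e ∈ P → e ≢ u → e ≢ v → e ≢ u ⊕ v → ⊥
triangle-is-all {n} {P} (_ , proper) {u} {v} u∈ v∈ w∈ u≢v v≢𝟘 {e} e∈ e≢u e≢v e≢w =
  proper Z Z⊆P (e , e∈ , cong₂ _xor_ (cong₂ _xor_ (single-≢ e≢u) (single-≢ e≢v)) (single-≢ e≢w))
    Z (λ _ h → h) (u , cong₂ _xor_ (cong₂ _xor_ (single-refl u) (single-≢ u≢v)) (single-≢ (⊕-cancel-≢ {x = u} {v} v≢𝟘)))
    (trans (sumS-Δ (single u Δ single v) (single (u ⊕ v))) (trans (cong₂ _⊕_
      (trans (sumS-Δ (single u) (single v)) (cong₂ _⊕_ (sumS-single u) (sumS-single v))) (sumS-single (u ⊕ v))) (⊕-self (u ⊕ v))))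
  where
  Z : PSet n
  Z = single u Δ single v Δ single (u ⊕ v)
  single-≢ : ∀ {x y : Pt n} → x ≢ y → x ∉ single y
  single-≢ ne = ≢true⇒≡false (λ h → ⊥-elim (ne (single⇒≡ h)))
  at : ∀ {x y} → y ∈ P → x ∈ single y → x ∈ P
  at y∈ h = subst (_∈ P) (sym (single⇒≡ h)) y∈
  Z⊆P : Z ⊆ P
  Z⊆P x h = [ (λ h → [ at u∈ , at v∈ ]′ (Δ-∈ {X = single u} {single v} {x} h)) , at w∈ ]′
    (Δ-∈ {X = single u Δ single v} {single (u ⊕ v)} {x} h)

-- A circuit spanning a space of dimension at least six contains no triangle; so the triangle on the points
-- e₀ + e₁, e₀ + e₂, e₁ + e₂ decides between the two outcomes.
decide-circuit : {S : PSet n} → Setting n (_∈ S) (_∈ compl n S) → Simple S → (∀ i → unit i ∈ S) →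
  IsCircuit S ⊎ IsCircuit (compl n S)
decide-circuit {zero} s _ _ with Setting.6≤n s
... | ()
decide-circuit {suc zero} s _ _ with Setting.6≤n s
... | s≤s ()
decide-circuit {suc (suc zero)} s _ _ with Setting.6≤n s
... | s≤s (s≤s ())
decide-circuit {n@(suc (suc (suc m)))} {S} s simple units =
  cases (S p₀₁) refl (S p₀₂) refl (S p₁₂) refl
  where
  i₀ i₁ i₂ : Fin n
  i₀ = zero
  i₁ = suc zero
  i₂ = suc (suc zero)
  p₀₁ p₀₂ p₁₂ : Pt n
  p₀₁ = unit i₀ ⊕ unit i₁
  p₀₂ = unit i₀ ⊕ unit i₂
  p₁₂ = unit i₁ ⊕ unit i₂

  -- Two units and their sum form a triangle, and `unit l` is a further point of S.
  triangle-in-S : ∀ {i j} l → (unit i ⊕ unit j) ∈ S → unit i ≢ unit j → unit l ≢ unit i → unit l ≢ unit j →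
    unit l ≢ unit i ⊕ unit j → ¬ IsCircuit S
  triangle-in-S {i} {j} l p∈ i≢j l≢i l≢j l≢p circuit =
    triangle-is-all circuit (units i) (units j) p∈ i≢j (unit≢𝟘 j) (units l) l≢i l≢j l≢p

  not-S : ¬ IsCircuit S → IsCircuit (compl n S)
  not-S ¬S = circuit-stable λ ret → circuit-or-complement s simple λ where
    (inj₁ c) → ¬S c
    (inj₂ c) → ret c

  triangle-in-compl : p₀₁ ∈ compl n S → p₀₂ ∈ compl n S → p₁₂ ∈ compl n S → ¬ IsCircuit (compl n S)
  triangle-in-compl a b c circuit = em {P = ∃ λ e → e ∈ compl n S × ¬ mem D e} λ where
      (yes (e , e∈ , e∉)) → triangle-is-all circuit {p₀₁} {p₀₂} a b (subst (_∈ compl n S) p₁₂≡ c) (λ ()) (λ ()) e∈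
        (λ { refl → e∉ (true ∷ false ∷ [] , trans (cong (p₀₁ ⊕_) (⊕-idˡ 𝟘)) (⊕-idʳ p₀₁)) })
        (λ { refl → e∉ (false ∷ true ∷ [] , trans (⊕-idˡ _) (⊕-idʳ p₀₂)) })
        (λ { refl → e∉ (true ∷ true ∷ [] , cong (p₀₁ ⊕_) (⊕-idʳ p₀₂)) })
      -- The complement cannot be confined to the plane D of the triangle: D is a proper subspace,
      -- and with 0 it would separate R.
      (no none) → decide-Sub D λ D? → em {P = ∃ λ v → ¬ mem D v} λ where
        (no all) → dim-escape {W = full} (p₀₁ ∷ p₀₂ ∷ []) (dim-≤ {W = full} (m≤m+n 3 m) dim-full)
          λ {x} _ → decidable-stable (D? x) λ x∉ → all (x , x∉)
        (yes (v , v∉)) → Setting.R-nonsep s record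
          { A = D ; B = nil ; disjoint = λ _ _ e → e ; A-proper = v , tt , v∉
          ; B-proper = v , tt , (λ { refl → v∉ (𝟘∈ D) })
          ; cover = λ {x} _ x∈ → inj₁ (decidable-stable (D? x) λ x∉ → none (x , x∈ , x∉)) }
    where
    D = span (p₀₁ ∷ p₀₂ ∷ [])
    p₁₂≡ : p₁₂ ≡ p₀₁ ⊕ p₀₂
    p₁₂≡ = solve (unit i₀ ∷ unit i₁ ∷ unit i₂ ∷ []) (v₁ :+ v₂) (v₀ :+ v₁ :+ (v₀ :+ v₂)) refl

  cases : ∀ a → S p₀₁ ≡ a → ∀ b → S p₀₂ ≡ b → ∀ c → S p₁₂ ≡ c → IsCircuit S ⊎ IsCircuit (compl n S)
  cases true e _ _ _ _ = inj₂ (not-S (triangle-in-S {i₀} {i₁} i₂ e (λ ()) (λ ()) (λ ()) λ ()))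
  cases false _ true e _ _ = inj₂ (not-S (triangle-in-S {i₀} {i₂} i₁ e (λ ()) (λ ()) (λ ()) λ ()))
  cases false _ false _ true e = inj₂ (not-S (triangle-in-S {i₁} {i₂} i₀ e (λ ()) (λ ()) (λ ()) λ ()))
  cases false a false b false c = inj₁ (circuit-stable λ ret → circuit-or-complement s simple λ where
    (inj₁ circuit) → ret circuit
    (inj₂ circuit) → triangle-in-compl (compl∈ {T = S} (λ ()) a) (compl∈ {T = S} (λ ()) b) (compl∈ {T = S} (λ ()) c) circuit)

-- Two coordinatizations of T differ by a linear map, so their complements are isomorphic.
compl-≅ : {T : PSet k} (bs : Vec (Pt k) n) → Ind bs → All (_∈ T) bs → {S′ : PSet n} → T ≅ S′ →
  compl n S′ ≅ compl n (λ c → T (lin c bs))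
compl-≅ {k} {n} {T} bs ind bs∈ {S′} I = coordinate-iso vs ind-vs (compl n S)
    (λ c h → let c≢𝟘 , c∉ = compl∈⁻ {T = S} h in compl∈ {T = S′} (λ e → c≢𝟘 (ind-vs c e))
      (≢true⇒≡false (λ h → contradict c∉ (subst (_∈ T) (graph-injective I (graph-∈′ I h) (graph-lin c bs bs∈)) (g∈ _ h)))))
    λ x h → let x≢𝟘 , x∉ = compl∈⁻ {T = S′} h
                c , e = Ind⇒spanning vs ind-vs x
            in c , compl∈ {T = S} {c} (λ z → x≢𝟘 (trans (sym e) (trans (cong (λ c → lin c vs) z) (lin-𝟘 vs))))
                 (≢true⇒≡false (λ h → contradict x∉ (subst (_∈ S′)
                   (trans (graph-functional I (graph-∈ I h) (graph-lin c bs bs∈)) e) (f∈ _ h)))) , e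
  where
  open _≅_ I
  S : PSet n
  S c = T (lin c bs)
  vs : Vec (Pt n) n
  vs = map f bs
  graph-lin : ∀ {m} (c : Vec Bool m) (bs : Vec (Pt k) m) → All (_∈ T) bs → Graph I (lin c bs) (lin c (map f bs))
  graph-lin [] [] [] = graph-𝟘 I
  graph-lin (true ∷ c) (b ∷ bs) (b∈ ∷ bs∈) = graph-⊕ I (graph-∈ I b∈) (graph-lin c bs bs∈)
  graph-lin (false ∷ c) (b ∷ bs) (b∈ ∷ bs∈) = graph-⊕ I (graph-𝟘 I) (graph-lin c bs bs∈)
  ind-vs : Ind vs
  ind-vs c e = ind c (graph-zeroʳ I (subst (Graph I _) e (graph-lin c bs bs∈)))

theorem4p7 : ∀ {k} (T : PSet k) → Simple T → ¬ Comat T →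
    (∀ F → ProperFlat T F → Comat F) →
    ∀ r → Rank T r → 6 ≤ r →
    IsCircuit T ⊎ (∀ (S : PSet r) → Simple S → T ≅ S → IsCircuit (compl r S))
theorem4p7 T simple ¬comat flats r rank 6≤r =
  let bs , ind , bs∈ , spans = spanning-basis rank
      T≅S = coordinates simple ¬comat flats 6≤r bs ind bs∈ spans
  in Sum.map (circuit-≅ T≅S) (λ circuit S′ _ I → circuit-≅ (compl-≅ bs ind bs∈ I) circuit)
       (decide-circuit (setting simple ¬comat flats 6≤r bs ind bs∈ spans)
         (S-loopless simple ¬comat flats 6≤r bs ind bs∈ spans)
         λ i → subst (_∈ T) (sym (lin-unit i bs)) (AllP.lookup⁺ bs∈ i))
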